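{- The following decision problem is NP-hard: given a triangle-free graph $G$, decide whether $G$ is perfectly divisible.
   Context: All graphs are finite and simple. A graph is triangle-free if it contains no clique on three vertices. For $S\subseteq V(G)$, $G[S]$ is the subgraph induced by $S$. $\omega(G)$ is the number of vertices in a largest clique of $G$ and $\chi(G)$ the chromatic number. A graph $G$ is perfect if $\chi(H)=\omega(H)$ for every induced subgraph $H$ of $G$. A partition $(A,B)$ of $V(G)$ is good if $G[A]$ is perfect and $\omega(G[B])<\omega(G)$. A graph $G$ is perfectly divisible if every induced subgraph $H$ of $G$ with at least one edge admits a good partition (of $V(H)$). -}

module Defs where

open import Data.Bool using (Bool; true; false)
open import Data.Fin using (Fin; zero; suc; _↑ʳ_)
open import Data.Fin.Subset using (Subset; inside; outside; _∈_; ∣_∣; ∁)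
open import Data.List using (List; []; _∷_; length; concat; tabulate)
import Data.List as List
open import Data.Maybe using (Maybe; just; nothing)
import Data.Maybe as Maybe
open import Data.Nat using (ℕ; zero; suc; _+_; _*_; _≤_; _<_)
open import Data.Product using (Σ; ∃; ∃-syntax; _×_; _,_; proj₁)
open import Data.Vec using (Vec; []; _∷_; _++_; lookup; map; replicate; zipWith; head; sum)
open import Function using (_∘_)
open import Function.Bundles using (_⇔_)
open import Relation.Binary.PropositionalEquality using (_≡_; _≢_)

------------------------------------------------------------------------
-- Graphs

record Graph : Set where
  field
    order  : ℕ
    adj    : Fin order → Fin order → Bool
    sym    : ∀ u v → adj u v ≡ adj v u
    irrefl : ∀ u → adj u u ≡ false

open Graph public

-- The members of a subset, in increasing order.
elements : ∀ {n} (S : Subset n) → Vec (Fin n) ∣ S ∣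
elements []            = []
elements (inside ∷ S)  = zero ∷ map suc (elements S)
elements (outside ∷ S) = map suc (elements S)

-- G [ S ]: vertex i of the induced subgraph is the i-th element of S.
_[_] : (G : Graph) → Subset (order G) → Graph
G [ S ] = record
  { order  = ∣ S ∣
  ; adj    = λ i j → adj G (vertex i) (vertex j)
  ; sym    = λ i j → sym G (vertex i) (vertex j)
  ; irrefl = λ i → irrefl G (vertex i)
  }
  where
  vertex : Fin ∣ S ∣ → Fin (order G)
  vertex = lookup (elements S)

HasEdge : Graph → Set
HasEdge G = ∃[ u ] ∃[ v ] adj G u v ≡ true

IsClique : (G : Graph) → Subset (order G) → Set
IsClique G K = ∀ {u v} → u ∈ K → v ∈ K → u ≢ v → adj G u v ≡ true

TriangleFree : Graph → Set
TriangleFree G = ∀ K → IsClique G K → ∣ K ∣ ≢ 3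

-- ω(G) = k
IsCliqueNumber : Graph → ℕ → Set
IsCliqueNumber G k =
  (∃[ K ] IsClique G K × ∣ K ∣ ≡ k) × (∀ K → IsClique G K → ∣ K ∣ ≤ k)

Colourable : Graph → ℕ → Set
Colourable G k =
  Σ (Fin (order G) → Fin k) λ c → ∀ u v → adj G u v ≡ true → c u ≢ c v

-- χ(G) = k
IsChromaticNumber : Graph → ℕ → Set
IsChromaticNumber G k = Colourable G k × (∀ j → Colourable G j → k ≤ j)

Perfect : Graph → Set
Perfect G = ∀ (S : Subset (order G)) →
  ∃[ k ] IsChromaticNumber (G [ S ]) k × IsCliqueNumber (G [ S ]) k

_ω<_ : Graph → Graph → Set
H ω< G = ∃[ k ] ∃[ l ] IsCliqueNumber H k × IsCliqueNumber G l × k < l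

-- (A , ∁ A) is a good partition.
Good : (G : Graph) → Subset (order G) → Set
Good G A = Perfect (G [ A ]) × (G [ ∁ A ]) ω< G

PerfectlyDivisible : Graph → Set
PerfectlyDivisible G = ∀ (S : Subset (order G)) →
  HasEdge (G [ S ]) → ∃[ A ] Good (G [ S ]) A

------------------------------------------------------------------------
-- Deterministic multitape Turing machines

Word : Set
Word = List Bool

data Symbol (a : ℕ) : Set where
  blank : Symbol a
  bit   : Bool → Symbol a
  aux   : Fin a → Symbol a

data Move : Set where
  left stay right : Move

-- A two-way infinite tape.  Both lists start next to the head; every cell
-- beyond their ends is blank.
record Tape (a : ℕ) : Set where
  constructor tape
  field
    before  : List (Symbol a)
    scanned : Symbol a
    after   : List (Symbol a)

open Tape public

fromList : ∀ {a} → List (Symbol a) → List (Symbol a) → Tape a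
fromList ls []       = tape ls blank []
fromList ls (s ∷ rs) = tape ls s rs

move : ∀ {a} → Move → Tape a → Tape a
move stay  t                    = t
move right (tape ls s rs)       = fromList (s ∷ ls) rs
move left  (tape []       s rs) = tape [] blank (s ∷ rs)
move left  (tape (l ∷ ls) s rs) = tape ls l (s ∷ rs)

act : ∀ {a} → Tape a → Symbol a × Move → Tape a
act t (s , m) = move m (record t { scanned = s })

inputTape : ∀ {a} → Word → Tape a
inputTape w = fromList [] (List.map bit w)

leadingBits : ∀ {a} → List (Symbol a) → Word
leadingBits (bit b ∷ ss) = b ∷ leadingBits ss
leadingBits _            = []

-- A machine has m input tapes, followed by one output tape and any number
-- of work tapes.  It halts when δ returns nothing.
record TM (m : ℕ) : Set where
  field
    states     : ℕ
    auxSymbols : ℕ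
    workTapes  : ℕ

  tapes : ℕ
  tapes = m + suc workTapes

  field
    start : Fin states
    δ     : Fin states → Vec (Symbol auxSymbols) tapes →
            Maybe (Fin states × Vec (Symbol auxSymbols × Move) tapes)

  Config : Set
  Config = Fin states × Vec (Tape auxSymbols) tapes

  initial : Vec Word m → Config
  initial ws = start , map inputTape ws ++ replicate (suc workTapes) (inputTape [])

  step : Config → Maybe Config
  step (q , ts) =
    Maybe.map (λ (q′ , as) → q′ , zipWith act ts as) (δ q (map scanned ts))

  -- c ⇓[ t ] d: started in c, the machine halts in d after exactly t steps.
  data _⇓[_]_ : Config → ℕ → Config → Set where
    halted : ∀ {c} → step c ≡ nothing → c ⇓[ 0 ] c
    next   : ∀ {c c′ d t} → step c ≡ just c′ → c′ ⇓[ t ] d → c ⇓[ suc t ] d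

  -- The maximal block of bits on the output tape starting at the head.
  output : Config → Word
  output (_ , ts) = leadingBits (scanned out ∷ after out)
    where
    out : Tape auxSymbols
    out = lookup ts (m ↑ʳ zero)

------------------------------------------------------------------------
-- Polynomial time, NP and NP-hardness

-- Coefficients, constant term first.
Polynomial : Set
Polynomial = List ℕ

eval : Polynomial → ℕ → ℕ
eval []      n = 0
eval (a ∷ p) n = a + n * eval p n

PolyTime : ∀ {m} → (Vec Word m → Word) → Set
PolyTime {m} f =
  Σ (TM m) λ M → Σ Polynomial λ p → let open TM M in
  ∀ ws → ∃[ t ] ∃[ d ]
    (initial ws ⇓[ t ] d) × t ≤ eval p (sum (map length ws)) × output d ≡ f ws

Language : Set₁
Language = Word → Set

-- V (x , u) = true means that u is a certificate for x.
NP : Language → Set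
NP L =
  Σ (Word → Word → Bool) λ V → Σ Polynomial λ p →
    PolyTime {2} (λ { (x ∷ u ∷ []) → V x u ∷ [] }) ×
    (∀ x → L x ⇔ (∃[ u ] length u ≤ eval p (length x) × V x u ≡ true))

record DecisionProblem : Set₁ where
  field
    Instance : Set
    encode   : Instance → Word
    Yes      : Instance → Set

-- Polynomial-time many-one reducibility.
_≤ₚ_ : Language → DecisionProblem → Set
L ≤ₚ P = let open DecisionProblem P in
  Σ (Word → Instance) λ f →
    PolyTime {1} (λ ws → encode (f (head ws))) × (∀ x → L x ⇔ Yes (f x))

NPHard : DecisionProblem → Set₁
NPHard P = ∀ (L : Language) → NP L → L ≤ₚ P

-- The adjacency matrix, row by row; its length n² determines the order n.
encodeGraph : Graph → Word
encodeGraph G = concat (tabulate λ u → tabulate λ v → adj G u v)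

TriangleFreePerfectDivisibility : DecisionProblem
TriangleFreePerfectDivisibility = record
  { Instance = Σ Graph TriangleFree
  ; encode   = encodeGraph ∘ proj₁
  ; Yes      = PerfectlyDivisible ∘ proj₁
  }

{-# OPTIONS --safe #-}
module Submission where

-- A triangle-free graph is perfectly divisible iff it is 3-colourable: in a good partition of an
-- induced subgraph with an edge, one side is bipartite and the other edgeless.
--
-- To reduce a language in NP to 3-colouring, write the run of its verifier M on (x , u) as a tiling
-- of a W × W grid, W polynomial in the length of x.  Row t describes step t relative to the heads:
-- the tile in column s holds the cells at distance s + 1 on either side of the heads and of their
-- neighbours, together with the state and the scanned symbols.  So the tiles are finitely many, and
-- whether a tiling is a run that halts accepting is a matter of adjacent tiles and of the border.
-- The certificate u appears in row 0 as a free choice of tiles.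
--
-- In the graph, each site of the grid has a vertex for every tile.  The tile is chosen if this
-- vertex has the colour of petal 0, and each site leaves one other colour to its remaining vertices,
-- alternating in a chequerboard, so that edges between neighbouring sites can exclude incompatible
-- tiles.  An odd cycle matched with the vertices of a site cannot be coloured if none is chosen.
-- The colours come from the Grötzsch graph without an edge, which forces two non-adjacent vertices
-- to share a colour without creating a triangle.
--
-- An entry of the adjacency matrix depends only on the classes of the two rows and columns and on
-- their distances if at most 1.  Hence a machine can print the matrix by walking over copies of a
-- ruler that lists the classes, while two tapes with three marked cells report the distances.

open import Defs hiding (sym)
open import Data.Bool using (Bool; true; false; not; _xor_; if_then_else_; T)
import Data.Bool.Properties as Bool
open import Data.Empty using (⊥; ⊥-elim)
open import Data.Fin using (Fin; zero; suc; toℕ; fromℕ<; splitAt; join; combine; remQuot; _↑ˡ_; _↑ʳ_; #_)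
import Data.Fin as Fin
import Data.Fin.Properties as Fin
open import Data.List using (List; []; _∷_; length; _++_; _ʳ++_; concat; tabulate)
import Data.List as List
import Data.List.Properties as List
open import Data.Maybe using (Maybe; just; nothing; maybe)
import Data.Maybe as Maybe
open import Data.Nat using (ℕ; zero; suc; _+_; _*_; _≤_; _<_; z≤n; s≤s; _<ᵇ_; _≡ᵇ_; _≤?_; _<?_)
import Data.Nat as ℕ
import Data.Nat.Properties as ℕ
open import Data.Product as Product using (∃-syntax; _×_; _,_; proj₁; proj₂; uncurry; map₁)
open import Data.Sum as Sum using (_⊎_; inj₁; inj₂; [_,_]′; swap)
open import Data.Unit using (⊤; tt)
open import Data.Vec using (Vec; []; _∷_; lookup; map; zipWith; replicate; head; updateAt; _[_]≔_; here; there)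
import Data.Vec as Vec
import Data.Vec.Properties as Vec
import Data.Vec.Relation.Binary.Pointwise.Extensional as Ext
open import Data.Vec.Relation.Unary.All using (All; []; _∷_)
import Data.Vec.Relation.Unary.All.Properties as All
open import Function using (_∘_; const; case_of_; mk⇔; Equivalence)
open import Relation.Binary.Definitions using (DecidableEquality; tri<; tri≈; tri>)
open import Relation.Binary.PropositionalEquality
  using (_≡_; _≢_; refl; sym; trans; cong; cong₂; subst; subst₂; ≢-sym; _≗_)
open import Relation.Nullary using (Dec; yes; no; ¬_; does; ¬?; contradiction)
open import Relation.Nullary.Decidable
  using (_×-dec_; _→-dec_; _⊎-dec_; decidable-stable; from-yes; dec-true; map′)

-- Triangle-freeness shapes the gadgets: the usual palette of a 3-colouring reduction is a triangle,
-- and vertices restrained by a common palette vertex must not be adjacent. The chequerboard answers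
-- two needs at once. Unchosen vertices of neighbouring sites get different colours, so an edge
-- between two of them forbids only that both be chosen; and the ends of such an edge are restrained
-- by different petals. The frame that moves with the heads is due to the number of tapes. Over a
-- fixed grid several heads would wander independently; relative to its head each tape merely shifts
-- by at most one cell, and every tile can hold the full argument of `δ`. The reduction must be
-- carried out by a concrete machine, hence the uniformity of the graph: every site has the same
-- vertices, including those of inadmissible tiles and an idle copy of the palette, so the matrix is
-- printed by nested loops and no vertex number is ever decoded.

module FiniteTypes where

  -- Only one half of a bijection is asked for. It already gives decidable equality and an
  -- enumeration that misses nothing; a repeated element would at worst become a pair of twin
  -- vertices in the graph.
  record Finite (A : Set) : Set where
    field
      size    : ℕ
      to      : A → Fin size
      from    : Fin size → A
      from∘to : ∀ x → from (to x) ≡ x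

    decEq : DecidableEquality A
    decEq x y = map′ (λ eq → trans (sym (from∘to x)) (trans (cong from eq) (from∘to y)))
                     (cong to) (to x Fin.≟ to y)

  open Finite

  finite-retract : ∀ {A B : Set} (f : A → B) (g : B → A) → (∀ x → g (f x) ≡ x) → Finite B → Finite A
  finite-retract f g gf B = record
    { size = size B ; to = λ x → to B (f x) ; from = λ i → g (from B i)
    ; from∘to = λ x → trans (cong g (from∘to B (f x))) (gf x) }

  finite-Fin : ∀ n → Finite (Fin n)
  finite-Fin n = record { size = n ; to = λ i → i ; from = λ i → i ; from∘to = λ _ → refl }

  finite-⊎ : ∀ {A B : Set} → Finite A → Finite B → Finite (A ⊎ B)
  finite-⊎ {A} {B} F G = record
    { size = size F + size G
    ; to = λ x → join (size F) (size G) (Sum.map (to F) (to G) x)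
    ; from = λ i → Sum.map (from F) (from G) (splitAt (size F) i)
    ; from∘to = λ x → trans
        (cong (Sum.map (from F) (from G)) (Fin.splitAt-join (size F) (size G) (Sum.map (to F) (to G) x)))
        (retract x) }
    where
    retract : ∀ x → Sum.map (from F) (from G) (Sum.map (to F) (to G) x) ≡ x
    retract (inj₁ x) = cong inj₁ (from∘to F x)
    retract (inj₂ y) = cong inj₂ (from∘to G y)

  finite-× : ∀ {A B : Set} → Finite A → Finite B → Finite (A × B)
  finite-× {A} {B} F G = record
    { size = size F * size G
    ; to = λ { (x , y) → combine (to F x) (to G y) }
    ; from = λ i → Product.map (from F) (from G) (remQuot {size F} (size G) i)
    ; from∘to = λ { (x , y) → trans
        (cong (Product.map (from F) (from G)) (Fin.remQuot-combine (to F x) (to G y)))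
        (cong₂ _,_ (from∘to F x) (from∘to G y)) } }

  finite-Maybe : ∀ {A : Set} → Finite A → Finite (Maybe A)
  finite-Maybe F = finite-retract
    (λ { nothing → inj₁ zero ; (just x) → inj₂ x })
    (λ { (inj₁ _) → nothing ; (inj₂ x) → just x })
    (λ { nothing → refl ; (just _) → refl })
    (finite-⊎ (finite-Fin 1) F)

  finite-Bool : Finite Bool
  finite-Bool = finite-retract
    (λ { false → zero ; true → suc zero })
    (λ { zero → false ; (suc _) → true })
    (λ { false → refl ; true → refl })
    (finite-Fin 2)

  finite-Vec : ∀ {A : Set} → Finite A → ∀ n → Finite (Vec A n)
  finite-Vec F zero = finite-retract (λ _ → zero) (λ _ → []) (λ { [] → refl }) (finite-Fin 1)
  finite-Vec F (suc n) = finite-retract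
    (λ { (x ∷ xs) → x , xs }) (λ { (x , xs) → x ∷ xs }) (λ { (_ ∷ _) → refl })
    (finite-× F (finite-Vec F n))

  finite-Symbol : ∀ a → Finite (Symbol a)
  finite-Symbol a = finite-retract
    (λ { blank → nothing ; (bit b) → just (inj₁ b) ; (aux i) → just (inj₂ i) })
    (λ { nothing → blank ; (just (inj₁ b)) → bit b ; (just (inj₂ i)) → aux i })
    (λ { blank → refl ; (bit _) → refl ; (aux _) → refl })
    (finite-Maybe (finite-⊎ finite-Bool (finite-Fin a)))

  finite-⊤ : Finite ⊤
  finite-⊤ = finite-retract (λ _ → zero) (λ _ → tt) (λ _ → refl) (finite-Fin 1)

-- Perfect divisibility and 3-colourability of triangle-free graphs

module PerfectDivisibility where

  open import Data.Fin.Subset using (Subset; inside; outside; _∈_; _∉_; ∣_∣; ∁)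
  import Data.Fin.Subset as Subset
  import Data.Fin.Subset.Properties as Subset

  lookup-elements∈ : ∀ {n} (S : Subset n) i → lookup (elements S) i ∈ S
  lookup-elements∈ (inside  ∷ S) zero    = here
  lookup-elements∈ (inside  ∷ S) (suc i) =
    subst (_∈ inside ∷ S) (sym (Vec.lookup-map i suc (elements S))) (there (lookup-elements∈ S i))
  lookup-elements∈ (outside ∷ S) i =
    subst (_∈ outside ∷ S) (sym (Vec.lookup-map i suc (elements S))) (there (lookup-elements∈ S i))

  lookup-injective-map : ∀ {m n} (xs : Vec (Fin n) m) {i j} →
    lookup (map suc xs) i ≡ lookup (map suc xs) j → lookup xs i ≡ lookup xs j
  lookup-injective-map xs {i} {j} eq = Fin.suc-injective
    (trans (sym (Vec.lookup-map i suc xs)) (trans eq (Vec.lookup-map j suc xs)))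

  lookup-elements-injective : ∀ {n} (S : Subset n) {i j} →
    lookup (elements S) i ≡ lookup (elements S) j → i ≡ j
  lookup-elements-injective (inside ∷ S) {zero}  {zero}  eq = refl
  lookup-elements-injective (inside ∷ S) {zero}  {suc j} eq
    with () ← trans eq (Vec.lookup-map j suc (elements S))
  lookup-elements-injective (inside ∷ S) {suc i} {zero}  eq
    with () ← trans (sym eq) (Vec.lookup-map i suc (elements S))
  lookup-elements-injective (inside ∷ S) {suc i} {suc j} eq =
    cong suc (lookup-elements-injective S (lookup-injective-map (elements S) eq))
  lookup-elements-injective (outside ∷ S) eq =
    lookup-elements-injective S (lookup-injective-map (elements S) eq)

  index : ∀ {n} {S : Subset n} {v} → v ∈ S → ∃[ i ] lookup (elements S) i ≡ v
  index here = zero , refl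
  index {S = inside ∷ S} (there v∈S) with i , eq ← index v∈S =
    suc i , trans (Vec.lookup-map i suc (elements S)) (cong suc eq)
  index {S = outside ∷ S} (there v∈S) with i , eq ← index v∈S =
    i , trans (Vec.lookup-map i suc (elements S)) (cong suc eq)

  insert : ∀ {n} → Fin n → Subset n → Subset n
  insert zero    (_ ∷ S) = inside ∷ S
  insert (suc v) (s ∷ S) = s ∷ insert v S

  ∣insert∣ : ∀ {n} (v : Fin n) S → v ∉ S → ∣ insert v S ∣ ≡ suc ∣ S ∣
  ∣insert∣ zero    (inside  ∷ S) v∉S = ⊥-elim (v∉S here)
  ∣insert∣ zero    (outside ∷ S) v∉S = refl
  ∣insert∣ (suc v) (inside  ∷ S) v∉S = cong suc (∣insert∣ v S (v∉S ∘ there))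
  ∣insert∣ (suc v) (outside ∷ S) v∉S = ∣insert∣ v S (v∉S ∘ there)

  ∈-insert : ∀ {n} (v : Fin n) S {u} → u ∈ insert v S → u ≡ v ⊎ u ∈ S
  ∈-insert zero    (_ ∷ S) here        = inj₁ refl
  ∈-insert zero    (_ ∷ S) (there u∈S) = inj₂ (there u∈S)
  ∈-insert (suc v) (_ ∷ S) here        = inj₂ here
  ∈-insert (suc v) (_ ∷ S) (there u∈)  with ∈-insert v S u∈
  ... | inj₁ refl = inj₁ refl
  ... | inj₂ u∈S  = inj₂ (there u∈S)

  module _ (G : Graph) where

    adj⇒≢ : ∀ {u v} → adj G u v ≡ true → u ≢ v
    adj⇒≢ {u} uv refl with () ← trans (sym uv) (irrefl G u)

    insert-clique : ∀ {K v} → IsClique G K → (∀ {u} → u ∈ K → adj G v u ≡ true) →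
      IsClique G (insert v K) × ∣ insert v K ∣ ≡ suc ∣ K ∣
    insert-clique {K} {v} clique joined =
      clique′ , ∣insert∣ v K λ v∈K → adj⇒≢ (joined v∈K) refl
      where
      clique′ : IsClique G (insert v K)
      clique′ a∈ b∈ a≢b with ∈-insert v K a∈ | ∈-insert v K b∈
      ... | inj₁ refl | inj₁ refl = ⊥-elim (a≢b refl)
      ... | inj₁ refl | inj₂ b∈K  = joined b∈K
      ... | inj₂ a∈K  | inj₁ refl = trans (Graph.sym G _ _) (joined a∈K)
      ... | inj₂ a∈K  | inj₂ b∈K  = clique a∈K b∈K a≢b

    ∅-clique : IsClique G Subset.⊥
    ∅-clique u∈ = ⊥-elim (Subset.∉⊥ u∈)

    singleton-clique : ∀ v → ∃[ K ] IsClique G K × ∣ K ∣ ≡ 1 × (∀ {u} → u ∈ K → u ≡ v)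
    singleton-clique v
      with clique , size ← insert-clique {v = v} ∅-clique (λ u∈ → ⊥-elim (Subset.∉⊥ u∈)) =
      insert v Subset.⊥ , clique , trans size (cong suc (Subset.∣⊥∣≡0 (order G))) , only
      where
      only : ∀ {u} → u ∈ insert v Subset.⊥ → u ≡ v
      only u∈ with ∈-insert v Subset.⊥ u∈
      ... | inj₁ u≡v = u≡v
      ... | inj₂ u∈⊥ = ⊥-elim (Subset.∉⊥ u∈⊥)

    edge-clique : ∀ {u v} → adj G u v ≡ true →
      ∃[ K ] IsClique G K × ∣ K ∣ ≡ 2 × (∀ {x} → x ∈ K → x ≡ u ⊎ x ≡ v)
    edge-clique {u} {v} uv
      with K , clique , size , only ← singleton-clique v
      with clique′ , size′ ← insert-clique {v = u} clique
             (λ x∈ → subst (λ x → adj G u x ≡ true) (sym (only x∈)) uv) =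
      insert u K , clique′ , trans size′ (cong suc size) , ends
      where
      ends : ∀ {x} → x ∈ insert u K → x ≡ u ⊎ x ≡ v
      ends x∈ with ∈-insert u K x∈
      ... | inj₁ x≡u = inj₁ x≡u
      ... | inj₂ x∈K = inj₂ (only x∈K)

    -- The form of triangle-freeness that suits case analysis on vertices. Distinctness need not be
    -- stated, since adjacent vertices differ.
    NoTriangle : Set
    NoTriangle = ∀ {a b c} → adj G a b ≡ true → adj G b c ≡ true → adj G a c ≡ true → ⊥

    triangle-free⇒no-triangle : TriangleFree G → NoTriangle
    triangle-free⇒no-triangle free {a} {b} {c} ab bc ac
      with K , clique , size , ends ← edge-clique bc
      with clique′ , size′ ← insert-clique {v = a} clique (λ x∈ → [ (λ { refl → ab }) , (λ { refl → ac }) ]′ (ends x∈)) =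
      free (insert a K) clique′ (trans size′ (cong suc size))

    clique-members : ∀ {K} → IsClique G K → ∀ {i j} → i ≢ j →
      adj G (lookup (elements K) i) (lookup (elements K) j) ≡ true
    clique-members {K} clique {i} {j} i≢j =
      clique (lookup-elements∈ K i) (lookup-elements∈ K j)
             (i≢j ∘ lookup-elements-injective K)

    clique≤2 : NoTriangle → ∀ K → IsClique G K → ∣ K ∣ ≤ 2
    clique≤2 free K clique = decidable-stable (∣ K ∣ ≤? 2) λ ≰2 → big (ℕ.≰⇒> ≰2)
      where
      big : 3 ≤ ∣ K ∣ → ⊥
      big 3≤ = free (members {zero} {suc zero} λ ()) (members {suc zero} {suc (suc zero)} λ ())
                    (members {zero} {suc (suc zero)} λ ())
        where
        members : ∀ {i j : Fin 3} → i ≢ j → _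
        members {i} {j} i≢j =
          clique-members clique {Fin.inject≤ i 3≤} {Fin.inject≤ j 3≤}
            (i≢j ∘ Fin.inject≤-injective 3≤ 3≤ i j)

    no-triangle⇒triangle-free : NoTriangle → TriangleFree G
    no-triangle⇒triangle-free free K clique size
      with s≤s (s≤s ()) ← subst (_≤ 2) size (clique≤2 free K clique)

    clique≤colours : ∀ {m} → Colourable G m → ∀ K → IsClique G K → ∣ K ∣ ≤ m
    clique≤colours {m} (c , proper) K clique = decidable-stable (∣ K ∣ ≤? m) λ ≰m →
      let i , j , i<j , same = Fin.pigeonhole (ℕ.≰⇒> ≰m) (c ∘ lookup (elements K)) in
      proper _ _ (clique-members clique λ i≡j → ℕ.<-irrefl (cong Fin.toℕ i≡j) i<j) same

    hasEdge? : Dec (HasEdge G)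
    hasEdge? = Fin.any? λ u → Fin.any? λ v → adj G u v Bool.≟ true

    -- The value is 0 for the graph without vertices and 1 otherwise. A colouring with that many
    -- colours bounds all cliques, and it also gives χ = ω.
    ω-of-edgeless : ¬ HasEdge G → ∃[ k ] k ≤ 1 × IsCliqueNumber G k × Colourable G k
    ω-of-edgeless edgeless = vertices (order G) refl
      where
      colourable : ∀ {k} → (Fin (order G) → Fin k) → Colourable G k
      colourable c = c , λ u v uv → ⊥-elim (edgeless (u , v , uv))
      vertices : ∀ n → order G ≡ n → ∃[ k ] k ≤ 1 × IsCliqueNumber G k × Colourable G k
      vertices zero    eq = 0 , z≤n ,
        ((Subset.⊥ , ∅-clique , Subset.∣⊥∣≡0 (order G)) , clique≤colours colouring) , colouring
        where colouring = colourable λ v → subst Fin eq v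
      vertices (suc n) eq with K , clique , size , _ ← singleton-clique (subst Fin (sym eq) zero) =
        1 , s≤s z≤n , ((K , clique , size) , clique≤colours colouring) , colouring
        where colouring = colourable λ _ → zero {0}

    ω-of-edge : HasEdge G → (∀ K → IsClique G K → ∣ K ∣ ≤ 2) → IsCliqueNumber G 2
    ω-of-edge (u , v , uv) ≤2 with K , clique , size , _ ← edge-clique uv =
      (K , clique , size) , ≤2

    -- The core of the perfection of bipartite graphs: with an edge both numbers are 2, and without
    -- one both are the value found for edgeless graphs.
    χ≡ω-of-2-colourable : Colourable G 2 → ∃[ k ] IsChromaticNumber G k × IsCliqueNumber G k
    χ≡ω-of-2-colourable col with hasEdge?
    ... | yes edge@(u , v , uv) = 2 , (col , λ j → lower j) , ω-of-edge edge (clique≤colours col)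
      where
      lower : ∀ j → Colourable G j → 2 ≤ j
      lower zero          (c , _) with () ← c u
      lower (suc zero)    (c , proper) with c u in cu | c v in cv
      ... | zero | zero = ⊥-elim (proper u v uv (trans cu (sym cv)))
      lower (suc (suc j)) _ = s≤s (s≤s z≤n)
    ... | no edgeless with k , _ , ω@((K , clique , size) , _) , col′ ← ω-of-edgeless edgeless =
      k , (col′ , λ j colⱼ → subst (_≤ j) size (clique≤colours colⱼ K clique)) , ω

  restrict-colouring : ∀ G (S : Subset (order G)) {k} → Colourable G k → Colourable (G [ S ]) k
  restrict-colouring G S (c , proper) = c ∘ lookup (elements S) , λ u v → proper _ _

  -- The first two colour classes form the perfect side, the third class the other one. Since `H`
  -- has an edge and no triangle, ω(H) = 2, which exceeds the clique number of an edgeless graph.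
  colourable⇒perfectlyDivisible : ∀ G → TriangleFree G → Colourable G 3 → PerfectlyDivisible G
  colourable⇒perfectlyDivisible G free col S edge = A , perfect , small
    where
    H = G [ S ]

    c : Fin (order H) → Fin 3
    c = proj₁ (restrict-colouring G S col)

    proper : ∀ u v → adj H u v ≡ true → c u ≢ c v
    proper = proj₂ (restrict-colouring G S col)

    two : Fin 3
    two = suc (suc zero)

    A : Subset (order H)
    A = Vec.tabulate λ v → does (c v Fin.<? two)

    ∈A⇒ : ∀ {v} → v ∈ A → c v Fin.< two
    ∈A⇒ {v} v∈A with c v Fin.<? two in eq
    ... | yes p = p
    ... | no ¬p with () ← trans (sym (Vec.[]=⇒lookup v∈A))
                           (trans (Vec.lookup∘tabulate _ v) (cong does eq))

    ∈∁A⇒ : ∀ {v} → v ∈ ∁ A → c v ≡ two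
    ∈∁A⇒ {v} v∈ with c v in eq | Subset.x∈∁p⇒x∉p v∈
    ... | zero         | v∉ = ⊥-elim (v∉ (Vec.lookup⇒[]= v A (trans (Vec.lookup∘tabulate _ v)
                                (cong (λ x → does (x Fin.<? two)) eq))))
    ... | suc zero     | v∉ = ⊥-elim (v∉ (Vec.lookup⇒[]= v A (trans (Vec.lookup∘tabulate _ v)
                                (cong (λ x → does (x Fin.<? two)) eq))))
    ... | suc (suc zero) | _ = refl

    lower : (x : Fin 3) → Fin 2
    lower zero    = zero
    lower (suc _) = suc zero

    lower-injective : ∀ x y → x Fin.< two → y Fin.< two →
      lower x ≡ lower y → x ≡ y
    lower-injective zero       zero       _ _ _ = refl
    lower-injective (suc zero) (suc zero) _ _ _ = refl
    lower-injective (suc (suc zero)) _ (s≤s (s≤s ())) _ _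
    lower-injective _ (suc (suc zero)) _ (s≤s (s≤s ())) _

    2-colouring : Colourable (H [ A ]) 2
    2-colouring = (λ i → lower (c (lookup (elements A) i))) , λ i j ij same →
      proper _ _ ij (lower-injective _ _ (∈A⇒ (lookup-elements∈ A i)) (∈A⇒ (lookup-elements∈ A j)) same)

    perfect : Perfect (H [ A ])
    perfect S′ = χ≡ω-of-2-colourable ((H [ A ]) [ S′ ]) (restrict-colouring (H [ A ]) S′ 2-colouring)

    small : (H [ ∁ A ]) ω< H
    small with k , k≤1 , ω , _ ← ω-of-edgeless (H [ ∁ A ]) (λ { (i , j , ij) →
                 proper _ _ ij (trans (∈∁A⇒ (lookup-elements∈ (∁ A) i))
                               (sym (∈∁A⇒ (lookup-elements∈ (∁ A) j)))) }) =
      k , 2 , ω , ω-of-edge H edge (clique≤2 H (triangle-free⇒no-triangle G free)) , s≤s k≤1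

  -- Cliques have at most two vertices, so χ = ω lets two colours suffice on the perfect side. The
  -- other side has clique number below 2, hence no edge, and takes the remaining colour.
  perfectlyDivisible⇒colourable : ∀ G → TriangleFree G → PerfectlyDivisible G → Colourable G 3
  -- Good partitions are promised only in the presence of an edge; without one any map is a
  -- colouring.
  perfectlyDivisible⇒colourable G free divisible with hasEdge? G
  ... | no edgeless = (λ _ → zero) , λ u v uv → ⊥-elim (edgeless (u , v , uv))
  ... | yes (u₀ , v₀ , u₀v₀) = colour , proper
    where
    -- The definition speaks of induced subgraphs, so `G` itself appears as the one induced by all
    -- vertices. It is not definitionally `G`, and `position` translates between the two.
    H = G [ Subset.⊤ ]

    noTriangle : NoTriangle G
    noTriangle = triangle-free⇒no-triangle G free

    position : ∀ v → ∃[ i ] lookup (elements (Subset.⊤ {order G})) i ≡ v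
    position v = index Subset.∈⊤

    edge-to-H : ∀ {u v} → adj G u v ≡ true → adj H (proj₁ (position u)) (proj₁ (position v)) ≡ true
    edge-to-H {u} {v} uv rewrite proj₂ (position u) | proj₂ (position v) = uv

    partition : ∃[ A ] Good H A
    partition = divisible Subset.⊤ (_ , _ , edge-to-H u₀v₀)

    A : Subset (order H)
    A = proj₁ partition

    B : Subset (order H)
    B = ∁ A

    A-colouring : Colourable ((H [ A ]) [ Subset.⊤ ]) 2
    A-colouring with k , ((c , proper) , _) , ((K , clique , size) , _) ← proj₁ (proj₂ partition) Subset.⊤ =
      (λ i → Fin.inject≤ (c i) k≤2) , λ i j ij same → proper i j ij (Fin.inject≤-injective k≤2 k≤2 _ _ same)
      where
      k≤2 : k ≤ 2
      k≤2 = subst (_≤ 2) size (clique≤2 ((H [ A ]) [ Subset.⊤ ]) noTriangle K clique)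

    B-edgeless : ¬ HasEdge (H [ B ])
    B-edgeless (i , j , ij)
      with k , l , (_ , k-max) , ((K , clique , size) , _) , k<l ← proj₂ (proj₂ partition)
      with K′ , clique′ , size′ , _ ← edge-clique (H [ B ]) ij =
      ℕ.<-irrefl refl (ℕ.≤-trans (s≤s (subst (_≤ k) size′ (k-max K′ clique′)))
        (ℕ.≤-trans k<l (subst (_≤ 2) size (clique≤2 H noTriangle K clique))))

    Position : Fin (order H) → Set
    Position x = (∃[ i ] lookup (elements A) (lookup (elements Subset.⊤) i) ≡ x)
               ⊎ (∃[ i ] lookup (elements B) i ≡ x)

    locate : ∀ x → Position x
    locate x with x Subset.∈? A
    ... | yes x∈A with i , eqᵢ ← index x∈A with j , eqⱼ ← index (Subset.∈⊤ {x = i}) =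
      inj₁ (j , trans (cong (lookup (elements A)) eqⱼ) eqᵢ)
    ... | no x∉A = inj₂ (index (Subset.x∉p⇒x∈∁p x∉A))

    colourAt : ∀ {x} → Position x → Fin 3
    colourAt (inj₁ (i , _)) = suc (proj₁ A-colouring i)
    colourAt (inj₂ _)       = zero

    properAt : ∀ {x y} (p : Position x) (q : Position y) → adj H x y ≡ true → colourAt p ≢ colourAt q
    properAt (inj₁ (i , refl)) (inj₁ (j , refl)) xy same =
      proj₂ A-colouring i j xy (Fin.suc-injective same)
    properAt (inj₂ (i , refl)) (inj₂ (j , refl)) xy _ = B-edgeless (i , j , xy)

    colour : Fin (order G) → Fin 3
    colour v = colourAt (locate (proj₁ (position v)))

    proper : ∀ u v → adj G u v ≡ true → colour u ≢ colour v
    proper u v uv = properAt (locate _) (locate _) (edge-to-H uv)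

-- Structured programs for Turing machines and their timed Hoare logic

module Programs where

  open import Data.Integer using (ℤ; +_; -[1+_])
  open FiniteTypes
  open Finite

  nth : ∀ {a} → List (Symbol a) → ℕ → Symbol a
  nth []       _       = blank
  nth (s ∷ _)  zero    = s
  nth (_ ∷ ss) (suc n) = nth ss n

  -- A tape as a function of the position relative to the head. Lists that differ only in trailing
  -- blanks give the same view, so specifications need not record which blanks have become explicit.
  View : ℕ → Set
  View a = ℤ → Symbol a

  look : ∀ {a} → Tape a → View a
  look t (+ zero)  = scanned t
  look t (+ suc n) = nth (after t) n
  look t -[1+ n ]  = nth (before t) n

  inc dec : ℤ → ℤ
  inc (+ n)        = + suc n
  inc -[1+ zero ]  = + zero
  inc -[1+ suc n ] = -[1+ n ]
  dec (+ zero)     = -[1+ zero ]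
  dec (+ suc n)    = + n
  dec -[1+ n ]     = -[1+ suc n ]

  module _ {a : ℕ} where

    moveV : Move → View a → View a
    moveV left  v = v ∘ dec
    moveV stay  v = v
    moveV right v = v ∘ inc

    writeV : View a → Symbol a → View a
    writeV v s (+ zero)  = s
    writeV v s (+ suc n) = v (+ suc n)
    writeV v s -[1+ n ]  = v -[1+ n ]

    actV : View a → Symbol a × Move → View a
    actV v (s , m) = moveV m (writeV v s)

    look-move : ∀ m (t : Tape a) → look (move m t) ≗ moveV m (look t)
    look-move left  (tape [] s rs) (+ zero)          = refl
    look-move left  (tape [] s rs) (+ suc zero)      = refl
    look-move left  (tape [] s rs) (+ suc (suc n))   = refl
    look-move left  (tape [] s rs) -[1+ n ]          = refl
    look-move left  (tape (l ∷ ls) s rs) (+ zero)        = refl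
    look-move left  (tape (l ∷ ls) s rs) (+ suc zero)    = refl
    look-move left  (tape (l ∷ ls) s rs) (+ suc (suc n)) = refl
    look-move left  (tape (l ∷ ls) s rs) -[1+ n ]        = refl
    look-move stay  t i = refl
    look-move right (tape ls s []) (+ zero)      = refl
    look-move right (tape ls s []) (+ suc n)     = refl
    look-move right (tape ls s []) -[1+ zero ]   = refl
    look-move right (tape ls s []) -[1+ suc n ]  = refl
    look-move right (tape ls s (r ∷ rs)) (+ zero)     = refl
    look-move right (tape ls s (r ∷ rs)) (+ suc n)    = refl
    look-move right (tape ls s (r ∷ rs)) -[1+ zero ]  = refl
    look-move right (tape ls s (r ∷ rs)) -[1+ suc n ] = refl

    moveV-cong : ∀ m {v w : View a} → v ≗ w → moveV m v ≗ moveV m w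
    moveV-cong left  eq = eq ∘ dec
    moveV-cong stay  eq = eq
    moveV-cong right eq = eq ∘ inc

    look-write : ∀ (t : Tape a) {v} s → look t ≗ v → look (record t { scanned = s }) ≗ writeV v s
    look-write t s eq (+ zero)  = refl
    look-write t s eq (+ suc n) = eq (+ suc n)
    look-write t s eq -[1+ n ]  = eq -[1+ n ]

    look-act : ∀ (t : Tape a) {v} s → look t ≗ v → look (act t s) ≗ actV v s
    look-act t (s , m) eq i =
      trans (look-move m _ i) (moveV-cong m (look-write t s eq) i)

    write-back : ∀ (v : View a) → writeV v (v (+ 0)) ≗ v
    write-back v (+ zero)  = refl
    write-back v (+ suc n) = refl
    write-back v -[1+ n ]  = refl

    peek : View a → Symbol a
    peek v = v (+ 0)

  -- A machine fragment is left by a transition to nothing.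
  record Fragment (a k : ℕ) : Set₁ where
    field
      State  : Set
      finite : Finite State
      entry  : State
      transition : State → Vec (Symbol a) k → Maybe State × Vec (Symbol a × Move) k

  open Fragment

  module _ {a k : ℕ} where

    Tapes : Set
    Tapes = Vec (Tape a) k

    Views : Set
    Views = Vec (View a) k

    scan : Tapes → Vec (Symbol a) k
    scan = map scanned

    data Run (P : Fragment a k) : State P → Tapes → ℕ → Tapes → Set where
      exit : ∀ {q ts as} → transition P q (scan ts) ≡ (nothing , as) → Run P q ts 1 (zipWith act ts as)
      go   : ∀ {q q′ ts as t ts′} → transition P q (scan ts) ≡ (just q′ , as) →
             Run P q′ (zipWith act ts as) t ts′ → Run P q ts (suc t) ts′

    idle : Vec (Symbol a) k → Vec (Symbol a × Move) k
    idle = map (_, stay)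

    zipWith-idle : ∀ {n} (ts : Vec (Tape a) n) → zipWith act ts (map (_, stay) (map scanned ts)) ≡ ts
    zipWith-idle []       = refl
    zipWith-idle (t ∷ ts) = cong (t ∷_) (zipWith-idle ts)

    zipWith-idle-at : ∀ {n} (ts : Vec (Tape a) n) i s →
      zipWith act ts (map (_, stay) (map scanned ts) [ i ]≔ s) ≡ updateAt ts i (λ t → act t s)
    zipWith-idle-at (t ∷ ts) zero    s = cong (act t s ∷_) (zipWith-idle ts)
    zipWith-idle-at (t ∷ ts) (suc i) s = cong (t ∷_) (zipWith-idle-at ts i s)

    -- at i f acts on tape i alone, as told by the symbols scanned on all tapes.
    infixr 4 _⨟_
    data Program : Set where
      at    : Fin k → (Vec (Symbol a) k → Symbol a × Move) → Program
      skip  : Program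
      _⨟_   : Program → Program → Program
      while : (Vec (Symbol a) k → Bool) → Program → Program

    ⟦_⟧ : Program → Fragment a k
    ⟦ at i f ⟧ = record
      { State  = ⊤
      ; finite = finite-⊤
      ; entry  = tt
      ; transition = λ _ ss → nothing , idle ss [ i ]≔ f ss }
    ⟦ skip ⟧ = record
      { State  = ⊤
      ; finite = finite-⊤
      ; entry  = tt
      ; transition = λ _ ss → nothing , idle ss }
    ⟦ P ⨟ Q ⟧ = record
      { State  = State ⟦ P ⟧ ⊎ State ⟦ Q ⟧
      ; finite = finite-⊎ (finite ⟦ P ⟧) (finite ⟦ Q ⟧)
      ; entry  = inj₁ (entry ⟦ P ⟧)
      ; transition = λ { (inj₁ q) ss → map₁ (λ q′ → just (maybe inj₁ (inj₂ (entry ⟦ Q ⟧)) q′)) (transition ⟦ P ⟧ q ss)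
                       ; (inj₂ q) ss → map₁ (Maybe.map inj₂) (transition ⟦ Q ⟧ q ss) } }
    ⟦ while c P ⟧ = record
      -- `nothing` is the state that tests the condition. An exit `nothing` of the body turns into
      -- `just nothing`, a transition back to the test, so `map₁ just` alone closes the loop.
      { State  = Maybe (State ⟦ P ⟧)
      ; finite = finite-Maybe (finite ⟦ P ⟧)
      ; entry  = nothing
      ; transition = λ { nothing  ss → (if c ss then just (just (entry ⟦ P ⟧)) else nothing) , idle ss
                       ; (just q) ss → map₁ just (transition ⟦ P ⟧ q ss) } }

    run-second : ∀ {P Q q ts t ts′} → Run ⟦ Q ⟧ q ts t ts′ → Run ⟦ P ⨟ Q ⟧ (inj₂ q) ts t ts′
    run-second (exit eq) = exit (cong (map₁ (Maybe.map inj₂)) eq)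
    run-second (go eq r) = go (cong (map₁ (Maybe.map inj₂)) eq) (run-second r)

    run-⨟ : ∀ {P Q q ts t ts′ t′ ts″} → Run ⟦ P ⟧ q ts t ts′ → Run ⟦ Q ⟧ (entry ⟦ Q ⟧) ts′ t′ ts″ →
      Run ⟦ P ⨟ Q ⟧ (inj₁ q) ts (t + t′) ts″
    run-⨟ {Q = Q} (exit eq) r = go (cong (map₁ (λ q′ → just (maybe inj₁ (inj₂ (entry ⟦ Q ⟧)) q′))) eq) (run-second r)
    run-⨟ {Q = Q} (go eq r) r′ = go (cong (map₁ (λ q′ → just (maybe inj₁ (inj₂ (entry ⟦ Q ⟧)) q′))) eq) (run-⨟ r r′)

    run-body : ∀ {c P q ts t ts′ t′ ts″} → Run ⟦ P ⟧ q ts t ts′ → Run ⟦ while c P ⟧ nothing ts′ t′ ts″ →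
      Run ⟦ while c P ⟧ (just q) ts (t + t′) ts″
    run-body (exit eq) r = go (cong (map₁ just) eq) r
    run-body (go eq r) r′ = go (cong (map₁ just) eq) (run-body r r′)

    infix 4 _⊨_
    _⊨_ : Tapes → Views → Set
    ts ⊨ vs = ∀ i → look (lookup ts i) ≗ lookup vs i

    peeks : Views → Vec (Symbol a) k
    peeks = map peek

    scan≡peeks : ∀ {ts vs} → ts ⊨ vs → scan ts ≡ peeks vs
    scan≡peeks {ts} {vs} = go′ ts vs
      where
      go′ : ∀ {n} (ts : Vec (Tape a) n) vs → (∀ i → look (lookup ts i) ≗ lookup vs i) → map scanned ts ≡ map peek vs
      go′ []       []       m = refl
      go′ (t ∷ ts) (v ∷ vs) m = cong₂ _∷_ (m zero (+ 0)) (go′ ts vs (m ∘ suc))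

    infix 3 _⟶⟨_,_⟩_
    -- A Hoare triple for total correctness with a time bound. Being a record and not a function
    -- type, it lets unification recover the views from the type of a triple.
    record _⟶⟨_,_⟩_ (vs : Views) (P : Program) (b : ℕ) (vs′ : Views) : Set where
      constructor triple
      field
        runs : ∀ ts → ts ⊨ vs → ∃[ t ] ∃[ ts′ ] Run ⟦ P ⟧ (entry ⟦ P ⟧) ts t ts′ × t ≤ b × ts′ ⊨ vs′

    infix 4 _≋_
    _≋_ : Views → Views → Set
    vs ≋ ws = ∀ i → lookup vs i ≗ lookup ws i

    ⟶-pre : ∀ {us vs P b ws} → us ≋ vs → vs ⟶⟨ P , b ⟩ ws → us ⟶⟨ P , b ⟩ ws
    ⟶-pre eq (triple r) = triple λ ts m → r ts λ i j → trans (m i j) (eq i j)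

    ⟶-weaken : ∀ {vs P b c ws} → b ≤ c → vs ⟶⟨ P , b ⟩ ws → vs ⟶⟨ P , c ⟩ ws
    ⟶-weaken b≤c (triple r) = triple λ ts m → let t , ts′ , run , t≤b , m′ = r ts m in
      t , ts′ , run , ℕ.≤-trans t≤b b≤c , m′

    ⟶-skip : ∀ {vs} → vs ⟶⟨ skip , 1 ⟩ vs
    ⟶-skip {vs} = triple λ ts m →
      1 , _ , exit refl , ℕ.≤-refl , subst (_⊨ vs) (sym (zipWith-idle ts)) m

    ⟶-at : ∀ {vs i f v} → actV (lookup vs i) (f (peeks vs)) ≗ v → vs ⟶⟨ at i f , 1 ⟩ vs [ i ]≔ v
    ⟶-at {vs} {i} {f} {v} eq = triple λ ts m → 1 , _ , exit refl , ℕ.≤-refl ,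
      subst (_⊨ vs [ i ]≔ v) (sym (zipWith-idle-at ts i (f (scan ts)))) (updated ts m)
      where
      updated : ∀ ts → ts ⊨ vs → updateAt ts i (λ t → act t (f (scan ts))) ⊨ vs [ i ]≔ v
      updated ts m j x with j Fin.≟ i
      ... | yes refl
        rewrite Vec.lookup∘updateAt i {λ t → act t (f (scan ts))} ts | Vec.lookup∘updateAt i {const v} vs
              | scan≡peeks {ts} {vs} m =
        trans (look-act (lookup ts i) (f (peeks vs)) (m i) x) (eq x)
      ... | no j≢i
        rewrite Vec.lookup∘updateAt′ j i {λ t → act t (f (scan ts))} j≢i ts | Vec.lookup∘updateAt′ j i {const v} j≢i vs =
        m j x

    infixr 4 _⟫_
    _⟫_ : ∀ {us vs ws P Q b c} → us ⟶⟨ P , b ⟩ vs → vs ⟶⟨ Q , c ⟩ ws → us ⟶⟨ P ⨟ Q , b + c ⟩ ws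
    triple p ⟫ triple q = triple λ ts m →
      let t , ts′ , run , t≤b , m′ = p ts m
          t′ , ts″ , run′ , t′≤c , m″ = q ts′ m′ in
      t + t′ , ts″ , run-⨟ run run′ , ℕ.+-mono-≤ t≤b t′≤c , m″

    while-exit : ∀ {vs c P} → c (peeks vs) ≡ false → vs ⟶⟨ while c P , 1 ⟩ vs
    while-exit {vs} {c} {P} eq = triple λ ts m →
      1 , _ , exit (test ts m) , ℕ.≤-refl , subst (_⊨ vs) (sym (zipWith-idle ts)) m
      where
      test : ∀ ts → ts ⊨ vs → transition ⟦ while c P ⟧ nothing (scan ts) ≡ (nothing , idle (scan ts))
      test ts m = cong (λ b → (if b then just (just (entry ⟦ P ⟧)) else nothing) , idle (scan ts))
                  (trans (cong c (scan≡peeks {ts} {vs} m)) eq)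

    while-enter : ∀ {us vs ws c P b b′} → c (peeks us) ≡ true →
      us ⟶⟨ P , b ⟩ vs → vs ⟶⟨ while c P , b′ ⟩ ws → us ⟶⟨ while c P , suc b + b′ ⟩ ws
    while-enter {us} {c = c} {P} eq (triple p) (triple w) = triple λ ts m →
      let t , ts′ , run , t≤b , m′ = p ts m
          t′ , ts″ , run′ , t′≤c , m″ = w ts′ m′ in
      suc (t + t′) , ts″ ,
      go (test ts m) (subst (λ ts₀ → Run ⟦ while c P ⟧ (just (entry ⟦ P ⟧)) ts₀ (t + t′) ts″) (sym (zipWith-idle ts)) (run-body run run′)) ,
      s≤s (ℕ.+-mono-≤ t≤b t′≤c) , m″
      where
      test : ∀ ts → ts ⊨ us → transition ⟦ while c P ⟧ nothing (scan ts) ≡ (just (just (entry ⟦ P ⟧)) , idle (scan ts))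
      test ts m = cong (λ b → (if b then just (just (entry ⟦ P ⟧)) else nothing) , idle (scan ts))
                  (trans (cong c (scan≡peeks {ts} {us} m)) eq)

    loop-time : ℕ → ℕ → ℕ
    loop-time n b = n * suc b + 1

    while-up : ∀ {c P b} (I : ℕ → Views) n → c (peeks (I n)) ≡ false →
      (∀ i → i < n → c (peeks (I i)) ≡ true) → (∀ i → i < n → I i ⟶⟨ P , b ⟩ I (suc i)) →
      I 0 ⟶⟨ while c P , loop-time n b ⟩ I n
    while-up {c} {P} {b} I zero stop more body = while-exit stop
    while-up {c} {P} {b} I (suc n) stop more body =
      ⟶-weaken (ℕ.≤-reflexive (sym (ℕ.+-assoc (suc b) (n * suc b) 1)))
        (while-enter (more 0 (s≤s z≤n)) (body 0 (s≤s z≤n))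
          (while-up (I ∘ suc) n stop (λ i i<n → more (suc i) (s≤s i<n)) (λ i i<n → body (suc i) (s≤s i<n))))

    each : ∀ n → (Fin n → Program) → Program
    each zero    P = skip
    each (suc n) P = P zero ⨟ each n (P ∘ suc)

    ⟶-each : ∀ {b} n (P : Fin n → Program) (I : ℕ → Views) →
      (∀ i → I (toℕ i) ⟶⟨ P i , b ⟩ I (suc (toℕ i))) → I 0 ⟶⟨ each n P , n * b + 1 ⟩ I n
    ⟶-each zero    P I step = ⟶-skip
    ⟶-each {b} (suc n) P I step =
      ⟶-weaken (ℕ.≤-reflexive (sym (ℕ.+-assoc b (n * b) 1)))
        (step zero ⟫ ⟶-each n (P ∘ suc) (I ∘ suc) (step ∘ suc))

  -- Leaving the fragment leads to the additional state `nothing`, in which no transition is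
  -- defined. Thus the last action of the fragment is still performed before the machine halts.
  machine : ∀ {a} m w → Fragment a (m + suc w) → TM m
  machine {a} m w P = record
    { states     = size F
    ; auxSymbols = a
    ; workTapes  = w
    ; start      = to F (just (entry P))
    ; δ          = λ q ss → Maybe.map (λ s → map₁ (to F) (transition P s ss)) (from F q) }
    where F = finite-Maybe (finite P)

  machine-runs : ∀ {a} m w (P : Fragment a (m + suc w)) {q ts t ts′} → Run P q ts t ts′ →
    let open TM (machine m w P) in
    (to (finite-Maybe (finite P)) (just q) , ts) ⇓[ t ] (to (finite-Maybe (finite P)) nothing , ts′)
  machine-runs {a} m w P = simulate
    where
    open TM (machine m w P)
    F = finite-Maybe (finite P)
    step-just : ∀ {q ts q′ as} → transition P q (scan ts) ≡ (q′ , as) →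
      step (to F (just q) , ts) ≡ just (to F q′ , zipWith act ts as)
    step-just {q} {ts} eq = trans
      (cong (λ s → Maybe.map (λ (q′ , as) → q′ , zipWith act ts as)
                     (Maybe.map (λ s′ → map₁ (to F) (transition P s′ (scan ts))) s))
            (from∘to F (just q)))
      (cong (λ r → just (to F (proj₁ r) , zipWith act ts (proj₂ r))) eq)
    simulate : ∀ {q ts t ts′} → Run P q ts t ts′ → (to F (just q) , ts) ⇓[ t ] (to F nothing , ts′)
    simulate (exit {ts = ts} {as} eq) = next (step-just eq)
      (halted (cong (λ s → Maybe.map (λ (q′ , as) → q′ , zipWith act ts′ as)
                             (Maybe.map (λ s′ → map₁ (to F) (transition P s′ (scan ts′))) s))
                    (from∘to F nothing)))
      where ts′ = zipWith act ts as
    simulate (go eq r) = next (step-just eq) (simulate r)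

  initialTapes : ∀ {a m} w → Vec Word m → Vec (Tape a) (m + suc w)
  initialTapes w ws = map inputTape ws Vec.++ Vec.replicate (suc w) (inputTape [])

  Outputs : ∀ {a} m w → Program {a} {m + suc w} → Vec Word m → ℕ → Word → Set
  Outputs m w P ws b v = let open TM (machine m w ⟦ P ⟧) in
    ∃[ t ] ∃[ d ] (initial ws ⇓[ t ] d) × t ≤ b × output d ≡ v

  leadingBits-nth : ∀ {a} w (ss : List (Symbol a)) → (∀ s → nth ss s ≡ nth (List.map bit w) s) → leadingBits ss ≡ w
  leadingBits-nth []      []            eq = refl
  leadingBits-nth []      (blank ∷ ss)  eq = refl
  leadingBits-nth []      (aux _ ∷ ss)  eq = refl
  leadingBits-nth []      (bit _ ∷ ss)  eq with () ← eq 0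
  leadingBits-nth (b ∷ w) []            eq with () ← eq 0
  leadingBits-nth (b ∷ w) (s ∷ ss)      eq with refl ← eq 0 = cong (b ∷_) (leadingBits-nth w ss (eq ∘ suc))

  program-outputs : ∀ {a m w} (P : Program {a} {m + suc w}) ws {vs vs′ b v} →
    initialTapes w ws ⊨ vs → vs ⟶⟨ P , b ⟩ vs′ →
    (∀ s → lookup vs′ (m ↑ʳ zero) (+ s) ≡ nth (List.map bit v) s) → Outputs m w P ws b v
  program-outputs {m = m} {w} P ws {v = v} initially (triple runs) finally
    with t , ts′ , run , t≤ , models ← runs _ initially =
    t , _ , machine-runs m w ⟦ P ⟧ run , t≤ ,
    leadingBits-nth v _ λ { zero    → trans (models (m ↑ʳ zero) (+ zero)) (finally zero)
                          ; (suc s) → trans (models (m ↑ʳ zero) (+ suc s)) (finally (suc s)) }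

  program⇒polyTime : ∀ {a m w} (P : Program {a} {m + suc w}) {f : Vec Word m → Word} p →
    (∀ ws → Outputs m w P ws (eval p (Vec.sum (map List.length ws))) (f ws)) → PolyTime f
  program⇒polyTime {m = m} {w} P p outputs = machine m w ⟦ P ⟧ , p , outputs

-- Runs of a verifier as tilings of a square

module Tilings where

  open FiniteTypes
  open Finite
  open Programs using (nth)

  -- The finitely much that tiles and gadgets may know about a coordinate. Rows and columns share
  -- it, so a single ruler describes both.
  record Class : Set where
    constructor class
    field
      inputBit : Maybe Bool
      certificate first last odd : Bool

  open Class

  opaque
    -- Opaque, so that type checking never computes its size, on which the alphabet of the printing
    -- machine depends.
    finite-Class : Finite Class
    finite-Class = finite-retract
      (λ c → inputBit c , certificate c , first c , last c , odd c)
      (λ { (i , c , f , l , o) → class i c f l o })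
      (λ _ → refl)
      (finite-× (finite-Maybe finite-Bool) (finite-× finite-Bool (finite-× finite-Bool (finite-× finite-Bool finite-Bool))))

  isOdd : ℕ → Bool
  isOdd zero    = false
  isOdd (suc n) = not (isOdd n)

  bitAt : Word → ℕ → Maybe Bool
  bitAt []      _       = nothing
  bitAt (b ∷ _) zero    = just b
  bitAt (_ ∷ w) (suc n) = bitAt w n

  -- W is the side of the grid, P the greatest length of a certificate.
  classOf : Word → ℕ → ℕ → ℕ → Class
  classOf x P W s = class (bitAt x s) (s <ᵇ P) (s ≡ᵇ 0) (suc s ≡ᵇ W) (isOdd s)

  missing : ∀ {A : Set} → Maybe A → Bool
  missing nothing  = true
  missing (just _) = false

  module Tiles (M : TM 2) where

    open TM M

    Sym : Set
    Sym = Symbol auxSymbols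

    -- The cells at distance s + 1 before and after the head.
    Cell : Set
    Cell = Sym × Sym

    Column : Set
    Column = Vec Cell tapes

    -- A cell of the next row depends on up to three columns of the present one. Copies of the
    -- neighbouring columns turn this into a relation between two tiles, one above the other, and
    -- the horizontal relation keeps the copies faithful. `nothing` stands for a missing neighbour
    -- at the border.
    record Tile : Set where
      constructor tile
      field
        global : Fin states × Vec Sym tapes
        west   : Maybe Column
        own    : Column
        east   : Maybe Column

    open Tile

    finite-Cell : Finite Cell
    finite-Cell = finite-× (finite-Symbol auxSymbols) (finite-Symbol auxSymbols)

    finite-Column : Finite Column
    finite-Column = finite-Vec finite-Cell tapes

    opaque
      finite-Tile : Finite Tile
      finite-Tile = finite-retract
        (λ a → global a , west a , own a , east a)
        (λ { (g , l , c , r) → tile g l c r })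
        (λ _ → refl)
        (finite-× (finite-× (finite-Fin states) (finite-Vec (finite-Symbol auxSymbols) tapes))
          (finite-× (finite-Maybe finite-Column) (finite-× finite-Column (finite-Maybe finite-Column))))

    _≟ˢ_ : ∀ (s s′ : Sym) → Dec (s ≡ s′)
    _≟ˢ_ = decEq (finite-Symbol auxSymbols)

    out : Fin tapes
    out = 2 ↑ʳ zero

    at : Fin tapes → Maybe Column → Maybe Cell
    at j = Maybe.map λ c → lookup c j

    -- A move to the left brings the cells before the head one place nearer and pushes those after
    -- it one place away. Column 0 has no western neighbour: what arrives there from the direction
    -- of the head is the symbol `w` just written. From beyond the last column a blank arrives.
    shifted : Sym × Move → Maybe Cell → Cell → Maybe Cell → Cell
    shifted (w , left)  l c r = maybe proj₁ blank r , maybe proj₂ w l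
    shifted (w , Move.stay)  l c r = c
    shifted (w , right) l c r = maybe proj₁ w l , maybe proj₂ blank r

    rescanned : Sym × Move → Cell → Sym
    rescanned (w , left)  c = proj₁ c
    rescanned (w , Move.stay)  c = w
    rescanned (w , right) c = proj₂ c

    NotBit : Sym → Set
    NotBit (bit _) = ⊥
    NotBit _       = ⊤

    notBit? : ∀ s → Dec (NotBit s)
    notBit? blank   = yes tt
    notBit? (bit _) = no λ ()
    notBit? (aux _) = yes tt

    Action : Set
    Action = Maybe (Fin states × Vec (Sym × Move) tapes)

    -- The output is the block of bits that starts at the head, so it is the single bit `true`
    -- exactly when the next cell holds no bit. Rows that have not halted are unconstrained.
    Accepting : Action → Tile → Set
    Accepting (just _) a = ⊤
    Accepting nothing  a = lookup (proj₂ (global a)) out ≡ bit true × NotBit (proj₂ (lookup (own a) out))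

    accepting? : ∀ d a → Dec (Accepting d a)
    accepting? (just _) a = yes tt
    accepting? nothing  a = (_ ≟ˢ _) ×-dec notBit? _

    -- In column s this is the cell s places to the right of the head, one place nearer than the
    -- tile's own cells. With this offset column s meets position s of the input word.
    atOrAfterHead : Tile → Fin tapes → Sym
    atOrAfterHead a j = maybe (λ c → proj₂ (lookup c j)) (lookup (proj₂ (global a)) j) (west a)

    -- A certificate cell and its successor.
    Certificate : Bool → Sym → Sym → Set
    Certificate allowed blank   s′ = s′ ≡ blank
    Certificate allowed (bit _) s′ = allowed ≡ true
    Certificate allowed (aux _) s′ = ⊥

    certificate? : ∀ allowed s s′ → Dec (Certificate allowed s s′)
    certificate? allowed blank   s′ = s′ ≟ˢ blank
    certificate? allowed (bit _) s′ = allowed Bool.≟ true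
    certificate? allowed (aux _) s′ = no λ ()

    -- Everything is prescribed except the second tape, where any block of bits followed by blanks
    -- is allowed, as long as its bits lie at positions below the bound on certificates.
    Starting : Class → Tile → Set
    Starting κ a =
      proj₁ (global a) ≡ start ×
      (∀ j → proj₁ (lookup (own a) j) ≡ blank) ×
      (last κ ≡ true → ∀ j → proj₂ (lookup (own a) j) ≡ blank) ×
      atOrAfterHead a zero ≡ maybe bit blank (inputBit κ) ×
      Certificate (certificate κ) (atOrAfterHead a (suc zero)) (proj₂ (lookup (own a) (suc zero))) ×
      (∀ (j : Fin (suc workTapes)) → atOrAfterHead a (2 ↑ʳ j) ≡ blank)

    Admissible : Class → Class → Tile → Set
    Admissible ρ κ a =
      missing (west a) ≡ first κ ×
      missing (east a) ≡ last κ ×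
      (first κ ≡ true → Accepting (uncurry δ (global a)) a) ×
      (first ρ ≡ true → Starting κ a)

    admissible? : ∀ ρ κ a → Dec (Admissible ρ κ a)
    admissible? ρ κ a =
      (_ Bool.≟ _) ×-dec (_ Bool.≟ _) ×-dec
      ((_ Bool.≟ _) →-dec accepting? (uncurry δ (global a)) a) ×-dec
      ((_ Bool.≟ _) →-dec
        ((_ Fin.≟ _) ×-dec Fin.all? (λ _ → _ ≟ˢ _) ×-dec
         ((_ Bool.≟ _) →-dec Fin.all? (λ _ → _ ≟ˢ _)) ×-dec
         (_ ≟ˢ _) ×-dec certificate? _ _ _ ×-dec Fin.all? (λ _ → _ ≟ˢ _)))

    Horizontal : Tile → Tile → Set
    Horizontal a b = global a ≡ global b × west b ≡ just (own a) × east a ≡ just (own b)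

    horizontal? : ∀ a b → Dec (Horizontal a b)
    horizontal? a b =
      decEq (finite-× (finite-Fin states) (finite-Vec (finite-Symbol auxSymbols) tapes)) _ _ ×-dec
      decEq (finite-Maybe finite-Column) _ _ ×-dec decEq (finite-Maybe finite-Column) _ _

    -- A halted row puts no condition on the row after it: the rows beyond the halt merely complete
    -- the square.
    Successor : Action → Tile → Tile → Set
    Successor nothing         a b = ⊤
    Successor (just (q , as)) a b =
      proj₁ (global b) ≡ q ×
      (∀ j → lookup (own b) j ≡ shifted (lookup as j) (at j (west a)) (lookup (own a) j) (at j (east a))) ×
      -- Only column 0 sees the cells next to the heads. The symbols scanned after the step are
      -- fixed there, and the horizontal relation spreads them along the row.
      (missing (west a) ≡ true → ∀ j → lookup (proj₂ (global b)) j ≡ rescanned (lookup as j) (lookup (own a) j))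

    successor? : ∀ d a b → Dec (Successor d a b)
    successor? nothing         a b = yes tt
    successor? (just (q , as)) a b =
      (_ Fin.≟ _) ×-dec Fin.all? (λ _ → decEq finite-Cell _ _) ×-dec
      ((_ Bool.≟ _) →-dec Fin.all? (λ _ → _ ≟ˢ _))

    Vertical : Tile → Tile → Set
    Vertical a b = Successor (uncurry δ (global a)) a b

    vertical? : ∀ a b → Dec (Vertical a b)
    vertical? a b = successor? (uncurry δ (global a)) a b

    record Tiling (W : ℕ) (κ : ℕ → Class) (τ : ℕ → ℕ → Tile) : Set where
      field
        admissible : ∀ {t s} → t < W → s < W → Admissible (κ t) (κ s) (τ t s)
        horizontal : ∀ {t s} → t < W → suc s < W → Horizontal (τ t s) (τ t (suc s))
        vertical   : ∀ {t s} → suc t < W → s < W → Vertical (τ t s) (τ (suc t) s)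

    cell : Tape auxSymbols → ℕ → Cell
    cell t s = nth (before t) s , nth (after t) s

    column : ∀ {n} → Vec (Tape auxSymbols) n → ℕ → Vec Cell n
    column ts s = map (λ t → cell t s) ts

    leftOf : Vec (Tape auxSymbols) tapes → ℕ → Maybe Column
    leftOf ts zero    = nothing
    leftOf ts (suc s) = just (column ts s)

    rightOf : ℕ → Vec (Tape auxSymbols) tapes → ℕ → Maybe Column
    rightOf W ts s = if suc s ≡ᵇ W then nothing else just (column ts (suc s))

    tileOf : ℕ → Config → ℕ → Tile
    tileOf W (q , ts) s = tile (q , map scanned ts) (leftOf ts s) (column ts s) (rightOf W ts s)

    -- The grid shows only `W` cells on either side of each head. The bound grows by one per step,
    -- and while it stays at most `W` the grid loses nothing.
    record Within (L : ℕ) (ts : Vec (Tape auxSymbols) tapes) : Set where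
      constructor within
      field
        beyond : ∀ j {s} → L ≤ s → cell (lookup ts j) s ≡ (blank , blank)

    left-cell : Tape auxSymbols → ℕ → Maybe Cell
    left-cell t zero    = nothing
    left-cell t (suc s) = just (cell t s)

    cell-act : ∀ t a s → cell (act t a) s ≡ shifted a (left-cell t s) (cell t s) (just (cell t (suc s)))
    cell-act (tape [] _ rs)            (w , left)  zero    = refl
    cell-act (tape [] _ rs)            (w , left)  (suc s) = refl
    cell-act (tape (l ∷ ls) _ rs)      (w , left)  zero    = refl
    cell-act (tape (l ∷ ls) _ rs)      (w , left)  (suc s) = refl
    cell-act t                         (w , Move.stay)  s       = refl
    cell-act (tape ls _ [])            (w , right) zero    = refl
    cell-act (tape ls _ [])            (w , right) (suc s) = refl
    cell-act (tape ls _ (r ∷ rs))      (w , right) zero    = refl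
    cell-act (tape ls _ (r ∷ rs))      (w , right) (suc s) = refl

    scanned-act : ∀ t a → scanned (act t a) ≡ rescanned a (cell t zero)
    scanned-act (tape [] _ rs)       (w , left)  = refl
    scanned-act (tape (l ∷ ls) _ rs) (w , left)  = refl
    scanned-act t                    (w , Move.stay)  = refl
    scanned-act (tape ls _ [])       (w , right) = refl
    scanned-act (tape ls _ (r ∷ rs)) (w , right) = refl

    at-leftOf : ∀ j ts s → at j (leftOf ts s) ≡ left-cell (lookup ts j) s
    at-leftOf j ts zero    = refl
    at-leftOf j ts (suc s) = cong just (Vec.lookup-map j _ ts)

    shifted-blank : ∀ a l c → shifted a l c (just (blank , blank)) ≡ shifted a l c nothing
    shifted-blank (w , left)  l c = refl
    shifted-blank (w , Move.stay)  l c = refl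
    shifted-blank (w , right) l c = refl

    -- In the last column the absent neighbour is read as blank, and `Within W` says that the cell
    -- it would hold is blank indeed.
    shifted-rightOf : ∀ {W} ts a j l c s → Within W ts →
      shifted a l c (just (cell (lookup ts j) (suc s))) ≡ shifted a l c (at j (rightOf W ts s))
    shifted-rightOf {W} ts a j l c s (within beyond) with suc s ≡ᵇ W in eq
    ... | false = cong (λ x → shifted a l c (just x)) (sym (Vec.lookup-map j _ ts))
    ... | true  = trans (cong (λ x → shifted a l c (just x))
                    (beyond j (ℕ.≤-reflexive (sym (ℕ.≡ᵇ⇒≡ (suc s) W (subst T (sym eq) tt))))))
                    (shifted-blank a l c)

    column-act : ∀ {W} ts as s → Within W ts → ∀ j →
      lookup (column (zipWith act ts as) s) j ≡
      shifted (lookup as j) (at j (leftOf ts s)) (lookup (column ts s) j) (at j (rightOf W ts s))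
    column-act {W} ts as s wi j
      rewrite Vec.lookup-map j (λ t → cell t s) (zipWith act ts as)
            | Vec.lookup-zipWith act j ts as
            | at-leftOf j ts s
            | Vec.lookup-map j (λ t → cell t s) ts =
      trans (cell-act (lookup ts j) (lookup as j) s) (shifted-rightOf {W} ts (lookup as j) j _ _ s wi)

    scan-act : ∀ (ts : Vec (Tape auxSymbols) tapes) as j → lookup (map scanned (zipWith act ts as)) j ≡ rescanned (lookup as j) (lookup (column ts 0) j)
    scan-act ts as j
      rewrite Vec.lookup-map j scanned (zipWith act ts as)
            | Vec.lookup-zipWith act j ts as
            | Vec.lookup-map j (λ t → cell t 0) ts = scanned-act (lookup ts j) (lookup as j)

    lookup-ext : ∀ {A : Set} {n} {xs ys : Vec A n} → (∀ j → lookup xs j ≡ lookup ys j) → xs ≡ ys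
    lookup-ext eq = Ext.Pointwise-≡⇒≡ (Ext.ext eq)

    shifted-within : ∀ a l c r → l ≡ just (blank , blank) → c ≡ (blank , blank) → r ≡ just (blank , blank) →
      shifted a l c r ≡ (blank , blank)
    shifted-within (w , left)  _ _ _ refl refl refl = refl
    shifted-within (w , Move.stay)  _ _ _ refl refl refl = refl
    shifted-within (w , right) _ _ _ refl refl refl = refl

    within-act : ∀ {L} ts as → Within L ts → Within (suc L) (zipWith act ts as)
    within-act {L} ts as (within beyond) = within still
      where
      still : ∀ j {s} → suc L ≤ s → cell (lookup (zipWith act ts as) j) s ≡ (blank , blank)
      still j {suc s} (s≤s L≤s)
        rewrite Vec.lookup-zipWith act j ts as | cell-act (lookup ts j) (lookup as j) (suc s) =
        shifted-within (lookup as j) _ _ _ (cong just (beyond j L≤s)) (beyond j (ℕ.m≤n⇒m≤1+n L≤s))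
          (cong just (beyond j (ℕ.m≤n⇒m≤1+n (ℕ.m≤n⇒m≤1+n L≤s))))

    within-mono : ∀ {L L′ ts} → L ≤ L′ → Within L ts → Within L′ ts
    within-mono L≤ (within beyond) = within λ j L′≤s → beyond j (ℕ.≤-trans L≤ L′≤s)

    data Stepped (c : Config) : Config → Set where
      stepped : ∀ {q as} → uncurry δ (proj₁ c , map scanned (proj₂ c)) ≡ just (q , as) →
        Stepped c (q , zipWith act (proj₂ c) as)

    step-just : ∀ c {c′} → step c ≡ just c′ → Stepped c c′
    step-just (q , ts) eq with δ q (map scanned ts) in eqδ
    step-just (q , ts) refl | just (q′ , as) = stepped eqδ

    step-nothing : ∀ c → step c ≡ nothing → δ (proj₁ c) (map scanned (proj₂ c)) ≡ nothing
    step-nothing (q , ts) eq with δ q (map scanned ts)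
    ... | nothing = refl

    leadingBits-accepting : ∀ {s : Sym} {ss} → s ≡ bit true → NotBit (nth ss 0) → leadingBits (s ∷ ss) ≡ true ∷ []
    leadingBits-accepting {ss = []}          refl _ = refl
    leadingBits-accepting {ss = blank ∷ ss}  refl _ = refl
    leadingBits-accepting {ss = bit _ ∷ ss}  refl ()
    leadingBits-accepting {ss = aux _ ∷ ss}  refl _ = refl

    accepting-leadingBits : ∀ (s : Sym) ss → leadingBits (s ∷ ss) ≡ true ∷ [] → s ≡ bit true × NotBit (nth ss 0)
    accepting-leadingBits (bit true) []           eq = refl , tt
    accepting-leadingBits (bit true) (blank ∷ ss) eq = refl , tt
    accepting-leadingBits (bit true) (aux _ ∷ ss) eq = refl , tt

    accepting⇒output : ∀ {W} c → Accepting nothing (tileOf W c 0) → output c ≡ true ∷ []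
    accepting⇒output (q , ts) (s , n)
      rewrite Vec.lookup-map out scanned ts | Vec.lookup-map out (λ t → cell t 0) ts =
      leadingBits-accepting s n

    output⇒accepting : ∀ {W} c → output c ≡ true ∷ [] → Accepting nothing (tileOf W c 0)
    output⇒accepting (q , ts) eq
      rewrite Vec.lookup-map out scanned ts | Vec.lookup-map out (λ t → cell t 0) ts =
      accepting-leadingBits _ _ eq

    nth-beyond : ∀ (ss : List Sym) {s} → length ss ≤ s → nth ss s ≡ blank
    nth-beyond []       _         = refl
    nth-beyond (_ ∷ ss) (s≤s le) = nth-beyond ss le

    nth-bits : ∀ w s → nth {auxSymbols} (List.map bit w) s ≡ maybe bit blank (bitAt w s)
    nth-bits []      _       = refl
    nth-bits (_ ∷ _) zero    = refl
    nth-bits (_ ∷ w) (suc s) = nth-bits w s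

    before-input : ∀ w s → nth (before (inputTape {auxSymbols} w)) s ≡ blank
    before-input []      s = refl
    before-input (_ ∷ _) s = refl

    scanned-input : ∀ w → scanned (inputTape {auxSymbols} w) ≡ nth (List.map bit w) 0
    scanned-input []      = refl
    scanned-input (_ ∷ _) = refl

    after-input : ∀ w s → nth (after (inputTape {auxSymbols} w)) s ≡ nth (List.map bit w) (suc s)
    after-input []      s = refl
    after-input (_ ∷ _) s = refl

    initialTapes : Word → Word → Vec (Tape auxSymbols) tapes
    initialTapes x u = proj₂ (initial (x ∷ u ∷ []))

    work-initial : ∀ x u (j : Fin (suc workTapes)) → lookup (initialTapes x u) (2 ↑ʳ j) ≡ inputTape []
    work-initial x u j = Vec.lookup-replicate j (inputTape [])

    before-initial : ∀ x u j s → nth (before (lookup (initialTapes x u) j)) s ≡ blank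
    before-initial x u zero s = before-input x s
    before-initial x u (suc zero) s = before-input u s
    before-initial x u (suc (suc j)) s = cong (λ t → nth (before t) s) (work-initial x u j)

    after-within : ∀ w {s} → length w ≤ s → nth (after (inputTape {auxSymbols} w)) s ≡ blank
    after-within w {s} le = trans (after-input w s) (nth-beyond (List.map bit w)
      (ℕ.≤-trans (ℕ.≤-reflexive (List.length-map bit w)) (ℕ.m≤n⇒m≤1+n le)))

    within-initial : ∀ x u {L} → length x ≤ L → length u ≤ L → Within L (initialTapes x u)
    within-initial x u {L} x≤ u≤ = within beyond
      where
      beyond : ∀ j {s} → L ≤ s → cell (lookup (initialTapes x u) j) s ≡ (blank , blank)
      beyond zero          L≤s = cong₂ _,_ (before-input x _) (after-within x (ℕ.≤-trans x≤ L≤s))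
      beyond (suc zero)    L≤s = cong₂ _,_ (before-input u _) (after-within u (ℕ.≤-trans u≤ L≤s))
      beyond (suc (suc j)) {s} L≤s = cong (λ t → cell t s) (work-initial x u j)

    ≡ᵇ-true : ∀ {m n} → (m ≡ᵇ n) ≡ true → m ≡ n
    ≡ᵇ-true {m} {n} eq = ℕ.≡ᵇ⇒≡ m n (subst T (sym eq) tt)

    ≡ᵇ-refl : ∀ {m n} → m ≡ n → (m ≡ᵇ n) ≡ true
    ≡ᵇ-refl {zero}  refl = refl
    ≡ᵇ-refl {suc m} refl = ≡ᵇ-refl {m} refl

    ≢⇒≡ᵇ-false : ∀ {m n} → m ≢ n → (m ≡ᵇ n) ≡ false
    ≢⇒≡ᵇ-false {m} {n} m≢n with m ≡ᵇ n in eq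
    ... | true  = ⊥-elim (m≢n (≡ᵇ-true eq))
    ... | false = refl

    module _ (x : Word) (P W : ℕ) where

      atOrAfterHead-tileOf : ∀ c s j → atOrAfterHead (tileOf W c s) j ≡ nth (scanned (lookup (proj₂ c) j) ∷ after (lookup (proj₂ c) j)) s
      atOrAfterHead-tileOf (q , ts) zero    j = Vec.lookup-map j scanned ts
      atOrAfterHead-tileOf (q , ts) (suc s) j = cong proj₂ (Vec.lookup-map j _ ts)

      input-cells : ∀ w s → nth (scanned (inputTape {auxSymbols} w) ∷ after (inputTape w)) s ≡ nth (List.map bit w) s
      input-cells w zero    = scanned-input w
      input-cells w (suc s) = after-input w s

      missing-left : ∀ c s → missing (west (tileOf W c s)) ≡ (s ≡ᵇ 0)
      missing-left c zero    = refl
      missing-left c (suc s) = refl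

      missing-right : ∀ c s → missing (east (tileOf W c s)) ≡ (suc s ≡ᵇ W)
      missing-right c s with suc s ≡ᵇ W
      ... | true  = refl
      ... | false = refl

      certificate-bits : ∀ u s → length u ≤ P →
        Certificate (s <ᵇ P) (nth (List.map bit u) s) (nth (List.map bit u) (suc s))
      certificate-bits []          s       le = refl
      certificate-bits (b ∷ u)     s       le = cert (b ∷ u) s le
        where
        cert : ∀ u {Q} s → length u ≤ Q →
          Certificate (s <ᵇ Q) (nth (List.map bit u) s) (nth (List.map bit u) (suc s))
        cert []      s       le       = refl
        cert (b ∷ u) zero    (s≤s le) = refl
        cert (b ∷ u) (suc s) (s≤s le) = cert u s le

      Fits : ℕ → Set
      Fits T = length x + P + T ≤ W

      starting : ∀ u s → length u ≤ P → length x + P ≤ W → s < W → Starting (classOf x P W s) (tileOf W (initial (x ∷ u ∷ [])) s)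
      starting u s u≤P fits s<W =
        refl ,
        (λ j → trans (cong proj₁ (Vec.lookup-map j (λ t → cell t s) ts)) (before-initial x u j s)) ,
        (λ l j → trans (cong proj₂ (Vec.lookup-map j (λ t → cell t s) ts)) (at-last (≡ᵇ-true l) j)) ,
        trans (atOrAfterHead-tileOf c₀ s zero) (trans (input-cells x s) (nth-bits x s)) ,
        subst (λ z → Certificate (s <ᵇ P) z _) (sym (trans (atOrAfterHead-tileOf c₀ s (suc zero)) (input-cells u s)))
          (subst (Certificate (s <ᵇ P) _) (sym (after-input u s)) (certificate-bits u s u≤P)) ,
        (λ j → trans (atOrAfterHead-tileOf c₀ s (2 ↑ʳ j)) (trans
          (cong (λ t → nth (scanned t ∷ after t) s) (work-initial x u j)) (input-cells [] s)))
        where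
        c₀ = initial (x ∷ u ∷ [])
        ts = initialTapes x u
        beyond : ∀ w → length w ≤ length x + P → suc s ≡ W → nth (after (inputTape {auxSymbols} w)) s ≡ blank
        beyond w le eq = trans (after-input w s) (nth-beyond (List.map bit w)
          (ℕ.≤-trans (ℕ.≤-reflexive (List.length-map bit w))
            (ℕ.≤-trans le (ℕ.≤-trans fits (ℕ.≤-reflexive (sym eq))))))
        at-last : suc s ≡ W → ∀ j → nth (after (lookup ts j)) s ≡ blank
        at-last eq zero          = beyond x (ℕ.m≤m+n _ _) eq
        at-last eq (suc zero)    = beyond u (ℕ.≤-trans u≤P (ℕ.m≤n+m _ _)) eq
        at-last eq (suc (suc j)) = cong (λ t → nth (after t) s) (work-initial x u j)

      -- Constant from the halt on, so that a run shorter than the square still supplies every row.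
      configAt : ∀ {c T d} → c ⇓[ T ] d → ℕ → Config
      configAt {c} (halted _) _       = c
      configAt {c} (next _ r) zero    = c
      configAt     (next _ r) (suc t) = configAt r t

      configAt-zero : ∀ {c T d} (r : c ⇓[ T ] d) → configAt r 0 ≡ c
      configAt-zero (halted _) = refl
      configAt-zero (next _ _) = refl

      configAt-halted : ∀ {c T d} (r : c ⇓[ T ] d) t → step (configAt r t) ≡ nothing → configAt r t ≡ d
      configAt-halted (halted _) t       eq = refl
      configAt-halted (next e r) zero    eq with () ← trans (sym e) eq
      configAt-halted (next e r) (suc t) eq = configAt-halted r t eq

      configAt-next : ∀ {c T d} (r : c ⇓[ T ] d) t → step (configAt r t) ≢ nothing →
        step (configAt r t) ≡ just (configAt r (suc t))
      configAt-next (halted e) t       ne = ⊥-elim (ne e)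
      configAt-next (next e r) zero    ne = trans e (cong just (sym (configAt-zero r)))
      configAt-next (next e r) (suc t) ne = configAt-next r t ne

      within-configAt : ∀ {c T d L} (r : c ⇓[ T ] d) t → Within L (proj₂ c) → Within (L + T) (proj₂ (configAt r t))
      within-configAt {L = L} (halted _) t wi = within-mono (ℕ.m≤m+n L 0) wi
      within-configAt {L = L} (next _ r) zero wi = within-mono (ℕ.m≤m+n L _) wi
      within-configAt {c} {L = L} (next {t = T} e r) (suc t) wi with stepped {as = as} _ ← step-just c e =
        within-mono (ℕ.≤-reflexive (sym (ℕ.+-suc L T))) (within-configAt r t (within-act (proj₂ c) as wi))

      vertical-tileOf : ∀ c c′ s → Within W (proj₂ c) → Stepped c c′ → Vertical (tileOf W c s) (tileOf W c′ s)
      vertical-tileOf (q , ts) _ s wi (stepped {q′} {as} eq) rewrite eq =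
        refl , column-act ts as s wi , λ m j → atHead s m j
        where
        atHead : ∀ s → missing (leftOf ts s) ≡ true → ∀ j → _ ≡ rescanned (lookup as j) (lookup (column ts s) j)
        atHead zero _ j = scan-act ts as j

      tiling-of-run : ∀ u {T d} → length u ≤ P → (r : initial (x ∷ u ∷ []) ⇓[ T ] d) → Fits T →
        output d ≡ true ∷ [] → ∃[ τ ] Tiling W (classOf x P W) τ
      tiling-of-run u {T} {d} u≤P r fits accepts = τ , record
        { admissible = λ {t} {s} _ s<W →
            missing-left (configAt r t) s , missing-right (configAt r t) s ,
            (λ s≡0 → subst (λ s → Accepting (uncurry δ (global (τ t s))) (τ t s)) (sym (≡ᵇ-true {s} s≡0)) (accepting t)) ,
            (λ t≡0 → subst (λ c → Starting (classOf x P W s) (tileOf W c s))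
              (sym (trans (cong (configAt r) (≡ᵇ-true {t} t≡0)) (configAt-zero r)))
              (starting u s u≤P (ℕ.≤-trans (ℕ.m≤m+n _ T) fits) s<W))
        ; horizontal = λ {t} {s} _ s′<W → refl , refl , right-tileOf (configAt r t) s s′<W
        ; vertical = λ {t} {s} _ _ → vertical′ t s }
        where
        τ : ℕ → ℕ → Tile
        τ t = tileOf W (configAt r t)
        accepting : ∀ t → Accepting (uncurry δ (global (τ t 0))) (τ t 0)
        accepting t with uncurry δ (global (τ t 0)) in eq
        ... | just _  = tt
        ... | nothing = output⇒accepting {W} (configAt r t) (trans
                (cong output (configAt-halted r t (cong (Maybe.map _) eq))) accepts)
        right-tileOf : ∀ c s → suc s < W → rightOf W (proj₂ c) s ≡ just (column (proj₂ c) (suc s))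
        right-tileOf c s s′<W rewrite ≢⇒≡ᵇ-false {suc s} {W} (ℕ.<⇒≢ s′<W) = refl
        vertical′ : ∀ t s → Vertical (τ t s) (τ (suc t) s)
        vertical′ t s with step (configAt r t) in eq
        ... | nothing = subst (λ a → Successor a (τ t s) (τ (suc t) s)) (sym (step-nothing (configAt r t) eq)) tt
        ... | just c′ = vertical-tileOf (configAt r t) _ s
                (within-mono fits (within-configAt r t (within-initial x u (ℕ.m≤m+n _ _) (ℕ.≤-trans u≤P (ℕ.m≤n+m _ _)))))
                (step-just (configAt r t) (configAt-next r t λ n → case trans (sym eq) n of λ ()))

      -- The rows are compared with the run of `M` on the certificate read off row 0. That this run
      -- halts before the rows are exhausted has to be assumed in `run-accepts`: acceptance is
      -- demanded of halted rows only, so a tiling alone does not exclude a run that is still going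
      -- on.
      module Soundness {τ : ℕ → ℕ → Tile} (tiling : Tiling W (classOf x P W) τ) (1<W : 1 < W)
                       (x+P≤W : length x + P < W) where

        open Tiling tiling

        0<W : 0 < W
        0<W = ℕ.<-trans (s≤s z≤n) 1<W

        neighbours : ∀ {t ts} → t < W → (∀ {s} → s < W → own (τ t s) ≡ column ts s) →
          ∀ {s} → s < W → west (τ t s) ≡ leftOf ts s × east (τ t s) ≡ rightOf W ts s
        neighbours {t} {ts} t<W owns s<W = lefts _ s<W , rights _ s<W
          where
          missing⇒nothing : ∀ {A : Set} {m : Maybe A} → missing m ≡ true → m ≡ nothing
          missing⇒nothing {m = nothing} _ = refl
          lefts : ∀ s → s < W → west (τ t s) ≡ leftOf ts s
          lefts zero    s<W = missing⇒nothing (proj₁ (admissible t<W s<W))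
          lefts (suc s) s<W = trans (proj₁ (proj₂ (horizontal t<W s<W))) (cong just (owns (ℕ.<-trans ℕ.≤-refl s<W)))
          rights : ∀ s → s < W → east (τ t s) ≡ rightOf W ts s
          rights s s<W with suc s ≡ᵇ W in eq
          ... | true  = missing⇒nothing (trans (proj₁ (proj₂ (admissible t<W s<W))) eq)
          ... | false = trans (proj₂ (proj₂ (horizontal t<W s′<W))) (cong just (owns s′<W))
            where
            s′<W : suc s < W
            s′<W = ℕ.≤∧≢⇒< s<W λ e → case trans (sym (≡ᵇ-refl e)) eq of λ ()

        global-constant : ∀ {t} → t < W → ∀ s → s < W → global (τ t s) ≡ global (τ t 0)
        global-constant t<W zero    s<W = refl
        global-constant t<W (suc s) s<W = trans (sym (proj₁ (horizontal t<W s<W))) (global-constant t<W s (ℕ.<-trans ℕ.≤-refl s<W))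

        Row : ℕ → Config → Set
        Row t c = ∀ {s} → s < W → τ t s ≡ tileOf W c s

        row : ∀ {t} q ts → t < W → global (τ t 0) ≡ (q , map scanned ts) →
          (∀ {s} → s < W → own (τ t s) ≡ column ts s) → Row t (q , ts)
        row {t} q ts t<W g owns {s} s<W with l , r ← neighbours {ts = ts} t<W owns s<W =
          assemble (trans (global-constant t<W s s<W) g) l (owns s<W) r
          where
          assemble : ∀ {a b : Tile} → global a ≡ global b → west a ≡ west b → own a ≡ own b → east a ≡ east b → a ≡ b
          assemble refl refl refl refl = refl

        row-step : ∀ {t c c′} → suc t < W → Within W (proj₂ c) → Stepped c c′ → Row t c → Row (suc t) c′
        row-step {t} {q , ts} t′<W wi (stepped {q′} {as} eq) rowₜ =
          row q′ (zipWith act ts as) t′<W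
            (cong₂ _,_ (proj₁ (succ 0<W)) (lookup-ext λ j → trans (proj₂ (proj₂ (succ 0<W)) refl j) (sym (scan-act ts as j))))
            (λ {s} s<W → lookup-ext λ j → trans (proj₁ (proj₂ (succ s<W)) j) (sym (column-act ts as s wi j)))
          where
          succ : ∀ {s} → s < W → Successor (just (q′ , as)) (tileOf W (q , ts) s) (τ (suc t) s)
          succ {s} s<W = subst (λ d → Successor d (tileOf W (q , ts) s) (τ (suc t) s)) eq
            (subst (λ a → Vertical a (τ (suc t) s)) (rowₜ s<W) (vertical t′<W s<W))

        -- Induction along the run. A step raises the row `t` and the occupied width `L` by one
        -- while the remaining time falls by one, which preserves both bounds; the row of the halt
        -- is checked in column 0.
        accepted : ∀ {c T d t} (r : c ⇓[ T ] d) {L} → Within L (proj₂ c) → L + T ≤ W → t + T < W → Row t c →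
          output d ≡ true ∷ []
        accepted {c} {t = t} (halted e) wi L≤ t< rowₜ = accepting⇒output {W} c
          (subst (λ d → Accepting d (tileOf W c 0)) (step-nothing c e)
            (subst (λ a → Accepting (uncurry δ (global a)) a) (rowₜ 0<W)
              (proj₁ (proj₂ (proj₂ (admissible (ℕ.≤-<-trans (ℕ.m≤m+n t 0) t<) 0<W))) refl)))
        accepted {c} {t = t} (next {t = T} e r) {L} wi L≤ t< rowₜ with st@(stepped {as = as} _) ← step-just c e =
          accepted r (within-act (proj₂ c) as wi) (ℕ.≤-trans (ℕ.≤-reflexive (sym (ℕ.+-suc L T))) L≤)
            (ℕ.≤-<-trans (ℕ.≤-reflexive (sym (ℕ.+-suc t T))) t<)
            (row-step (ℕ.≤-<-trans (ℕ.≤-trans (s≤s (ℕ.m≤m+n t T)) (ℕ.≤-reflexive (sym (ℕ.+-suc t T)))) t<)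
              (within-mono (ℕ.≤-trans (ℕ.m≤m+n L _) L≤) wi) st rowₜ)

        starting₀ : ∀ {s} → s < W → Starting (classOf x P W s) (τ 0 s)
        starting₀ s<W = proj₂ (proj₂ (proj₂ (admissible 0<W s<W))) refl

        afterHead₀ : ∀ {s} → suc s < W → ∀ j → atOrAfterHead (τ 0 (suc s)) j ≡ proj₂ (lookup (own (τ 0 s)) j)
        afterHead₀ {s} s′<W j = cong (maybe (λ c → proj₂ (lookup c j)) _) (proj₁ (proj₂ (horizontal 0<W s′<W)))

        last-blank : ∀ {s} → s < W → suc s ≡ W → ∀ j → proj₂ (lookup (own (τ 0 s)) j) ≡ blank
        last-blank s<W eq = proj₁ (proj₂ (proj₂ (starting₀ s<W))) (≡ᵇ-refl eq)

        -- Continued by blanks outside the grid, so that the local condition on certificates holds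
        -- for the whole sequence, across the right border too.
        certificateCell : ℕ → Sym
        certificateCell s = if s <ᵇ W then atOrAfterHead (τ 0 s) (suc zero) else blank

        inside : ∀ {s} → s < W → certificateCell s ≡ atOrAfterHead (τ 0 s) (suc zero)
        inside {s} s<W with s <ᵇ W in eq
        ... | true  = refl
        ... | false = ⊥-elim (subst T eq (ℕ.<⇒<ᵇ s<W))

        outside : ∀ {s} → W ≤ s → certificateCell s ≡ blank
        outside {s} W≤s with s <ᵇ W in eq
        ... | false = refl
        ... | true  = ⊥-elim (ℕ.<⇒≱ (ℕ.<ᵇ⇒< s W (subst T (sym eq) tt)) W≤s)

        certificateCells : ∀ s → Certificate (s <ᵇ P) (certificateCell s) (certificateCell (suc s))
        certificateCells s with s <? W
        ... | no s≮W rewrite outside (ℕ.≮⇒≥ s≮W) = outside (ℕ.m≤n⇒m≤1+n (ℕ.≮⇒≥ s≮W))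
        ... | yes s<W rewrite inside s<W = subst (Certificate (s <ᵇ P) _) (sym (nextCell (suc s <? W)))
                                             (proj₁ (proj₂ (proj₂ (proj₂ (proj₂ (starting₀ s<W))))))
          where
          nextCell : Dec (suc s < W) → certificateCell (suc s) ≡ proj₂ (lookup (own (τ 0 s)) (suc zero))
          nextCell (yes s′<W) = trans (inside s′<W) (afterHead₀ s′<W (suc zero))
          nextCell (no s′≮W)  = trans (outside (ℕ.≮⇒≥ s′≮W))
            (sym (last-blank s<W (ℕ.≤-antisym s<W (ℕ.≮⇒≥ s′≮W)) (suc zero)))

        -- Each bit uses up one unit of the bound, since a bit at position 0 requires `Q` to be
        -- positive, and the first blank forces all later cells to be blank.
        read : ∀ Q (c : ℕ → Sym) → (∀ s → Certificate (s <ᵇ Q) (c s) (c (suc s))) →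
          ∃[ u ] length u ≤ Q × (∀ s → c s ≡ nth (List.map bit u) s)
        read Q c cells with c 0 in eq | cells 0
        read Q c cells | blank | _ = [] , z≤n , blanks
          where
          blanks : ∀ s → c s ≡ blank
          blanks zero    = eq
          blanks (suc s) = subst (λ z → Certificate (s <ᵇ Q) z (c (suc s))) (blanks s) (cells s)
        read (suc Q) c cells | bit b | _ with u , u≤Q , bits ← read Q (c ∘ suc) (cells ∘ suc) =
          b ∷ u , s≤s u≤Q , λ { zero → eq ; (suc s) → bits s }

        certified : ∃[ u ] length u ≤ P × (∀ s → certificateCell s ≡ nth (List.map bit u) s)
        certified = read P certificateCell certificateCells

        u : Word
        u = proj₁ certified

        u≤P : length u ≤ P
        u≤P = proj₁ (proj₂ certified)

        ts₀ : Vec (Tape auxSymbols) tapes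
        ts₀ = initialTapes x u

        content : Fin tapes → ℕ → Sym
        content j s = nth (scanned (lookup ts₀ j) ∷ after (lookup ts₀ j)) s

        heads₀ : ∀ j {s} → s < W → atOrAfterHead (τ 0 s) j ≡ content j s
        heads₀ zero       {s} s<W = trans (proj₁ (proj₂ (proj₂ (proj₂ (starting₀ s<W)))))
                                      (sym (trans (input-cells x s) (nth-bits x s)))
        heads₀ (suc zero) {s} s<W = trans (sym (inside s<W))
                                      (trans (proj₂ (proj₂ certified) s) (sym (input-cells u s)))
        heads₀ (suc (suc j)) {s} s<W = trans (proj₂ (proj₂ (proj₂ (proj₂ (proj₂ (starting₀ s<W))))) j)
          (sym (trans (cong (λ t → nth (scanned t ∷ after t) s) (work-initial x u j)) (input-cells [] s)))

        -- The cell after column s is the at-or-after cell of column s + 1. The last column has no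
        -- such neighbour; its cell is blank on both sides of the equation, since `x` and `u` are
        -- shorter than `W`.
        after₀ : ∀ j {s} → s < W → proj₂ (lookup (own (τ 0 s)) j) ≡ nth (after (lookup ts₀ j)) s
        after₀ j {s} s<W with suc s <? W
        ... | yes s′<W = trans (sym (afterHead₀ s′<W j)) (heads₀ j s′<W)
        ... | no s′≮W = trans (last-blank s<W eq j) (sym (cong proj₂
                (Within.beyond (within-initial x u {s} (bound (ℕ.m≤m+n (length x) P)) (bound (ℕ.≤-trans u≤P (ℕ.m≤n+m P (length x))))) j ℕ.≤-refl)))
          where
          eq : suc s ≡ W
          eq = ℕ.≤-antisym s<W (ℕ.≮⇒≥ s′≮W)
          bound : ∀ {n} → n ≤ length x + P → n ≤ s
          bound le = ℕ.≤-pred (ℕ.≤-trans (s≤s le) (ℕ.≤-trans x+P≤W (ℕ.≤-reflexive (sym eq))))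

        row₀ : Row 0 (initial (x ∷ u ∷ []))
        row₀ = row start ts₀ 0<W
          (cong₂ _,_ (proj₁ (starting₀ 0<W)) (lookup-ext λ j →
            trans (sym (head-scanned j)) (trans (heads₀ j 0<W) (sym (Vec.lookup-map j scanned ts₀)))))
          (λ {s} s<W → lookup-ext λ j → trans
            (cong₂ _,_ (trans (proj₁ (proj₂ (starting₀ s<W)) j) (sym (before-initial x u j s))) (after₀ j s<W))
            (sym (Vec.lookup-map j (λ t → cell t s) ts₀)))
          where
          head-scanned : ∀ j → atOrAfterHead (τ 0 0) j ≡ lookup (proj₂ (global (τ 0 0))) j
          head-scanned j with west (τ 0 0) | proj₁ (admissible 0<W 0<W)
          ... | nothing | _ = refl

        run-accepts : ∀ {T d} → initial (x ∷ u ∷ []) ⇓[ T ] d → Fits T → T < W → output d ≡ true ∷ []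
        run-accepts r fits T<W =
          accepted r (within-initial x u (ℕ.m≤m+n _ _) (ℕ.≤-trans u≤P (ℕ.m≤n+m _ _))) fits T<W row₀

-- Tilings as 3-colourings of a triangle-free graph

module Colourings where

  open FiniteTypes
  open Finite
  open PerfectDivisibility using (no-triangle⇒triangle-free)
  open Tilings using (Class; classOf; isOdd)
  open Class

  clamp : ∀ {n} → ℕ → Fin (suc n)
  clamp         zero    = zero
  clamp {zero}  (suc i) = zero
  clamp {suc n} (suc i) = suc (clamp i)

  toℕ-clamp : ∀ {n i} → i ≤ n → toℕ (clamp {n} i) ≡ i
  toℕ-clamp z≤n      = refl
  toℕ-clamp (s≤s le) = cong suc (toℕ-clamp le)

  Follows : ∀ {n} → Fin (suc n) → Fin (suc n) → Set
  Follows {n} i j = toℕ j ≡ suc (toℕ i) ⊎ (toℕ i ≡ n × toℕ j ≡ 0)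

  follows? : ∀ {n} (i j : Fin (suc n)) → Dec (Follows i j)
  follows? i j = (_ ℕ.≟ _) ⊎-dec ((_ ℕ.≟ _) ×-dec (_ ℕ.≟ _))

  follows-functional : ∀ {n} {i j k : Fin (suc n)} → Follows i j → Follows i k → j ≡ k
  follows-functional (inj₁ p) (inj₁ q) = Fin.toℕ-injective (trans p (sym q))
  follows-functional {j = j} (inj₁ p) (inj₂ (q , _)) = ⊥-elim (ℕ.<-irrefl (trans p (cong suc q)) (Fin.toℕ<n j))
  follows-functional {k = k} (inj₂ (p , _)) (inj₁ q) = ⊥-elim (ℕ.<-irrefl (trans q (cong suc p)) (Fin.toℕ<n k))
  follows-functional (inj₂ (_ , p)) (inj₂ (_ , q)) = Fin.toℕ-injective (trans p (sym q))

  follows-injective : ∀ {n} {i j k : Fin (suc n)} → Follows j i → Follows k i → j ≡ k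
  follows-injective (inj₁ p) (inj₁ q) = Fin.toℕ-injective (ℕ.suc-injective (trans (sym p) q))
  follows-injective (inj₁ p) (inj₂ (_ , q)) with () ← trans (sym p) q
  follows-injective (inj₂ (_ , p)) (inj₁ q) with () ← trans (sym p) q
  follows-injective (inj₂ (p , _)) (inj₂ (q , _)) = Fin.toℕ-injective (trans p (sym q))

  follows-irreflexive : ∀ {n} {i : Fin (suc (suc n))} → ¬ Follows i i
  follows-irreflexive (inj₁ p) = ℕ.m≢1+m+n _ (trans p (cong suc (sym (ℕ.+-identityʳ _))))
  follows-irreflexive (inj₂ (p , q)) with () ← trans (sym p) q

  Adjacent : ∀ {n} → Fin (suc n) → Fin (suc n) → Set
  Adjacent i j = Follows i j ⊎ Follows j i

  no-directed-triangle : ∀ {n} {i j k : Fin (4 + n)} → Follows i j → Follows j k → Follows k i → ⊥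
  no-directed-triangle (inj₁ p) (inj₁ q) (inj₁ r) rewrite p | q = ℕ.m≢1+m+n _ {2} (trans r (cong suc (ℕ.+-comm 2 _)))
  no-directed-triangle (inj₁ p) (inj₁ q) (inj₂ (r , r′)) rewrite p | q | r′ with () ← r
  no-directed-triangle (inj₁ p) (inj₂ (q , q′)) (inj₁ r) rewrite p | q′ | r with () ← q
  no-directed-triangle (inj₁ p) (inj₂ (q , q′)) (inj₂ (r , r′)) with () ← trans (sym q′) r
  no-directed-triangle (inj₂ (p , p′)) (inj₁ q) (inj₁ r) rewrite p′ | q | r with () ← p
  no-directed-triangle (inj₂ (p , p′)) (inj₁ q) (inj₂ (r , r′)) with () ← trans (sym p) r′
  no-directed-triangle (inj₂ (p , p′)) (inj₂ (q , q′)) r with () ← trans (sym p′) q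

  cycle-no-triangle′ : ∀ {n} {i j k : Fin (4 + n)} → Adjacent i j → Adjacent j k → Adjacent i k → ⊥
  cycle-no-triangle′ (inj₁ ij) (inj₁ jk) (inj₁ ik) with refl ← follows-functional ij ik = follows-irreflexive jk
  cycle-no-triangle′ (inj₁ ij) (inj₁ jk) (inj₂ ki) = no-directed-triangle ij jk ki
  cycle-no-triangle′ (inj₁ ij) (inj₂ kj) (inj₁ ik) with refl ← follows-injective ij kj = follows-irreflexive ik
  cycle-no-triangle′ (inj₁ ij) (inj₂ kj) (inj₂ ki) with refl ← follows-functional kj ki = follows-irreflexive ij
  cycle-no-triangle′ (inj₂ ji) (inj₁ jk) (inj₁ ik) with refl ← follows-functional ji jk = follows-irreflexive ik
  cycle-no-triangle′ (inj₂ ji) (inj₁ jk) (inj₂ ki) with refl ← follows-functional ji jk = follows-irreflexive ki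
  cycle-no-triangle′ (inj₂ ji) (inj₂ kj) (inj₁ ik) = no-directed-triangle ji ik kj
  cycle-no-triangle′ (inj₂ ji) (inj₂ kj) (inj₂ ki) with refl ← follows-functional kj ki = follows-irreflexive ji

  cycle-no-triangle : ∀ {n} {i j k : Fin (suc n)} → 3 ≤ n → Adjacent i j → Adjacent j k → Adjacent i k → ⊥
  cycle-no-triangle (s≤s (s≤s (s≤s _))) = cycle-no-triangle′

  third-colour : ∀ (p q x y : Fin 3) → p ≢ q → x ≢ p → x ≢ q → y ≢ p → y ≢ q → x ≡ y
  third-colour = from-yes (Fin.all? λ (p : Fin 3) → Fin.all? λ q → Fin.all? λ x → Fin.all? λ y →
    ¬? (p Fin.≟ q) →-dec (¬? (x Fin.≟ p) →-dec (¬? (x Fin.≟ q) →-dec (¬? (y Fin.≟ p) →-dec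
    (¬? (y Fin.≟ q) →-dec (x Fin.≟ y))))))

  -- Without `r` two colours remain, which alternate along the positions 0 to 2m. Hence both ends
  -- agree, although the cycle joins them.
  odd-cycle : ∀ m (f : Fin (suc (m + m)) → Fin 3) r → (∀ i → f i ≢ r) →
    (∀ {i j} → Follows i j → f i ≢ f j) → ⊥
  odd-cycle m f r avoids proper =
    proper (inj₂ (toℕ-clamp ℕ.≤-refl , refl)) (alternates m ℕ.≤-refl)
    where
    g : ℕ → Fin 3
    g i = f (clamp i)
    next : ∀ {i} → suc i ≤ m + m → g i ≢ g (suc i)
    next le = proper (inj₁ (trans (toℕ-clamp le) (cong suc (sym (toℕ-clamp (ℕ.<⇒≤ le))))))
    alternates : ∀ j → j ≤ m → g (j + j) ≡ g 0
    alternates zero    _  = refl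
    alternates (suc j) le rewrite ℕ.+-suc j j = trans
      (third-colour r (g (suc (j + j))) (g (suc (suc (j + j)))) (g (j + j)) (≢-sym (avoids _))
        (avoids _) (≢-sym (next bound)) (avoids _) (next (ℕ.<⇒≤ bound)))
      (alternates j (ℕ.<⇒≤ le))
      where
      bound : suc (suc (j + j)) ≤ m + m
      bound = subst (_≤ m + m) (cong suc (ℕ.+-suc j j)) (ℕ.+-mono-≤ le le)

  -- The Grötzsch graph without the edge between its hub and petal 0.
  data Palette : Set where
    hub       : Palette
    petal rim : Fin 5 → Palette

  -- Mycielski's construction over the 5-cycle of the rim: petal i is joined to the rim neighbours
  -- of rim i, and the hub to the petals, here without petal 0. Each edge is listed in one
  -- direction.
  PaletteEdge : Palette → Palette → Set
  PaletteEdge hub       (petal i) = i ≢ zero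
  PaletteEdge (petal i) (rim j)   = Adjacent i j
  PaletteEdge (rim i)   (rim j)   = Follows i j
  PaletteEdge _         _         = ⊥

  paletteEdge? : ∀ p q → Dec (PaletteEdge p q)
  paletteEdge? hub       hub       = no λ ()
  paletteEdge? hub       (petal i) = ¬? (i Fin.≟ zero)
  paletteEdge? hub       (rim _)   = no λ ()
  paletteEdge? (petal _) hub       = no λ ()
  paletteEdge? (petal _) (petal _) = no λ ()
  paletteEdge? (petal i) (rim j)   = follows? i j ⊎-dec follows? j i
  paletteEdge? (rim _)   hub       = no λ ()
  paletteEdge? (rim _)   (petal _) = no λ ()
  paletteEdge? (rim i)   (rim j)   = follows? i j

  finite-Palette : Finite Palette
  finite-Palette = finite-retract
    (λ { hub → inj₁ zero ; (petal i) → inj₂ (inj₁ i) ; (rim i) → inj₂ (inj₂ i) })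
    (λ { (inj₁ _) → hub ; (inj₂ (inj₁ i)) → petal i ; (inj₂ (inj₂ i)) → rim i })
    (λ { hub → refl ; (petal _) → refl ; (rim _) → refl })
    (finite-⊎ (finite-Fin 1) (finite-⊎ (finite-Fin 5) (finite-Fin 5)))

  PaletteAdjacent : Palette → Palette → Set
  PaletteAdjacent p q = PaletteEdge p q ⊎ PaletteEdge q p

  3≤4 : 3 ≤ 4
  3≤4 = s≤s (s≤s (s≤s z≤n))

  palette-no-triangle : ∀ p q r → PaletteAdjacent p q → PaletteAdjacent q r → PaletteAdjacent p r → ⊥
  palette-no-triangle hub       hub       _         (inj₁ ())
  palette-no-triangle hub       hub       _         (inj₂ ())
  palette-no-triangle _         hub       hub       _ (inj₁ ())
  palette-no-triangle _         hub       hub       _ (inj₂ ())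
  palette-no-triangle hub       (rim _)   _         (inj₁ ())
  palette-no-triangle hub       (rim _)   _         (inj₂ ())
  palette-no-triangle hub       _         (rim _)   _ _ (inj₁ ())
  palette-no-triangle hub       _         (rim _)   _ _ (inj₂ ())
  palette-no-triangle hub       _         hub       _ _ (inj₁ ())
  palette-no-triangle hub       _         hub       _ _ (inj₂ ())
  palette-no-triangle (rim _)   hub       _         (inj₁ ())
  palette-no-triangle (rim _)   hub       _         (inj₂ ())
  palette-no-triangle _         hub       (rim _)   _ (inj₁ ())
  palette-no-triangle _         hub       (rim _)   _ (inj₂ ())
  palette-no-triangle _         (rim _)   hub       _ (inj₁ ())
  palette-no-triangle _         (rim _)   hub       _ (inj₂ ())
  palette-no-triangle (rim _)   _         hub       _ _ (inj₁ ())
  palette-no-triangle (rim _)   _         hub       _ _ (inj₂ ())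
  palette-no-triangle (petal _) (petal _) _         (inj₁ ())
  palette-no-triangle (petal _) (petal _) _         (inj₂ ())
  palette-no-triangle _         (petal _) (petal _) _ (inj₁ ())
  palette-no-triangle _         (petal _) (petal _) _ (inj₂ ())
  palette-no-triangle (petal _) _         (petal _) _ _ (inj₁ ())
  palette-no-triangle (petal _) _         (petal _) _ _ (inj₂ ())
  palette-no-triangle (petal i) (rim j) (rim k) (inj₁ ij) jk (inj₁ ik) = cycle-no-triangle 3≤4 ij jk ik
  palette-no-triangle (rim i) (petal j) (rim k) (inj₂ ji) (inj₁ jk) ik = cycle-no-triangle 3≤4 (swap ji) jk ik
  palette-no-triangle (rim i) (rim j) (petal k) ij (inj₂ kj) (inj₂ ki) = cycle-no-triangle 3≤4 ij (swap kj) (swap ki)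
  palette-no-triangle (rim i) (rim j) (rim k) ij jk ik = cycle-no-triangle 3≤4 ij jk ik

  -- Mycielski's argument: otherwise recolouring the rim vertices of the colour of the hub by
  -- the colours of their petals leaves only two colours on the odd rim.
  petal≡hub : (c : Palette → Fin 3) → (∀ {p q} → PaletteEdge p q → c p ≢ c q) → c (petal zero) ≡ c hub
  petal≡hub c proper = decidable-stable (_ Fin.≟ _) λ differ →
    odd-cycle 2 recoloured (c hub) (avoids differ) recoloured-proper
    where
    recoloured : Fin 5 → Fin 3
    recoloured i = if does (c (rim i) Fin.≟ c hub) then c (petal i) else c (rim i)
    avoids : c (petal zero) ≢ c hub → ∀ i → recoloured i ≢ c hub
    avoids differ i with c (rim i) Fin.≟ c hub
    ... | no  ≢hub = ≢hub
    avoids differ zero    | yes _ = differ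
    avoids differ (suc i) | yes _ = ≢-sym (proper {hub} {petal (suc i)} λ ())
    recoloured-proper : ∀ {i j} → Follows i j → recoloured i ≢ recoloured j
    recoloured-proper {i} {j} ij with c (rim i) Fin.≟ c hub | c (rim j) Fin.≟ c hub
    ... | yes p | yes q = λ _ → proper {rim i} {rim j} ij (trans p (sym q))
    ... | yes p | no  _ = proper {petal i} {rim j} (inj₁ ij)
    ... | no  _ | yes q = ≢-sym (proper {petal j} {rim i} (inj₂ ij))
    ... | no  _ | no  _ = proper {rim i} {rim j} ij

  -- The colours 0, 1, 2, 1, 2 in cyclic order. Colour 0 occurs only at index 0, so petals coloured
  -- alike leave it to the hub, and petals 0, 1 and 2 show the three colours.
  rimColour : Fin 5 → Fin 3
  rimColour zero                = zero
  rimColour (suc zero)          = suc zero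
  rimColour (suc (suc zero))    = suc (suc zero)
  rimColour (suc (suc (suc i))) = suc i

  rimColour-proper : ∀ i j → Follows i j → rimColour i ≢ rimColour j
  rimColour-proper = from-yes (Fin.all? λ i → Fin.all? λ j → follows? i j →-dec ¬? (rimColour i Fin.≟ rimColour j))

  rimColour≢zero : ∀ i → i ≢ zero → zero ≢ rimColour i
  rimColour≢zero = from-yes (Fin.all? λ i → ¬? (i Fin.≟ zero) →-dec ¬? (zero Fin.≟ rimColour i))

  paletteColour : Palette → Fin 3
  paletteColour hub       = zero
  paletteColour (petal i) = rimColour i
  paletteColour (rim i)   = rimColour i

  paletteColour-proper : ∀ {p q} → PaletteEdge p q → paletteColour p ≢ paletteColour q
  paletteColour-proper {hub}     {petal i} i≢0       = rimColour≢zero i i≢0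
  paletteColour-proper {petal i} {rim j}   (inj₁ ij) = rimColour-proper i j ij
  paletteColour-proper {petal i} {rim j}   (inj₂ ji) = ≢-sym (rimColour-proper j i ji)
  paletteColour-proper {rim i}   {rim j}   ij        = rimColour-proper i j ij

  data Rel : Set where
    far prev same next : Rel

  _≟ᴿ_ : (r r′ : Rel) → Dec (r ≡ r′)
  _≟ᴿ_ = decEq (finite-retract
    (λ { far → zero ; prev → suc zero ; same → suc (suc zero) ; next → suc (suc (suc zero)) })
    (λ { zero → far ; (suc zero) → prev ; (suc (suc zero)) → same ; (suc (suc (suc zero))) → next })
    (λ { far → refl ; prev → refl ; same → refl ; next → refl }) (finite-Fin 4))

  rel : ℕ → ℕ → Rel
  rel (suc i) (suc j)       = rel i j
  rel zero    zero          = same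
  rel zero    (suc zero)    = next
  rel zero    (suc (suc _)) = far
  rel (suc zero)    zero    = prev
  rel (suc (suc _)) zero    = far

  flip : Rel → Rel
  flip far  = far
  flip prev = next
  flip same = same
  flip next = prev

  rel-flip : ∀ i j → rel j i ≡ flip (rel i j)
  rel-flip zero    zero          = refl
  rel-flip zero    (suc zero)    = refl
  rel-flip zero    (suc (suc _)) = refl
  rel-flip (suc zero)    zero    = refl
  rel-flip (suc (suc _)) zero    = refl
  rel-flip (suc i) (suc j)       = rel-flip i j

  rel-same : ∀ i j → rel i j ≡ same → j ≡ i
  rel-same zero          zero          _  = refl
  rel-same (suc zero)    zero          ()
  rel-same (suc (suc _)) zero          ()
  rel-same zero          (suc zero)    ()
  rel-same zero          (suc (suc _)) ()
  rel-same (suc i)       (suc j)       eq = cong suc (rel-same i j eq)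

  rel-next : ∀ i j → rel i j ≡ next → j ≡ suc i
  rel-next zero          (suc zero)    _  = refl
  rel-next zero          zero          ()
  rel-next zero          (suc (suc _)) ()
  rel-next (suc zero)    zero          ()
  rel-next (suc (suc _)) zero          ()
  rel-next (suc i)       (suc j)       eq = cong suc (rel-next i j eq)

  rel-refl : ∀ i → rel i i ≡ same
  rel-refl zero    = refl
  rel-refl (suc i) = rel-refl i

  rel-suc : ∀ i → rel i (suc i) ≡ next
  rel-suc zero    = refl
  rel-suc (suc i) = rel-suc i

  does⇒ : ∀ {A : Set} (d : Dec A) → does d ≡ true → A
  does⇒ (yes p) _ = p

  record TileSystem (K : ℕ) : Set₁ where
    field
      Ok  : Class → Class → Fin K → Set
      ok? : ∀ ρ κ a → Dec (Ok ρ κ a)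
      Hor Ver : Fin K → Fin K → Set
      hor? : ∀ a b → Dec (Hor a b)
      ver? : ∀ a b → Dec (Ver a b)

  -- The number of tiles is taken odd because the cycle of a site has one vertex for each tile and
  -- must be odd.
  module Gadgets (m : ℕ) (S : TileSystem (suc (m + m))) where

    n : ℕ
    n = m + m

    open TileSystem S

    -- choice a has the colour of petal 0 if tile a is chosen; otherwise it has the one colour
    -- left by petal 0 and petal 1 (on even sites) or petal 2 (on odd sites).
    data Local : Set where
      palette : Palette → Local
      choice cycle : Fin (suc n) → Local

    opaque
      finite-Local : Finite Local
      finite-Local = finite-retract
        (λ { (palette p) → inj₁ p ; (choice a) → inj₂ (inj₁ a) ; (cycle a) → inj₂ (inj₂ a) })
        (λ { (inj₁ p) → palette p ; (inj₂ (inj₁ a)) → choice a ; (inj₂ (inj₂ a)) → cycle a })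
        (λ { (palette _) → refl ; (choice _) → refl ; (cycle _) → refl })
        (finite-⊎ finite-Palette (finite-⊎ (finite-Fin (suc n)) (finite-Fin (suc n))))

    oddSite : Class → Class → Bool
    oddSite ρ κ = odd ρ xor odd κ

    -- All sites carry palette vertices so that they look alike to the printing machine. Only the
    -- palette at the origin has edges; the other copies remain isolated.
    Origin : Class → Class → Set
    Origin ρ κ = first ρ ≡ true × first κ ≡ true

    origin? : ∀ ρ κ → Dec (Origin ρ κ)
    origin? ρ κ = (_ Bool.≟ _) ×-dec (_ Bool.≟ _)

    -- Petal 0 keeps its neighbours from being chosen. Petal 1 or petal 2 takes one colour away from
    -- all choice vertices of a site; parity decides which, so that neighbouring sites can leave
    -- different colours to the unchosen.
    Restrains : Palette → Class → Class → Fin (suc n) → Set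
    Restrains (petal zero)             ρ κ a = ¬ Ok ρ κ a
    Restrains (petal (suc zero))       ρ κ a = oddSite ρ κ ≡ false
    Restrains (petal (suc (suc zero))) ρ κ a = oddSite ρ κ ≡ true
    Restrains _                        ρ κ a = ⊥

    restrains? : ∀ p ρ κ a → Dec (Restrains p ρ κ a)
    restrains? (petal zero)                   ρ κ a = ¬? (ok? ρ κ a)
    restrains? (petal (suc zero))             ρ κ a = _ Bool.≟ _
    restrains? (petal (suc (suc zero)))       ρ κ a = _ Bool.≟ _
    restrains? hub                            ρ κ a = no λ ()
    restrains? (petal (suc (suc (suc _))))    ρ κ a = no λ ()
    restrains? (rim _)                        ρ κ a = no λ ()

    Edge : Class → Class → Class → Class → Rel → Rel → Local → Local → Set
    Edge ρ κ ρ′ κ′ r r′ (palette p) (palette q) = Origin ρ κ × Origin ρ′ κ′ × PaletteEdge p q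
    Edge ρ κ ρ′ κ′ r r′ (palette p) (choice a)  = Origin ρ κ × Restrains p ρ′ κ′ a
    -- Inadmissible tiles get no such edges: petal 0 is joined to all of them, so an edge between
    -- two of them would close a triangle.
    Edge ρ κ ρ′ κ′ r r′ (choice a)  (choice b)  = Ok ρ κ a × Ok ρ′ κ′ b ×
      ((r ≡ same × r′ ≡ next × ¬ Hor a b) ⊎ (r ≡ next × r′ ≡ same × ¬ Ver a b))
    Edge ρ κ ρ′ κ′ r r′ (choice a)  (cycle b)   = r ≡ same × r′ ≡ same × a ≡ b
    Edge ρ κ ρ′ κ′ r r′ (cycle a)   (cycle b)   = r ≡ same × r′ ≡ same × Follows a b
    Edge ρ κ ρ′ κ′ r r′ _           _           = ⊥

    edge? : ∀ ρ κ ρ′ κ′ r r′ ℓ ℓ′ → Dec (Edge ρ κ ρ′ κ′ r r′ ℓ ℓ′)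
    edge? ρ κ ρ′ κ′ r r′ (palette p) (palette q) = origin? ρ κ ×-dec origin? ρ′ κ′ ×-dec paletteEdge? p q
    edge? ρ κ ρ′ κ′ r r′ (palette p) (choice a)  = origin? ρ κ ×-dec restrains? p ρ′ κ′ a
    edge? ρ κ ρ′ κ′ r r′ (palette p) (cycle _)   = no λ ()
    edge? ρ κ ρ′ κ′ r r′ (choice a)  (palette _) = no λ ()
    edge? ρ κ ρ′ κ′ r r′ (choice a)  (choice b)  = ok? ρ κ a ×-dec ok? ρ′ κ′ b ×-dec
      (((r ≟ᴿ same) ×-dec (r′ ≟ᴿ next) ×-dec ¬? (hor? a b)) ⊎-dec ((r ≟ᴿ next) ×-dec (r′ ≟ᴿ same) ×-dec ¬? (ver? a b)))
    edge? ρ κ ρ′ κ′ r r′ (choice a)  (cycle b)   = (r ≟ᴿ same) ×-dec (r′ ≟ᴿ same) ×-dec (a Fin.≟ b)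
    edge? ρ κ ρ′ κ′ r r′ (cycle _)   (palette _) = no λ ()
    edge? ρ κ ρ′ κ′ r r′ (cycle _)   (choice _)  = no λ ()
    edge? ρ κ ρ′ κ′ r r′ (cycle a)   (cycle b)   = (r ≟ᴿ same) ×-dec (r′ ≟ᴿ same) ×-dec follows? a b

    -- The entry of the adjacency matrix, as a function of what a machine can see locally.
    entry : Class → Class → Class → Class → Rel → Rel → Local → Local → Bool
    entry ρ κ ρ′ κ′ r r′ ℓ ℓ′ =
      does (edge? ρ κ ρ′ κ′ r r′ ℓ ℓ′ ⊎-dec edge? ρ′ κ′ ρ κ (flip r) (flip r′) ℓ′ ℓ)

    module _ (3≤n : 3 ≤ n) (x : Word) (P w : ℕ) where

      κ : ℕ → Class
      κ = classOf x P (suc w)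

      Vertex : Set
      Vertex = Fin (suc w) × Fin (suc w) × Local

      finite-Vertex : Finite Vertex
      finite-Vertex = finite-× (finite-Fin (suc w)) (finite-× (finite-Fin (suc w)) finite-Local)

      E : Vertex → Vertex → Set
      E (t , s , ℓ) (t′ , s′ , ℓ′) =
        Edge (κ (toℕ t)) (κ (toℕ s)) (κ (toℕ t′)) (κ (toℕ s′)) (rel (toℕ t) (toℕ t′)) (rel (toℕ s) (toℕ s′)) ℓ ℓ′

      data Adj (u v : Vertex) : Set where
        fwd : E u v → Adj u v
        bwd : E v u → Adj u v

      adjacent : Vertex → Vertex → Bool
      adjacent (t , s , ℓ) (t′ , s′ , ℓ′) =
        entry (κ (toℕ t)) (κ (toℕ s)) (κ (toℕ t′)) (κ (toℕ s′)) (rel (toℕ t) (toℕ t′)) (rel (toℕ s) (toℕ s′)) ℓ ℓ′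

      adj? : ∀ u v → Dec (Adj u v)
      adj? (t , s , ℓ) (t′ , s′ , ℓ′) = map′ [ fwd , bwd ]′ (λ { (fwd e) → inj₁ e ; (bwd e) → inj₂ e })
        (edge? _ _ _ _ _ _ ℓ ℓ′ ⊎-dec edge? _ _ _ _ _ _ ℓ′ ℓ)

      adjacent≡ : ∀ u v → adjacent u v ≡ does (adj? u v)
      adjacent≡ (t , s , ℓ) (t′ , s′ , ℓ′)
        rewrite rel-flip (toℕ t) (toℕ t′) | rel-flip (toℕ s) (toℕ s′) = refl

      adjacent⇒ : ∀ {u v} → adjacent u v ≡ true → Adj u v
      adjacent⇒ {u} {v} eq = does⇒ (adj? u v) (trans (sym (adjacent≡ u v)) eq)

      adjacent⇐ : ∀ {u v} → Adj u v → adjacent u v ≡ true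
      adjacent⇐ {u} {v} p = trans (adjacent≡ u v) (dec-true (adj? u v) p)

      site : Vertex → Bool
      site (t , s , _) = oddSite (κ (toℕ t)) (κ (toℕ s))

      odd-next : ∀ {i j} → rel i j ≡ next → isOdd j ≡ not (isOdd i)
      odd-next {i} {j} eq = cong isOdd (rel-next i j eq)

      odd-same : ∀ {i j} → rel i j ≡ same → isOdd j ≡ isOdd i
      odd-same {i} {j} eq = cong isOdd (rel-same i j eq)

      -- Such an edge goes one step in one direction of the grid, and this changes the sum of the
      -- coordinates by one. So the choice vertices span a bipartite graph, and petals 1 and 2 never
      -- see both ends of an edge of it.
      E-choice-parity : ∀ t s a t′ s′ b → E (t , s , choice a) (t′ , s′ , choice b) →
        site (t′ , s′ , choice b) ≡ not (site (t , s , choice a))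
      E-choice-parity t s a t′ s′ b (_ , _ , inj₁ (r , r′ , _)) =
        trans (cong₂ _xor_ (odd-same {toℕ t} r) (odd-next {toℕ s} r′)) (flip-right (isOdd (toℕ t)) _)
        where
        flip-right : ∀ p q → p xor not q ≡ not (p xor q)
        flip-right true  q = refl
        flip-right false q = refl
      E-choice-parity t s a t′ s′ b (_ , _ , inj₂ (r , r′ , _)) =
        trans (cong₂ _xor_ (odd-next {toℕ t} r) (odd-same {toℕ s} r′)) (flip-left (isOdd (toℕ t)) _)
        where
        flip-left : ∀ p q → not p xor q ≡ not (p xor q)
        flip-left true  q = sym (Bool.not-involutive q)
        flip-left false q = refl

      choice-parity : ∀ t s a t′ s′ b → Adj (t , s , choice a) (t′ , s′ , choice b) →
        site (t′ , s′ , choice b) ≡ not (site (t , s , choice a))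
      choice-parity t s a t′ s′ b (fwd e) = E-choice-parity t s a t′ s′ b e
      choice-parity t s a t′ s′ b (bwd e) =
        trans (sym (Bool.not-involutive _)) (cong not (sym (E-choice-parity t′ s′ b t s a e)))

      choice-ok : ∀ t s a t′ s′ b → Adj (t , s , choice a) (t′ , s′ , choice b) → Ok (κ (toℕ t)) (κ (toℕ s)) a
      choice-ok t s a t′ s′ b (fwd (ok , _ , _)) = ok
      choice-ok t s a t′ s′ b (bwd (_ , ok , _)) = ok

      palettes : ∀ {t s p t′ s′ q} → Adj (t , s , palette p) (t′ , s′ , palette q) → PaletteAdjacent p q
      palettes (fwd (_ , _ , e)) = inj₁ e
      palettes (bwd (_ , _ , e)) = inj₂ e

      restrains : ∀ {t s p t′ s′ a} → Adj (t , s , palette p) (t′ , s′ , choice a) →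
        Restrains p (κ (toℕ t′)) (κ (toℕ s′)) a
      restrains (fwd (_ , e)) = e

      same-site : ∀ {t s t′ s′ : Fin (suc w)} → rel (toℕ t) (toℕ t′) ≡ same × rel (toℕ s) (toℕ s′) ≡ same → t ≡ t′ × s ≡ s′
      same-site {t} {s} {t′} {s′} (r , r′) =
        Fin.toℕ-injective (sym (rel-same _ _ r)) , Fin.toℕ-injective (sym (rel-same _ _ r′))

      matching : ∀ {t s a t′ s′ b} → Adj (t , s , choice a) (t′ , s′ , cycle b) → (t ≡ t′ × s ≡ s′) × a ≡ b
      matching (fwd (r , r′ , eq)) = same-site (r , r′) , eq

      cycles : ∀ {t s a t′ s′ b} → Adj (t , s , cycle a) (t′ , s′ , cycle b) → Adjacent a b
      cycles (fwd (_ , _ , f)) = inj₁ f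
      cycles (bwd (_ , _ , f)) = inj₂ f

      adj-sym : ∀ {u v} → Adj u v → Adj v u
      adj-sym (fwd e) = bwd e
      adj-sym (bwd e) = fwd e

      restrains-petal : ∀ p q {ρ κ a ρ′ κ′ b} → Restrains p ρ κ a → Restrains q ρ′ κ′ b → ¬ PaletteAdjacent p q
      restrains-petal (petal _) (petal _) _ _ (inj₁ ())
      restrains-petal (petal _) (petal _) _ _ (inj₂ ())

      adjacent-unrestrained : ∀ p t s a t′ s′ b → Adj (t , s , choice a) (t′ , s′ , choice b) →
        Restrains p (κ (toℕ t)) (κ (toℕ s)) a → ¬ Restrains p (κ (toℕ t′)) (κ (toℕ s′)) b
      adjacent-unrestrained (petal zero) t s a t′ s′ b e notOk _ = notOk (choice-ok t s a t′ s′ b e)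
      adjacent-unrestrained (petal (suc zero)) t s a t′ s′ b e even even′
        with () ← trans (sym even′) (trans (choice-parity t s a t′ s′ b e) (cong not even))
      adjacent-unrestrained (petal (suc (suc zero))) t s a t′ s′ b e odd odd′
        with () ← trans (sym odd′) (trans (choice-parity t s a t′ s′ b e) (cong not odd))

      -- The triples in the order palette, choice, cycle come first; the other orders are permuted
      -- into these, and palette and cycle vertices are never adjacent. The vertices are not assumed
      -- distinct, so loops are excluded as well, which gives the irreflexivity of `graph`.
      no-triangle : ∀ u v z → Adj u v → Adj v z → Adj u z → ⊥
      no-triangle (t , s , palette p) (t′ , s′ , palette q) (t″ , s″ , palette r) uv vz uz =
        palette-no-triangle p q r (palettes uv) (palettes vz) (palettes uz)
      no-triangle (t , s , palette p) (t′ , s′ , palette q) (t″ , s″ , choice a) uv vz uz =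
        restrains-petal p q (restrains uz) (restrains vz) (palettes uv)
      no-triangle (t , s , palette p) (t′ , s′ , choice a) (t″ , s″ , choice b) uv vz uz =
        adjacent-unrestrained p t′ s′ a t″ s″ b vz (restrains uv) (restrains uz)
      no-triangle (t , s , choice a) (t′ , s′ , choice b) (t″ , s″ , choice c) uv vz uz =
        not-fixed _ (trans (sym (choice-parity t s a t″ s″ c uz)) (trans (choice-parity t′ s′ b t″ s″ c vz)
          (trans (cong not (choice-parity t s a t′ s′ b uv)) (Bool.not-involutive _))))
        where
        not-fixed : ∀ b → not b ≢ b
        not-fixed true  ()
        not-fixed false ()
      no-triangle (t , s , choice a) (t′ , s′ , choice b) (t″ , s″ , cycle c) uv vz uz
        with (refl , refl) , _ ← matching vz | (refl , refl) , _ ← matching uz =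
        not-fixed _ (choice-parity t s a t s b uv)
        where
        not-fixed : ∀ b → b ≢ not b
        not-fixed true  ()
        not-fixed false ()
      no-triangle (t , s , choice a) (t′ , s′ , cycle b) (t″ , s″ , cycle c) uv vz uz
        with _ , refl ← matching uv | _ , refl ← matching uz =
        -- The matching has identified b and c, so `vz` is a loop on the cycle, that is, a
        -- degenerate triangle.
        cycle-no-triangle 3≤n (cycles vz) (cycles vz) (cycles vz)
      no-triangle (t , s , cycle a) (t′ , s′ , cycle b) (t″ , s″ , cycle c) uv vz uz =
        cycle-no-triangle 3≤n (cycles uv) (cycles vz) (cycles uz)
      no-triangle u@(_ , _ , palette _) v@(_ , _ , choice _) z@(_ , _ , palette _) uv vz uz =
        no-triangle u z v uz (adj-sym vz) uv
      no-triangle u@(_ , _ , choice _) v@(_ , _ , palette _) z@(_ , _ , palette _) uv vz uz =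
        no-triangle v z u vz (adj-sym uz) (adj-sym uv)
      no-triangle u@(_ , _ , choice _) v@(_ , _ , palette _) z@(_ , _ , choice _) uv vz uz =
        no-triangle v u z (adj-sym uv) uz vz
      no-triangle u@(_ , _ , choice _) v@(_ , _ , choice _) z@(_ , _ , palette _) uv vz uz =
        no-triangle z u v (adj-sym uz) uv (adj-sym vz)
      no-triangle u@(_ , _ , choice _) v@(_ , _ , cycle _) z@(_ , _ , choice _) uv vz uz =
        no-triangle u z v uz (adj-sym vz) uv
      no-triangle u@(_ , _ , cycle _) v@(_ , _ , choice _) z@(_ , _ , choice _) uv vz uz =
        no-triangle v z u vz (adj-sym uz) (adj-sym uv)
      no-triangle u@(_ , _ , cycle _) v@(_ , _ , choice _) z@(_ , _ , cycle _) uv vz uz =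
        no-triangle v u z (adj-sym uv) uz vz
      no-triangle u@(_ , _ , cycle _) v@(_ , _ , cycle _) z@(_ , _ , choice _) uv vz uz =
        no-triangle z u v (adj-sym uz) uv (adj-sym vz)
      no-triangle (_ , _ , palette _) (_ , _ , cycle _) _ (fwd ())
      no-triangle (_ , _ , palette _) (_ , _ , cycle _) _ (bwd ())
      no-triangle (_ , _ , cycle _) (_ , _ , palette _) _ (fwd ())
      no-triangle (_ , _ , cycle _) (_ , _ , palette _) _ (bwd ())
      no-triangle (_ , _ , palette _) _ (_ , _ , cycle _) _ _ (fwd ())
      no-triangle (_ , _ , palette _) _ (_ , _ , cycle _) _ _ (bwd ())
      no-triangle (_ , _ , cycle _) _ (_ , _ , palette _) _ _ (fwd ())
      no-triangle (_ , _ , cycle _) _ (_ , _ , palette _) _ _ (bwd ())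
      no-triangle (_ , _ , choice _) (_ , _ , palette _) (_ , _ , cycle _) _ (fwd ())
      no-triangle (_ , _ , choice _) (_ , _ , palette _) (_ , _ , cycle _) _ (bwd ())
      no-triangle (_ , _ , choice _) (_ , _ , cycle _) (_ , _ , palette _) _ (fwd ())
      no-triangle (_ , _ , choice _) (_ , _ , cycle _) (_ , _ , palette _) _ (bwd ())

      graph : Graph
      graph = record
        { order  = size finite-Vertex
        ; adj    = λ i j → adjacent (from finite-Vertex i) (from finite-Vertex j)
        ; sym    = λ i j → Bool.⇔→≡ {z = true} (mk⇔ (adjacent-sym {from finite-Vertex i} {from finite-Vertex j})
            (adjacent-sym {from finite-Vertex j} {from finite-Vertex i}))
        ; irrefl = λ i → Bool.¬-not λ e → let ii = adjacent⇒ {from finite-Vertex i} e in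
            no-triangle _ _ _ ii ii ii }
        where
        adjacent-sym : ∀ {u v} → adjacent u v ≡ true → adjacent v u ≡ true
        adjacent-sym {u} {v} e = adjacent⇐ (adj-sym (adjacent⇒ {u} {v} e))

      graph-triangle-free : TriangleFree graph
      graph-triangle-free = no-triangle⇒triangle-free graph λ {a} {b} {c} ab bc ac →
        no-triangle (from finite-Vertex a) (from finite-Vertex b) (from finite-Vertex c)
          (adjacent⇒ ab) (adjacent⇒ bc) (adjacent⇒ ac)

      record Selection (σ : ℕ → ℕ → Fin (suc n)) : Set where
        field
          ok         : ∀ {t s} → t ≤ w → s ≤ w → Ok (κ t) (κ s) (σ t s)
          horizontal : ∀ {t s} → t ≤ w → suc s ≤ w → Hor (σ t s) (σ t (suc s))
          vertical   : ∀ {t s} → suc t ≤ w → s ≤ w → Ver (σ t s) (σ (suc t) s)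

      module FromColouring (colouring : Colourable graph 3) where

        colour : Vertex → Fin 3
        colour v = proj₁ colouring (to finite-Vertex v)

        proper : ∀ {u v} → Adj u v → colour u ≢ colour v
        proper {u} {v} uv = proj₂ colouring _ _
          (subst (_≡ true) (sym (cong₂ adjacent (from∘to finite-Vertex u) (from∘to finite-Vertex v)))
                 (adjacent⇐ uv))

        paletteVertex : Palette → Vertex
        paletteVertex p = zero , zero , palette p

        C : Palette → Fin 3
        C = colour ∘ paletteVertex

        C-hub : C (petal zero) ≡ C hub
        C-hub = petal≡hub C λ {p} {q} e → proper {paletteVertex p} {paletteVertex q} (fwd ((refl , refl) , (refl , refl) , e))

        C-petal : ∀ i → C (petal (suc i)) ≢ C (petal zero)
        C-petal i eq = proper {paletteVertex hub} {paletteVertex (petal (suc i))}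
          (fwd ((refl , refl) , (refl , refl) , λ ())) (sym (trans eq C-hub))

        restrained : ∀ p t s a → Restrains p (κ (toℕ t)) (κ (toℕ s)) a → colour (t , s , choice a) ≢ C p
        restrained p t s a r = ≢-sym (proper {paletteVertex p} {t , s , choice a} (fwd ((refl , refl) , r)))

        -- Whether petals 1 and 2 agree in the given colouring is left open. It suffices that each
        -- differs from petal 0, which has the colour of their common neighbour, the hub.
        excluded : ∀ t s → ∃[ q ] q ≢ C (petal zero) × (∀ a → colour (t , s , choice a) ≢ q)
        excluded t s with oddSite (κ (toℕ t)) (κ (toℕ s)) in eq
        ... | false = C (petal (suc zero)) , C-petal zero , λ a → restrained (petal (suc zero)) t s a eq
        ... | true  = C (petal (suc (suc zero))) , C-petal (suc zero) , λ a → restrained (petal (suc (suc zero))) t s a eq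

        -- If no vertex had the colour of petal 0, two colours would be excluded at this site and
        -- all its choice vertices would share the third. The matching would then ban that colour
        -- from the entire odd cycle.
        chosen : ∀ t s → ∃[ a ] colour (t , s , choice a) ≡ C (petal zero)
        chosen t s with Fin.any? (λ a → colour (t , s , choice a) Fin.≟ C (petal zero))
        ... | yes found = found
        ... | no none = ⊥-elim (odd-cycle m (λ a → colour (t , s , cycle a)) (colour (t , s , choice zero))
            (λ a eq → proper {t , s , choice a} {t , s , cycle a} (fwd (rel-refl (toℕ t) , rel-refl (toℕ s) , refl))
              (trans (uniform a) (sym eq)))
            (λ {a} {b} f → proper {t , s , cycle a} {t , s , cycle b} (fwd (rel-refl (toℕ t) , rel-refl (toℕ s) , f))))
          where
          uniform : ∀ a → colour (t , s , choice a) ≡ colour (t , s , choice zero)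
          uniform a with q , q≢ , avoids ← excluded t s =
            third-colour q (C (petal zero)) _ _ q≢ (avoids a) (λ e → none (a , e)) (avoids zero) (λ e → none (zero , e))

        σ : ℕ → ℕ → Fin (suc n)
        σ t s = proj₁ (chosen (clamp t) (clamp s))

        chosen-ok : ∀ t s → Ok (κ (toℕ t)) (κ (toℕ s)) (proj₁ (chosen t s))
        chosen-ok t s = decidable-stable (ok? _ _ _) λ bad → restrained (petal zero) t s _ bad (proj₂ (chosen t s))

        compatible : ∀ t s t′ s′ → ¬ E (t , s , choice (proj₁ (chosen t s))) (t′ , s′ , choice (proj₁ (chosen t′ s′)))
        compatible t s t′ s′ e = proper {t , s , choice _} {t′ , s′ , choice _} (fwd e)
          (trans (proj₂ (chosen t s)) (sym (proj₂ (chosen t′ s′))))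

        rel-clamp : ∀ {i} → suc i ≤ w → rel (toℕ (clamp {w} i)) (toℕ (clamp {w} (suc i))) ≡ next
        rel-clamp {i} le rewrite toℕ-clamp (ℕ.<⇒≤ le) | toℕ-clamp le = rel-suc i

        selection : Selection σ
        selection = record
          { ok         = λ {t} {s} t≤w s≤w → subst₂ (λ i j → Ok (κ i) (κ j) (σ t s)) (toℕ-clamp t≤w) (toℕ-clamp s≤w)
                           (chosen-ok (clamp t) (clamp s))
          ; horizontal = λ {t} {s} t≤w s<w → decidable-stable (hor? _ _) λ bad →
                           compatible (clamp t) (clamp s) (clamp t) (clamp (suc s))
                             (chosen-ok _ _ , chosen-ok _ _ , inj₁ (rel-refl (toℕ (clamp {w} t)) , rel-clamp s<w , bad))
          ; vertical   = λ {t} {s} t<w s≤w → decidable-stable (ver? _ _) λ bad →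
                           compatible (clamp t) (clamp s) (clamp (suc t)) (clamp s)
                             (chosen-ok _ _ , chosen-ok _ _ , inj₂ (rel-clamp t<w , rel-refl (toℕ (clamp {w} s)) , bad)) }

      module FromSelection {σ : ℕ → ℕ → Fin (suc n)} (selection : Selection σ) where

        open Selection selection

        one two : Fin 3
        one = suc zero
        two = suc (suc zero)

        -- Even sites are restrained by petal 1 and odd ones by petal 2, whose colours are 1 and 2.
        -- That colour is `avoided`, and `unchosen` is the one left beside 0.
        unchosen avoided : Bool → Fin 3
        unchosen odd = if odd then one else two
        avoided  odd = if odd then two else one

        zero≢unchosen : ∀ o → zero ≢ unchosen o
        zero≢unchosen true  ()
        zero≢unchosen false ()

        alternate : Bool → ℕ → Fin 3
        alternate o i = if isOdd i then avoided o else zero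

        unchosen≢alternate : ∀ o i → unchosen o ≢ alternate o i
        unchosen≢alternate o i with isOdd i
        unchosen≢alternate true  i | true  = λ ()
        unchosen≢alternate true  i | false = λ ()
        unchosen≢alternate false i | true  = λ ()
        unchosen≢alternate false i | false = λ ()

        alternate-suc : ∀ o i → alternate o i ≢ alternate o (suc i)
        alternate-suc o i with isOdd i
        alternate-suc true  i | true  = λ ()
        alternate-suc true  i | false = λ ()
        alternate-suc false i | true  = λ ()
        alternate-suc false i | false = λ ()

        choiceColour : Bool → (a chosen : Fin (suc n)) → Fin 3
        choiceColour o a chosen = if does (a Fin.≟ chosen) then zero else unchosen o

        -- The cycle is coloured alternately once the chosen vertex, coloured as unchosen, is cut out.
        cycleColour : Bool → (a chosen : ℕ) → Fin 3
        cycleColour o a chosen with ℕ.<-cmp a chosen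
        ... | tri< _ _ _ = alternate o a
        ... | tri≈ _ _ _ = unchosen o
        ... | tri> _ _ _ = alternate o (suc a)

        siteColour : Bool → Fin (suc n) → Local → Fin 3
        siteColour o chosen (palette p) = paletteColour p
        siteColour o chosen (choice a)  = choiceColour o a chosen
        siteColour o chosen (cycle a)   = cycleColour o (toℕ a) (toℕ chosen)

        cycle-suc : ∀ o a b → cycleColour o a b ≢ cycleColour o (suc a) b
        cycle-suc o a b with ℕ.<-cmp a b | ℕ.<-cmp (suc a) b
        ... | tri< _ _ _     | tri< _ _ _    = alternate-suc o a
        ... | tri< _ _ _     | tri≈ _ _ _    = ≢-sym (unchosen≢alternate o a)
        ... | tri< a<b _ _   | tri> _ _ b<a′ = ⊥-elim (ℕ.<⇒≱ b<a′ a<b)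
        ... | tri≈ _ refl _  | tri< a′<a _ _ = ⊥-elim (ℕ.<-asym a′<a ℕ.≤-refl)
        ... | tri≈ _ refl _  | tri≈ _ eq _   = ⊥-elim (ℕ.1+n≢n eq)
        ... | tri≈ _ _ _     | tri> _ _ _    = unchosen≢alternate o (suc (suc a))
        ... | tri> _ _ b<a   | tri< a′<b _ _ = ⊥-elim (ℕ.<-asym a′<b (ℕ.m≤n⇒m≤1+n b<a))
        ... | tri> _ _ b<a   | tri≈ _ refl _ = ⊥-elim (ℕ.<-asym b<a ℕ.≤-refl)
        ... | tri> _ _ _     | tri> _ _ _    = alternate-suc o (suc a)

        isOdd-double : ∀ i → isOdd (i + i) ≡ false
        isOdd-double zero    = refl
        isOdd-double (suc i) rewrite ℕ.+-suc i i = trans (Bool.not-involutive _) (isOdd-double i)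

        -- Behind the cut the positions are counted one higher. As n = 2m is even, vertex n is
        -- coloured like an odd position and therefore differs from vertex 0.
        cycle-wrap : ∀ o b → b ≤ n → cycleColour o n b ≢ cycleColour o 0 b
        cycle-wrap o b b≤n with ℕ.<-cmp n b | ℕ.<-cmp 0 b
        ... | tri< n<b _ _ | _            = ⊥-elim (ℕ.<⇒≱ n<b b≤n)
        ... | tri≈ _ eq _  | tri≈ _ 0≡b _ = ⊥-elim (ℕ.<⇒≢ (ℕ.≤-trans (s≤s z≤n) 3≤n) (trans 0≡b (sym eq)))
        ... | tri≈ _ _ _   | tri< _ _ _   = unchosen≢alternate o 0
        ... | tri> _ _ _   | tri≈ _ _ _   = ≢-sym (unchosen≢alternate o (suc n))
        ... | tri> _ _ _   | tri< _ _ _   = subst (λ b → (if not b then avoided o else zero) ≢ zero)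
                (sym (isOdd-double m)) (avoided≢zero o)
          where
          avoided≢zero : ∀ o → avoided o ≢ zero
          avoided≢zero true  ()
          avoided≢zero false ()

        cycle-proper : ∀ o (c : Fin (suc n)) {a b : Fin (suc n)} → Follows a b →
          cycleColour o (toℕ a) (toℕ c) ≢ cycleColour o (toℕ b) (toℕ c)
        cycle-proper o c {a} {b} (inj₁ eq) rewrite eq = cycle-suc o (toℕ a) (toℕ c)
        cycle-proper o c {a} {b} (inj₂ (eq , eq′)) rewrite eq | eq′ = cycle-wrap o (toℕ c) (ℕ.≤-pred (Fin.toℕ<n c))

        spoke : ∀ o (c a : Fin (suc n)) → choiceColour o a c ≢ cycleColour o (toℕ a) (toℕ c)
        spoke o c a with a Fin.≟ c | ℕ.<-cmp (toℕ a) (toℕ c)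
        ... | yes refl | tri< a<a _ _ = ⊥-elim (ℕ.<-irrefl refl a<a)
        ... | yes refl | tri≈ _ _ _   = zero≢unchosen o
        ... | yes refl | tri> _ _ a<a = ⊥-elim (ℕ.<-irrefl refl a<a)
        ... | no _     | tri< _ _ _   = unchosen≢alternate o (toℕ a)
        ... | no a≢c   | tri≈ _ eq _  = ⊥-elim (a≢c (Fin.toℕ-injective eq))
        ... | no _     | tri> _ _ _   = unchosen≢alternate o (suc (toℕ a))

        colour : Vertex → Fin 3
        colour (t , s , ℓ) = siteColour (oddSite (κ (toℕ t)) (κ (toℕ s))) (σ (toℕ t) (toℕ s)) ℓ

        one≢choice : ∀ {o} a c → o ≡ false → one ≢ choiceColour o a c
        one≢choice a c refl with does (a Fin.≟ c)
        ... | true  = λ ()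
        ... | false = λ ()

        two≢choice : ∀ {o} a c → o ≡ true → two ≢ choiceColour o a c
        two≢choice a c refl with does (a Fin.≟ c)
        ... | true  = λ ()
        ... | false = λ ()

        palette-proper : ∀ p {t s} a → t ≤ w → s ≤ w → Restrains p (κ t) (κ s) a →
          paletteColour p ≢ choiceColour (oddSite (κ t) (κ s)) a (σ t s)
        palette-proper (petal zero) {t} {s} a t≤w s≤w bad with a Fin.≟ σ t s
        ... | yes refl = ⊥-elim (bad (ok t≤w s≤w))
        ... | no _     = zero≢unchosen (oddSite (κ t) (κ s))
        palette-proper (petal (suc zero)) {t} {s} a _ _ even = one≢choice a (σ t s) even
        palette-proper (petal (suc (suc zero))) {t} {s} a _ _ odd = two≢choice a (σ t s) odd

        -- At sites of opposite parity the unchosen colours are different and nonzero, so two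
        -- vertices can clash only by both being chosen.
        choice-proper : ∀ {o o′} a c a′ c′ → o′ ≡ not o → ¬ (a ≡ c × a′ ≡ c′) →
          choiceColour o a c ≢ choiceColour o′ a′ c′
        choice-proper {o} a c a′ c′ refl notBoth with a Fin.≟ c | a′ Fin.≟ c′
        ... | yes p | yes q = λ _ → notBoth (p , q)
        ... | yes _ | no _  = zero≢unchosen (not o)
        ... | no _  | yes _ = ≢-sym (zero≢unchosen o)
        choice-proper {true}  a c a′ c′ refl notBoth | no _ | no _ = λ ()
        choice-proper {false} a c a′ c′ refl notBoth | no _ | no _ = λ ()

        bound : (i : Fin (suc w)) → toℕ i ≤ w
        bound i = ℕ.≤-pred (Fin.toℕ<n i)

        E-proper : ∀ u v → E u v → colour u ≢ colour v
        E-proper (_ , _ , palette p) (_ , _ , palette q) (_ , _ , e) = paletteColour-proper e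
        E-proper (_ , _ , palette p) (t , s , choice a) (_ , r) = palette-proper p a (bound t) (bound s) r
        E-proper (t , s , choice a) (t′ , s′ , choice b) e@(_ , _ , way) =
          choice-proper a _ b _ (E-choice-parity t s a t′ s′ b e) (both way)
          where
          both : (rel (toℕ t) (toℕ t′) ≡ same × rel (toℕ s) (toℕ s′) ≡ next × ¬ Hor a b) ⊎
                 (rel (toℕ t) (toℕ t′) ≡ next × rel (toℕ s) (toℕ s′) ≡ same × ¬ Ver a b) →
                 ¬ (a ≡ σ (toℕ t) (toℕ s) × b ≡ σ (toℕ t′) (toℕ s′))
          both (inj₁ (r , r′ , bad)) (refl , refl) = bad (subst₂ (λ i j → Hor (σ (toℕ t) (toℕ s)) (σ i j))
            (sym (rel-same _ _ r)) (sym (rel-next (toℕ s) _ r′))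
            (horizontal (bound t) (subst (_≤ w) (rel-next (toℕ s) _ r′) (bound s′))))
          both (inj₂ (r , r′ , bad)) (refl , refl) = bad (subst₂ (λ i j → Ver (σ (toℕ t) (toℕ s)) (σ i j))
            (sym (rel-next (toℕ t) _ r)) (sym (rel-same _ _ r′))
            (vertical (subst (_≤ w) (rel-next (toℕ t) _ r) (bound t′)) (bound s)))
        E-proper (t , s , choice a) (t′ , s′ , cycle b) (r , r′ , refl)
          with refl , refl ← same-site {t} {s} {t′} {s′} (r , r′) = spoke (oddSite (κ (toℕ t)) (κ (toℕ s))) (σ (toℕ t) (toℕ s)) a
        E-proper (t , s , cycle a) (t′ , s′ , cycle b) (r , r′ , f)
          with refl , refl ← same-site {t} {s} {t′} {s′} (r , r′) = cycle-proper (oddSite (κ (toℕ t)) (κ (toℕ s))) (σ (toℕ t) (toℕ s)) f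

        colouring : Colourable graph 3
        colouring = colour ∘ from finite-Vertex , λ i j ij → Adj-proper (adjacent⇒ {from finite-Vertex i} {from finite-Vertex j} ij)
          where
          Adj-proper : ∀ {u v} → Adj u v → colour u ≢ colour v
          Adj-proper {u} {v} (fwd e) = E-proper u v e
          Adj-proper {u} {v} (bwd e) = ≢-sym (E-proper v u e)

-- Proof rules for counters, rewinding and written words

module ProgramRules where

  open import Data.Integer using (ℤ; +_; -[1+_])
  open Programs

  inc-dec : ∀ i → inc (dec i) ≡ i
  inc-dec (+ zero)     = refl
  inc-dec (+ suc n)    = refl
  inc-dec -[1+ n ]     = refl

  dec-inc : ∀ i → dec (inc i) ≡ i
  dec-inc (+ n)        = refl
  dec-inc -[1+ zero ]  = refl
  dec-inc -[1+ suc n ] = refl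

  isNonblank : ∀ {a} → Symbol a → Bool
  isNonblank blank = false
  isNonblank _     = true

  module _ {a : ℕ} where

    -- c seen from s cells further to the right, respectively left.
    sh hs : ℕ → View a → View a
    sh zero    c = c
    sh (suc s) c = sh s c ∘ inc
    hs zero    c = c
    hs (suc s) c = hs s c ∘ dec

    blanks : View a
    blanks _ = blank

    sh-+ : ∀ s c n → sh s c (+ n) ≡ c (+ (s + n))
    sh-+ zero    c n = refl
    sh-+ (suc s) c n = trans (sh-+ s c (suc n)) (cong (c ∘ +_) (ℕ.+-suc s n))

    peek-sh : ∀ s c → peek (sh s c) ≡ c (+ s)
    peek-sh s c = trans (sh-+ s c 0) (cong (c ∘ +_) (ℕ.+-identityʳ s))

    sh-cancel : ∀ s (c : View a) → sh (suc s) (c ∘ dec) ≗ sh s c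
    sh-cancel zero    c i = cong c (dec-inc i)
    sh-cancel (suc s) c i = sh-cancel s c (inc i)

    sh-hs : ∀ s t (c : View a) → sh (suc s) (hs (suc t) c) ≗ sh s (hs t c)
    sh-hs s t c = sh-cancel s (hs t c)

    left-sh : ∀ s (c : View a) → sh (suc s) c ∘ dec ≗ sh s c
    left-sh s c i = cong (sh s c) (inc-dec i)

    -- A stack of e marks in unary, the head on the topmost.
    counter : ℕ → View a
    counter zero    _             = blank
    counter (suc e) (+ zero)      = bit true
    counter (suc e) (+ suc _)     = blank
    counter (suc e) -[1+ zero ]   = counter e (+ zero)
    counter (suc e) -[1+ suc j ]  = counter e -[1+ j ]

    counter-above : ∀ e n → counter e (+ suc n) ≡ blank
    counter-above zero    n = refl
    counter-above (suc e) n = refl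

    pop-counter : ∀ e → actV (counter (suc e)) (blank , left) ≗ counter e
    pop-counter e (+ zero)        = refl
    pop-counter e (+ suc zero)    = sym (counter-above e zero)
    pop-counter e (+ suc (suc n)) = sym (counter-above e (suc n))
    pop-counter e -[1+ n ]        = refl

    push-counter : ∀ e → writeV (counter e ∘ inc) (bit true) ≗ counter (suc e)
    push-counter e (+ zero)      = refl
    push-counter e (+ suc n)     = counter-above e (suc n)
    push-counter e -[1+ zero ]   = refl
    push-counter e -[1+ suc n ]  = refl

    module _ {k : ℕ} where

      nonblank : Fin k → Vec (Symbol a) k → Bool
      nonblank i ss = isNonblank (lookup ss i)

      moveAt : Fin k → Move → Program {a} {k}
      moveAt i m = at i (λ ss → lookup ss i , m)

      ⟶-move : ∀ {vs : Vec (View a) k} i m {v} → moveV m (lookup vs i) ≗ v → vs ⟶⟨ moveAt i m , 1 ⟩ vs [ i ]≔ v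
      ⟶-move {vs} i m {v} eq = ⟶-at λ j → trans
        (moveV-cong m {writeV (lookup vs i) _} (λ j′ → trans (cong (λ s → writeV (lookup vs i) s j′) (Vec.lookup-map i peek vs))
                                    (write-back (lookup vs i) j′)) j)
        (eq j)

      pop push : Fin k → Program {a} {k}
      pop i  = at i (λ _ → blank , left)
      push i = moveAt i right ⨟ at i (λ _ → bit true , stay)

      ⟶-pop : ∀ {vs : Vec (View a) k} i e → lookup vs i ≡ counter (suc e) → vs ⟶⟨ pop i , 1 ⟩ vs [ i ]≔ counter e
      ⟶-pop i e eq = ⟶-at λ j → trans (cong (λ v → actV v (blank , left) j) eq) (pop-counter e j)

      ⟶-push : ∀ {vs : Vec (View a) k} i e → lookup vs i ≡ counter e → vs ⟶⟨ push i , 2 ⟩ vs [ i ]≔ counter (suc e)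
      ⟶-push {vs} i e eq = subst (vs ⟶⟨ push i , 2 ⟩_) (Vec.[]≔-idempotent vs i) both
        where
        vs′ : Vec (View a) k
        vs′ = vs [ i ]≔ (counter e ∘ inc)
        step : vs ⟶⟨ moveAt i right , 1 ⟩ vs′
        step = ⟶-move i right λ j → cong (λ v → v (inc j)) eq
        mark : vs′ ⟶⟨ at i (λ _ → bit true , stay) , 1 ⟩ vs′ [ i ]≔ counter (suc e)
        mark = ⟶-at λ j → trans (cong (λ v → writeV v (bit true) j) (Vec.lookup∘updateAt i vs)) (push-counter e j)
        both : vs ⟶⟨ push i , 2 ⟩ vs′ [ i ]≔ counter (suc e)
        both = step ⟫ mark

      -- For loops that drain one counter into others: `I i j` is the situation with i rounds to go
      -- and j rounds done.
      while-count : ∀ {c P b} n (I : ℕ → ℕ → Vec (View a) k) →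
        (∀ j → c (peeks (I 0 j)) ≡ false) → (∀ i j → c (peeks (I (suc i) j)) ≡ true) →
        (∀ i j → suc i + j ≡ n → I (suc i) j ⟶⟨ P , b ⟩ I i (suc j)) →
        I n 0 ⟶⟨ while c P , loop-time {a} {k} n b ⟩ I 0 n
      while-count {c} {P} {b} n I stop more body = count n 0 (ℕ.+-identityʳ n)
        where
        count : ∀ i j → i + j ≡ n → I i j ⟶⟨ while c P , loop-time {a} {k} i b ⟩ I 0 n
        count zero    j refl = while-exit (stop j)
        count (suc i) j eq = ⟶-weaken (ℕ.≤-reflexive (sym (ℕ.+-assoc (suc b) (i * suc b) 1)))
          (while-enter (more i j) (body i j eq) (count i (suc j) (trans (ℕ.+-suc i j) eq)))

      -- The head starts one place past the nonblank cells, so the first move precedes the test of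
      -- the loop. The loop overshoots to the blank in front, and the last move corrects this. `Q`
      -- and `Q′` accompany the moves to the left and to the right.
      rewind : Fin k → Program {a} {k} → Program {a} {k} → Program {a} {k}
      rewind i Q Q′ = (moveAt i left ⨟ Q) ⨟ while (nonblank i) (moveAt i left ⨟ Q) ⨟ (moveAt i right ⨟ Q′)

      -- Q and Q′ carry a companion B of the rewound tape along.
      ⟶-rewind : ∀ {Q Q′} i n {c : View a} {b} (B : ℕ → View a) (B₋₁ : View a) (F : View a → View a → Vec (View a) k) →
        (∀ u v → lookup (F u v) i ≡ u) → (∀ u u′ v → F u v [ i ]≔ u′ ≡ F u′ v) →
        (∀ u s → F u (B (suc s)) ⟶⟨ Q , b ⟩ F u (B s)) → (∀ u → F u (B 0) ⟶⟨ Q , b ⟩ F u B₋₁) →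
        (∀ u → F u B₋₁ ⟶⟨ Q′ , b ⟩ F u (B 0)) →
        c -[1+ 0 ] ≡ blank → (∀ s → s < n → isNonblank (c (+ s)) ≡ true) →
        F (sh n c) (B n) ⟶⟨ rewind i Q Q′ , suc b + (loop-time {a} {k} n (suc b) + suc b) ⟩ F c (B 0)
      ⟶-rewind {Q} {Q′} i n {c} {b} B B₋₁ F look-F set-F back back₀ forth edge inner =
        backwards n ⟫ while-fuel n ℕ.≤-refl ⟫ (move-F right (λ j → cong c (dec-inc j)) ⟫ forth c)
        where
        move-F : ∀ {u v} m {w} → moveV m u ≗ w → F u v ⟶⟨ moveAt i m , 1 ⟩ F w v
        move-F {u} {v} m {w} eq = subst (F u v ⟶⟨ moveAt i m , 1 ⟩_) (set-F u w v)
          (⟶-move i m λ j → trans (cong (λ z → moveV m z j) (look-F u v)) (eq j))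
        companion : ℕ → View a
        companion zero    = B₋₁
        companion (suc s) = B s
        I : ℕ → Vec (View a) k
        I s = F (sh s c ∘ dec) (companion s)
        backwards : ∀ s → F (sh s c) (B s) ⟶⟨ moveAt i left ⨟ Q , suc b ⟩ I s
        backwards zero    = move-F left (λ _ → refl) ⟫ back₀ _
        backwards (suc s) = move-F left (λ _ → refl) ⟫ back _ s
        again : ∀ s → I (suc s) ⟶⟨ moveAt i left ⨟ Q , suc b ⟩ I s
        again zero    = move-F left (λ j → left-sh 0 c (dec j)) ⟫ back₀ _
        again (suc s) = move-F left (λ j → left-sh (suc s) c (dec j)) ⟫ back _ s
        peek-I : ∀ s → nonblank i (peeks (I s)) ≡ isNonblank (sh s c -[1+ 0 ])
        peek-I s = cong isNonblank (trans (Vec.lookup-map i peek (I s)) (cong peek (look-F _ _)))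
        while-fuel : ∀ s → s ≤ n → I s ⟶⟨ while (nonblank i) (moveAt i left ⨟ Q) , loop-time {a} {k} s (suc b) ⟩ I 0
        while-fuel zero    _   = while-exit (trans (peek-I 0) (cong isNonblank edge))
        while-fuel (suc s) s<n = ⟶-weaken (ℕ.≤-reflexive (sym (ℕ.+-assoc (suc (suc b)) (s * suc (suc b)) 1)))
          (while-enter (trans (peek-I (suc s)) (trans (cong isNonblank (peek-sh s c)) (inner s s<n)))
            (again s) (while-fuel s (ℕ.<⇒≤ s<n)))

      -- Situations are indexed by the output so far in reverse, as it lies on the tape behind the
      -- head. A further piece of output is therefore added by `ʳ++`.
      ⟶-each-word : ∀ {b} n (P : Fin n → Program {a} {k}) (St : Word → Vec (View a) k) (f : Fin n → Word) →
        (∀ i l → St l ⟶⟨ P i , b ⟩ St (f i ʳ++ l)) → ∀ l → St l ⟶⟨ each n P , n * b + 1 ⟩ St (concat (tabulate f) ʳ++ l)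
      ⟶-each-word zero    P St f step l = ⟶-skip
      ⟶-each-word {b} (suc n) P St f step l =
        ⟶-weaken (ℕ.≤-reflexive (sym (ℕ.+-assoc b (n * b) 1)))
          (subst (λ l′ → St l ⟶⟨ each (suc n) P , b + (n * b + 1) ⟩ St l′) (sym (List.++-ʳ++ (f zero)))
            (step zero l ⟫ ⟶-each-word n (P ∘ suc) St (f ∘ suc) (step ∘ suc) (f zero ʳ++ l)))

      while-word : ∀ {c P b} n (St : ℕ → Word → Vec (View a) k) (f : ℕ → Word) →
        (∀ l → c (peeks (St n l)) ≡ false) → (∀ s l → s < n → c (peeks (St s l)) ≡ true) →
        (∀ s l → s < n → St s l ⟶⟨ P , b ⟩ St (suc s) (f s ʳ++ l)) →
        ∀ l → St 0 l ⟶⟨ while c P , loop-time {a} {k} n b ⟩ St n (concat (tabulate {n = n} (f ∘ toℕ)) ʳ++ l)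
      while-word zero St f stop more body l = while-exit (stop l)
      while-word {c} {P} {b} (suc n) St f stop more body l =
        ⟶-weaken (ℕ.≤-reflexive (sym (ℕ.+-assoc (suc b) (n * suc b) 1)))
          (subst (λ l′ → St 0 l ⟶⟨ while c P , suc b + loop-time {a} {k} n b ⟩ St (suc n) l′) (sym (List.++-ʳ++ (f 0)))
            (while-enter (more 0 l (s≤s z≤n)) (body 0 l (s≤s z≤n))
              (while-word n (St ∘ suc) (f ∘ suc) stop (λ s l s<n → more (suc s) l (s≤s s<n))
                (λ s l s<n → body (suc s) l (s≤s s<n)) (f 0 ʳ++ l))))

    zip : Word → Word → View a
    zip l q (+ n)     = nth (List.map bit q) n
    zip l q -[1+ n ]  = nth (List.map bit l) n

    write-zip : ∀ b l → actV (zip l []) (bit b , right) ≗ zip (b ∷ l) []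
    write-zip b l (+ n)        = refl
    write-zip b l -[1+ zero ]  = refl
    write-zip b l -[1+ suc n ] = refl

    zip-sh : ∀ l q → zip l q ≗ sh (length l) (zip [] (l ʳ++ q))
    zip-sh []      q i = refl
    zip-sh (b ∷ l) q i = trans (shift i) (zip-sh l (b ∷ q) (inc i))
      where
      shift : ∀ i → zip (b ∷ l) q i ≡ zip l (b ∷ q) (inc i)
      shift (+ n)        = refl
      shift -[1+ zero ]  = refl
      shift -[1+ suc n ] = refl

-- A machine that prints the adjacency matrix

module Printing where

  open import Data.Integer using (ℤ; +_; -[1+_])
  open FiniteTypes
  open Finite
  open Programs
  open ProgramRules
  open Tilings using (Class; class; classOf; isOdd; bitAt; finite-Class)
  open Colourings using (Rel; far; prev; same; next; rel)

  alphabet : ℕ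
  alphabet = suc (size finite-Class)

  Sym : Set
  Sym = Symbol alphabet

  classSymbol : Class → Sym
  classSymbol κ = aux (suc (to finite-Class κ))

  symbolClass : Sym → Class
  symbolClass (aux (suc i)) = from finite-Class i
  symbolClass _             = class nothing false false false false

  symbolClass-classSymbol : ∀ κ → symbolClass (classSymbol κ) ≡ κ
  symbolClass-classSymbol κ = from∘to finite-Class κ

  -- `far` is the blank, so that three marked cells make a complete distance tape. `same` takes
  -- `aux zero`, which the class symbols leave free.
  relSymbol : Rel → Sym
  relSymbol far  = blank
  relSymbol prev = bit false
  relSymbol same = aux zero
  relSymbol next = bit true

  symbolRel : Sym → Rel
  symbolRel blank       = far
  symbolRel (bit false) = prev
  symbolRel (bit true)  = next
  symbolRel (aux _)     = same

  symbolRel-relSymbol : ∀ r → symbolRel (relSymbol r) ≡ r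
  symbolRel-relSymbol far  = refl
  symbolRel-relSymbol prev = refl
  symbolRel-relSymbol same = refl
  symbolRel-relSymbol next = refl

  symbolBit : Sym → Maybe Bool
  symbolBit (bit b) = just b
  symbolBit _       = nothing

  Prog : Set
  Prog = Program {alphabet} {14}

  -- Input, output, five counters, a flag, four copies of the ruler, two distance tapes.
  iX iO iN iC iY iD iB iF iT iS iT′ iS′ iDT iDS : Fin 14
  iX  = # 0
  iO  = # 1
  iN  = # 2
  iC  = # 3
  iY  = # 4
  iD  = # 5
  iB  = # 6
  iF  = # 7
  iT  = # 8
  iS  = # 9
  iT′ = # 10
  iS′ = # 11
  iDT = # 12
  iDS = # 13

  time : ℕ → ℕ → ℕ
  time = loop-time {alphabet} {14}

  drain : Fin 14 → Prog → Prog
  drain i P = while (nonblank i) (pop i ⨟ P)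

  -- Horner's rule on counters: Y := c + N * Y.
  horner : Polynomial → Prog
  horner []      = skip
  horner (c ∷ p) =
    horner p ⨟ drain iN (push iC ⨟ drain iY (push iB ⨟ push iD) ⨟ drain iD (push iY)) ⨟
    drain iC (push iN) ⨟ drain iY skip ⨟ drain iB (push iY) ⨟ each c (λ _ → push iY)

  hornerTime : Polynomial → ℕ → ℕ
  hornerTime []      n = 1
  hornerTime (c ∷ p) n = hornerTime p n +
    (time n (1 + (2 + (time e 5 + time e 3))) + (time n 3 + (time e 2 + (time (n * e) 3 + (c * 2 + 1)))))
    where e = eval p n

  module Horner (x o : View alphabet) (ws : Vec (View alphabet) 7) where

    H : ℕ → ℕ → ℕ → ℕ → ℕ → Vec (View alphabet) 14
    H n c y d b = x ∷ o ∷ counter n ∷ counter c ∷ counter y ∷ counter d ∷ counter b ∷ ws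

    copy-Y : ∀ n c y b → H n c y 0 b ⟶⟨ drain iY (push iB ⨟ push iD) , time y 5 ⟩ H n c 0 y (y + b)
    copy-Y n c y b = while-count y (λ i j → H n c i j (j + b)) (λ _ → refl) (λ _ _ → refl)
      λ i j _ → ⟶-pop iY i refl ⟫ ⟶-push iB (j + b) refl ⟫ ⟶-push iD j refl

    move-D : ∀ n c d b → H n c 0 d b ⟶⟨ drain iD (push iY) , time d 3 ⟩ H n c d 0 b
    move-D n c d b = while-count d (λ i j → H n c j i b) (λ _ → refl) (λ _ _ → refl)
      λ i j _ → ⟶-pop iD i refl ⟫ ⟶-push iY j refl

    -- Adding the second factor to `B` empties `Y`, hence the copy in `D`, from which it is
    -- refilled. `C` records the rounds, so that `N` can be restored afterwards.
    multiply : ∀ n e → H n 0 e 0 0 ⟶⟨ drain iN (push iC ⨟ drain iY (push iB ⨟ push iD) ⨟ drain iD (push iY)) ,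
      time n (1 + (2 + (time e 5 + time e 3))) ⟩ H 0 n e 0 (n * e)
    multiply n e = while-count n (λ i j → H i j e 0 (j * e)) (λ _ → refl) (λ _ _ → refl)
      λ i j _ → ⟶-pop iN i refl ⟫ ⟶-push iC j refl ⟫ copy-Y i (suc j) e (j * e) ⟫ move-D i (suc j) e (e + j * e)

    restore-N : ∀ n y b → H 0 n y 0 b ⟶⟨ drain iC (push iN) , time n 3 ⟩ H n 0 y 0 b
    restore-N n y b = while-count n (λ i j → H j i y 0 b) (λ _ → refl) (λ _ _ → refl)
      λ i j _ → ⟶-pop iC i refl ⟫ ⟶-push iN j refl

    clear-Y : ∀ n y b → H n 0 y 0 b ⟶⟨ drain iY skip , time y 2 ⟩ H n 0 0 0 b
    clear-Y n y b = while-count y (λ i j → H n 0 i 0 b) (λ _ → refl) (λ _ _ → refl)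
      λ i j _ → ⟶-pop iY i refl ⟫ ⟶-skip

    move-B : ∀ n b → H n 0 0 0 b ⟶⟨ drain iB (push iY) , time b 3 ⟩ H n 0 b 0 0
    move-B n b = while-count b (λ i j → H n 0 j 0 i) (λ _ → refl) (λ _ _ → refl)
      λ i j _ → ⟶-pop iB i refl ⟫ ⟶-push iY j refl

    ⟶-horner : ∀ p n → H n 0 0 0 0 ⟶⟨ horner p , hornerTime p n ⟩ H n 0 (eval p n) 0 0
    ⟶-horner []      n = ⟶-skip
    ⟶-horner (c ∷ p) n =
      ⟶-horner p n ⟫ multiply n e ⟫ restore-N n e (n * e) ⟫ clear-Y n e (n * e) ⟫ move-B n (n * e) ⟫
      ⟶-each c (λ _ → push iY) (λ j → H n 0 (j + n * e) 0 0) (λ i → ⟶-push iY (toℕ i + n * e) refl)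
      where e = eval p n

  inc^ : ℕ → ℤ → ℤ
  inc^ zero    i = i
  inc^ (suc s) i = inc^ s (inc i)

  sh-inc^ : ∀ s (c : View alphabet) i → sh s c i ≡ c (inc^ s i)
  sh-inc^ zero    c i = refl
  sh-inc^ (suc s) c i = sh-inc^ s c (inc i)

  inc^-+ : ∀ s n → inc^ s (+ n) ≡ + (s + n)
  inc^-+ zero    n = refl
  inc^-+ (suc s) n = trans (inc^-+ s (suc n)) (cong (λ j → + j) (ℕ.+-suc s n))

  inc^-injective : ∀ s {i j} → inc^ s i ≡ inc^ s j → i ≡ j
  inc^-injective zero    eq = eq
  inc^-injective (suc s) {i} {j} eq =
    trans (sym (dec-inc i)) (trans (cong dec (inc^-injective s eq)) (dec-inc j))

  cut : (ℕ → Sym) → ℕ → View alphabet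
  cut f s (+ i)    = if i <ᵇ s then f i else blank
  cut f s -[1+ _ ] = blank

  <ᵇ-true : ∀ {i s} → i < s → (i <ᵇ s) ≡ true
  <ᵇ-true {i} {s} i<s with i <ᵇ s in eq
  ... | true  = refl
  ... | false = ⊥-elim (subst T eq (ℕ.<⇒<ᵇ i<s))

  <ᵇ-false : ∀ {i s} → s ≤ i → (i <ᵇ s) ≡ false
  <ᵇ-false {i} {s} s≤i with i <ᵇ s in eq
  ... | false = refl
  ... | true  = ⊥-elim (ℕ.<⇒≱ (ℕ.<ᵇ⇒< i s (subst T (sym eq) _)) s≤i)

  cut-inside : ∀ f {s i} → i < s → cut f s (+ i) ≡ f i
  cut-inside f i<s rewrite <ᵇ-true i<s = refl

  cut-outside : ∀ f {s i} → s ≤ i → cut f s (+ i) ≡ blank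
  cut-outside f s≤i rewrite <ᵇ-false s≤i = refl

  <ᵇ-suc : ∀ i s → i ≢ s → (i <ᵇ s) ≡ (i <ᵇ suc s)
  <ᵇ-suc zero    zero    ne = ⊥-elim (ne refl)
  <ᵇ-suc zero    (suc s) ne = refl
  <ᵇ-suc (suc i) zero    ne = refl
  <ᵇ-suc (suc i) (suc s) ne = <ᵇ-suc i s (ne ∘ cong suc)

  cut-suc : ∀ f s z → z ≢ + s → cut f s z ≡ cut f (suc s) z
  cut-suc f s (+ i)    ne = cong (λ b → if b then f i else blank) (<ᵇ-suc i s (λ eq → ne (cong (λ j → + j) eq)))
  cut-suc f s -[1+ _ ] ne = refl

  write-cut : ∀ f s → actV (sh s (cut f s)) (f s , right) ≗ sh (suc s) (cut f (suc s))
  write-cut f s j = written (inc j)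
    where
    elsewhere : ∀ i → i ≢ + 0 → sh s (cut f s) i ≡ sh s (cut f (suc s)) i
    elsewhere i ne = trans (sh-inc^ s (cut f s) i) (trans
      (cut-suc f s (inc^ s i) (λ eq → ne (inc^-injective s (trans eq (sym (trans (inc^-+ s 0) (cong (λ j → + j) (ℕ.+-identityʳ s))))))))
      (sym (sh-inc^ s (cut f (suc s)) i)))
    written : writeV (sh s (cut f s)) (f s) ≗ sh s (cut f (suc s))
    written (+ zero)  = sym (trans (peek-sh s (cut f (suc s))) (cut-inside f (ℕ.n<1+n s)))
    written (+ suc n) = elsewhere (+ suc n) λ ()
    written -[1+ n ]  = elsewhere -[1+ n ] λ ()

  -- One cell reports both whether the position is the first and whether it is odd: it is blank at 0
  -- and holds the parity from then on.
  flag : ℕ → Sym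
  flag zero    = blank
  flag (suc s) = bit (isOdd (suc s))

  flagV : ℕ → View alphabet
  flagV s (+ zero)  = flag s
  flagV s (+ suc _) = blank
  flagV s -[1+ _ ]  = blank

  nextFlag : Sym → Sym
  nextFlag (bit b) = bit (not b)
  nextFlag _       = bit true

  flag-suc : ∀ s → actV (flagV s) (nextFlag (flag s) , stay) ≗ flagV (suc s)
  flag-suc zero    (+ zero)  = refl
  flag-suc (suc s) (+ zero)  = refl
  flag-suc s       (+ suc _) = refl
  flag-suc s       -[1+ _ ]  = refl

  flagFirst flagOdd : Sym → Bool
  flagFirst blank = true
  flagFirst _     = false
  flagOdd (bit b) = b
  flagOdd _       = false

  flag-first : ∀ s → flagFirst (flag s) ≡ (s ≡ᵇ 0)
  flag-first zero    = refl
  flag-first (suc s) = refl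

  flag-odd : ∀ s → flagOdd (flag s) ≡ isOdd s
  flag-odd zero    = refl
  flag-odd (suc s) = refl

  -- The certificate and last bits of a class are known from the place in the program; the rest is
  -- read off the input tape and the flag. All four rulers receive the same symbol.
  emit : Bool → Bool → Prog
  emit allowed last = write iT ⨟ write iS ⨟ write iT′ ⨟ write iS′ ⨟ at iF (λ ss → nextFlag (lookup ss iF) , stay) ⨟ moveAt iX right
    where
    write : Fin 14 → Prog
    write i = at i λ ss → classSymbol (class (symbolBit (lookup ss iX)) allowed (flagFirst (lookup ss iF)) last (flagOdd (lookup ss iF))) , right

  readInput : Prog
  readInput = while (nonblank iX) (push iN ⨟ moveAt iX right) ⨟ rewind iX skip skip

  markD : Fin 14 → Prog
  markD i = at i (λ _ → relSymbol same , right) ⨟ at i (λ _ → relSymbol next , left) ⨟ moveAt i left ⨟ at i (λ _ → relSymbol prev , right)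

  distance : View alphabet
  distance (+ zero)          = relSymbol same
  distance (+ suc zero)      = relSymbol next
  distance (+ suc (suc _))   = blank
  distance -[1+ zero ]       = relSymbol prev
  distance -[1+ suc _ ]      = blank

  ⟶-markD : ∀ {vs : Vec (View alphabet) 14} i → lookup vs i ≡ blanks → vs ⟶⟨ markD i , 4 ⟩ vs [ i ]≔ distance
  ⟶-markD {vs} i eq = subst (vs ⟶⟨ markD i , 4 ⟩_)
    (trans (Vec.[]≔-idempotent (vs [ i ]≔ v₁ [ i ]≔ v₂) i) (trans (Vec.[]≔-idempotent (vs [ i ]≔ v₁) i) (Vec.[]≔-idempotent vs i)))
    (⟶-at (λ j → cong (λ v → actV v (relSymbol same , right) j) eq) ⟫
     ⟶-at (λ j → cong (λ v → actV v (relSymbol next , left) j) (Vec.lookup∘updateAt i vs)) ⟫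
     ⟶-move i left (λ j → cong (λ v → v (dec j)) (Vec.lookup∘updateAt i (vs [ i ]≔ v₁))) ⟫
     ⟶-at (λ j → trans (cong (λ v → actV v (relSymbol prev , right) j) (Vec.lookup∘updateAt i (vs [ i ]≔ v₁ [ i ]≔ v₂))) (result j)))
    where
    v₁ v₂ v₃ : View alphabet
    v₁ = actV blanks (relSymbol same , right)
    v₂ = actV v₁ (relSymbol next , left)
    v₃ = v₂ ∘ dec
    result : actV v₃ (relSymbol prev , right) ≗ distance
    result (+ zero)              = refl
    result (+ suc zero)          = refl
    result (+ suc (suc _))       = refl
    result -[1+ zero ]           = refl
    result -[1+ suc zero ]       = refl
    result -[1+ suc (suc _) ]    = refl

  -- The head stands t′ - t cells to the right of the mark `same`, since it has moved left with the
  -- first ruler and right with the second. Common steps cancel, which leaves one of the two offsets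
  -- 0.
  distance-rel : ∀ t t′ → peek (sh t′ (hs t distance)) ≡ relSymbol (rel t t′)
  distance-rel (suc t) (suc t′) = trans (sh-hs t′ t distance (+ 0)) (distance-rel t t′)
  distance-rel zero    t′       = trans (peek-sh t′ distance) (right-side t′)
    where
    right-side : ∀ t → distance (+ t) ≡ relSymbol (rel zero t)
    right-side zero          = refl
    right-side (suc zero)    = refl
    right-side (suc (suc _)) = refl
  distance-rel (suc zero)    zero = refl
  distance-rel (suc (suc t)) zero = hs-left t 0
    where
    hs-left : ∀ t j → hs (suc t) distance -[1+ j ] ≡ blank
    hs-left zero    j = refl
    hs-left (suc t) j = hs-left t (suc j)

  module Printer {C : ℕ} (bits : Class → Class → Class → Class → Rel → Rel → Fin C → Fin C → Bool) (p r : Polynomial) where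

    printBit : Fin C → Fin C → Prog
    printBit ℓ ℓ′ = at iO λ ss →
      bit (bits (symbolClass (lookup ss iT)) (symbolClass (lookup ss iS))
                (symbolClass (lookup ss iT′)) (symbolClass (lookup ss iS′))
                (symbolRel (lookup ss iDT)) (symbolRel (lookup ss iDS)) ℓ ℓ′) , right

    -- The distance tapes move against the first pair of rulers and along with the second pair.
    printSite printSites print : Prog
    printCellsOf printRowOf : Fin C → Prog
    printCellsOf ℓ = while (nonblank iS′) (each C (printBit ℓ) ⨟ moveAt iS′ right ⨟ moveAt iDS right)
    printRowOf ℓ = while (nonblank iT′)
      (printCellsOf ℓ ⨟ rewind iS′ (moveAt iDS left) (moveAt iDS right) ⨟ moveAt iT′ right ⨟ moveAt iDT right)
    printSite = each C λ ℓ → printRowOf ℓ ⨟ rewind iT′ (moveAt iDT left) (moveAt iDT right)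
    printSites = while (nonblank iS) (printSite ⨟ moveAt iS right ⨟ moveAt iDS left)
    print = while (nonblank iT)
      (printSites ⨟ rewind iS (moveAt iDS right) (moveAt iDS left) ⨟ moveAt iT right ⨟ moveAt iDT left)

    printer : Prog
    printer =
      -- P columns in which a certificate may have bits, then R without, then the last one: this
      -- makes W = R + P + 1 cells. `horner` preserves `N`, so it can be evaluated twice.
      readInput ⨟ horner p ⨟ drain iY (emit true false) ⨟ horner r ⨟ drain iY (emit false false) ⨟ emit false true ⨟
      rewind iT skip skip ⨟ rewind iS skip skip ⨟ rewind iT′ skip skip ⨟ rewind iS′ skip skip ⨟
      -- The output is read from the head onwards, so the output head must finally return to the
      -- first bit.
      markD iDT ⨟ markD iDS ⨟ print ⨟ rewind iO skip skip

    rewindTime : ℕ → ℕ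
    rewindTime n = 2 + (time n 2 + 2)

    cellsTime rowTime siteTime sitesTime printTime : ℕ → ℕ
    cellsTime W = time W (C * 1 + 1 + 2)
    rowTime W   = time W (cellsTime W + (rewindTime W + 2))
    siteTime W  = C * (rowTime W + rewindTime W) + 1
    sitesTime W = time W (siteTime W + 2)
    printTime W = time W (sitesTime W + (rewindTime W + 2))

    printerTime : ℕ → ℕ
    printerTime n =
      time n 3 + rewindTime n + (hornerTime p n + (time (eval p n) 7 + (hornerTime r n + (time (eval r n) 7 + (6 +
      (rewindTime W + (rewindTime W + (rewindTime W + (rewindTime W + (4 + (4 + (printTime W +
      rewindTime (W * (W * (C * (W * (W * C)))))))))))))))))
      where W = suc (eval r n + eval p n)

    module OnInput (x : Word) where

      n P R W : ℕ
      n = length x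
      P = eval p n
      R = eval r n
      W = suc (R + P)

      κ : ℕ → Class
      κ = classOf x P W

      input : View alphabet
      input = look (inputTape x)

      ruler : ℕ → View alphabet
      ruler = cut (classSymbol ∘ κ)

      cells : ℕ → ℕ → Fin C → ℕ → ℕ → Word
      cells t s ℓ t′ s′ = concat (tabulate λ ℓ′ → bits (κ t) (κ s) (κ t′) (κ s′) (rel t t′) (rel s s′) ℓ ℓ′ ∷ [])

      forSites : (ℕ → Word) → Word
      forSites f = concat (tabulate {n = W} (f ∘ toℕ))

      row : ℕ → ℕ → Fin C → Word
      row t s ℓ = forSites λ t′ → forSites λ s′ → cells t s ℓ t′ s′

      matrix : Word
      matrix = forSites λ t → forSites λ s → concat (tabulate (row t s))

      input-nonblank : ∀ {s} → s < n → isNonblank (input (+ s)) ≡ true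
      input-nonblank {s} s<n = at-position x s s<n
        where
        inside : ∀ w s → s < length w → isNonblank (nth {alphabet} (List.map bit w) s) ≡ true
        inside (_ ∷ w) zero    _         = refl
        inside (_ ∷ w) (suc s) (s≤s s<) = inside w s s<
        at-position : ∀ x s → s < length x → isNonblank (look {alphabet} (inputTape x) (+ s)) ≡ true
        at-position (_ ∷ w) zero    _         = refl
        at-position (_ ∷ w) (suc s) (s≤s s<) = inside w s s<

      input-bit : ∀ s → symbolBit (input (+ s)) ≡ bitAt x s
      input-bit s = at-position x s
        where
        inside : ∀ w s → symbolBit (nth {alphabet} (List.map bit w) s) ≡ bitAt w s
        inside []      s       = refl
        inside (_ ∷ w) zero    = refl
        inside (_ ∷ w) (suc s) = inside w s
        at-position : ∀ x s → symbolBit (look {alphabet} (inputTape x) (+ s)) ≡ bitAt x s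
        at-position []      zero    = refl
        at-position []      (suc s) = refl
        at-position (_ ∷ w) zero    = refl
        at-position (_ ∷ w) (suc s) = inside w s

      input-end : isNonblank (input (+ n)) ≡ false
      input-end = end x
        where
        inside : ∀ w → isNonblank (nth {alphabet} (List.map bit w) (length w)) ≡ false
        inside []      = refl
        inside (_ ∷ w) = inside w
        end : ∀ x → isNonblank (look {alphabet} (inputTape x) (+ length x)) ≡ false
        end []      = refl
        end (_ ∷ w) = inside w

      input-before : input -[1+ 0 ] ≡ blank
      input-before = before′ x
        where
        before′ : ∀ x → look {alphabet} (inputTape x) -[1+ 0 ] ≡ blank
        before′ []      = refl
        before′ (_ ∷ _) = refl

      ⟶-rewind-alone : ∀ i m {c} (F : View alphabet → Vec (View alphabet) 14) →
        (∀ u → lookup (F u) i ≡ u) → (∀ u u′ → F u [ i ]≔ u′ ≡ F u′) →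
        c -[1+ 0 ] ≡ blank → (∀ s → s < m → isNonblank (c (+ s)) ≡ true) →
        F (sh m c) ⟶⟨ rewind i skip skip , rewindTime m ⟩ F c
      ⟶-rewind-alone i m F look-F set-F = ⟶-rewind i m (λ _ → blanks) blanks (λ u _ → F u)
        (λ u _ → look-F u) (λ u u′ _ → set-F u u′) (λ _ _ → ⟶-skip) (λ _ → ⟶-skip) (λ _ → ⟶-skip)

      Setup : View alphabet → ℕ → ℕ → ℕ → Vec (View alphabet) 14
      Setup X N Y s = X ∷ zip [] [] ∷ counter N ∷ counter 0 ∷ counter Y ∷ counter 0 ∷ counter 0 ∷ flagV s ∷
        sh s (ruler s) ∷ sh s (ruler s) ∷ sh s (ruler s) ∷ sh s (ruler s) ∷ blanks ∷ blanks ∷ []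

      ⟶-readInput : Setup input 0 0 0 ⟶⟨ readInput , time n 3 + rewindTime n ⟩ Setup input n 0 0
      ⟶-readInput =
        while-up (λ j → Setup (sh j input) j 0 0) n
          (trans (cong isNonblank (peek-sh n input)) input-end)
          (λ i i<n → trans (cong isNonblank (peek-sh i input)) (input-nonblank i<n))
          (λ i _ → ⟶-push iN i refl ⟫ ⟶-move iX right λ _ → refl)
        ⟫ ⟶-rewind-alone iX n (λ u → Setup u n 0 0) (λ _ → refl) (λ _ _ → refl) input-before (λ s → input-nonblank)

      ⟶-emit : ∀ {allowed last} y s → κ s ≡ class (bitAt x s) allowed (s ≡ᵇ 0) last (isOdd s) →
        Setup (sh s input) n y s ⟶⟨ emit allowed last , 6 ⟩ Setup (sh (suc s) input) n y (suc s)
      ⟶-emit {allowed} {last} y s eq =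
        ⟶-at written ⟫ ⟶-at written ⟫ ⟶-at written ⟫ ⟶-at written ⟫ ⟶-at (flag-suc s) ⟫ ⟶-move iX right λ _ → refl
        where
        written : actV (sh s (ruler s)) (classSymbol (class (symbolBit (peek (sh s input))) allowed (flagFirst (flag s)) last (flagOdd (flag s))) , right)
          ≗ sh (suc s) (ruler (suc s))
        written j = trans
          (cong (λ c → actV (sh s (ruler s)) (classSymbol c , right) j) (trans
            (trans (cong (λ b → class b allowed (flagFirst (flag s)) last (flagOdd (flag s))) (trans (cong symbolBit (peek-sh s input)) (input-bit s)))
                   (cong₂ (λ f o → class (bitAt x s) allowed f last o) (flag-first s) (flag-odd s)))
            (sym eq)))
          (write-cut (classSymbol ∘ κ) s j)

      ≡ᵇ-false : ∀ {i j} → i < j → (i ≡ᵇ j) ≡ false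
      ≡ᵇ-false {zero}  (s≤s _)   = refl
      ≡ᵇ-false {suc i} (s≤s i<j) = ≡ᵇ-false i<j

      ≡ᵇ-true : ∀ i → (i ≡ᵇ i) ≡ true
      ≡ᵇ-true zero    = refl
      ≡ᵇ-true (suc i) = ≡ᵇ-true i

      class-cong : ∀ {s} allowed last → (s <ᵇ P) ≡ allowed → (suc s ≡ᵇ W) ≡ last →
        κ s ≡ class (bitAt x s) allowed (s ≡ᵇ 0) last (isOdd s)
      class-cong {s} _ _ refl refl = refl

      ⟶-emit-certificate : Setup input n P 0 ⟶⟨ drain iY (emit true false) , time P 7 ⟩ Setup (sh P input) n 0 P
      ⟶-emit-certificate = while-count P (λ i j → Setup (sh j input) n i j) (λ _ → refl) (λ _ _ → refl)
        λ i j eq → ⟶-pop iY i refl ⟫ ⟶-emit i j (class-cong true false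
          (<ᵇ-true (below eq)) (≡ᵇ-false {j} (ℕ.≤-trans (below eq) (ℕ.m≤n+m P R))))
        where
        below : ∀ {i j} → suc i + j ≡ P → j < P
        below {i} {j} eq = ℕ.≤-trans (s≤s (ℕ.m≤n+m j i)) (ℕ.≤-reflexive eq)

      ⟶-emit-rest : Setup (sh P input) n R P ⟶⟨ drain iY (emit false false) , time R 7 ⟩ Setup (sh (R + P) input) n 0 (R + P)
      ⟶-emit-rest = while-count R (λ i j → Setup (sh (j + P) input) n i (j + P)) (λ _ → refl) (λ _ _ → refl)
        λ i j eq → ⟶-pop iY i refl ⟫ ⟶-emit i (j + P) (class-cong false false
          (<ᵇ-false (ℕ.m≤n+m P j)) (≡ᵇ-false {j + P} (ℕ.+-monoˡ-< P (below eq))))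
        where
        below : ∀ {i j} → suc i + j ≡ R → j < R
        below {i} {j} eq = ℕ.≤-trans (s≤s (ℕ.m≤n+m j i)) (ℕ.≤-reflexive eq)

      ⟶-emit-last : Setup (sh (R + P) input) n 0 (R + P) ⟶⟨ emit false true , 6 ⟩ Setup (sh W input) n 0 W
      ⟶-emit-last = ⟶-emit 0 (R + P) (class-cong false true (<ᵇ-false (ℕ.m≤n+m P R)) (≡ᵇ-true (R + P)))

      Q : View alphabet
      Q = ruler W

      ruler-inside : ∀ {s} → s < W → Q (+ s) ≡ classSymbol (κ s)
      ruler-inside = cut-inside (classSymbol ∘ κ)

      ruler-nonblank : ∀ {s} → s < W → isNonblank (Q (+ s)) ≡ true
      ruler-nonblank s<W = cong isNonblank (ruler-inside s<W)

      more : ∀ s → s < W → isNonblank (peek (sh s Q)) ≡ true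
      more s s<W = trans (cong isNonblank (peek-sh s Q)) (ruler-nonblank s<W)

      stop : isNonblank (peek (sh W Q)) ≡ false
      stop = trans (cong isNonblank (peek-sh W Q)) (cong isNonblank (cut-outside (classSymbol ∘ κ) {W} ℕ.≤-refl))

      ruler-class : ∀ {s} → s < W → symbolClass (peek (sh s Q)) ≡ κ s
      ruler-class {s} s<W = trans (cong symbolClass (trans (peek-sh s Q) (ruler-inside s<W))) (symbolClass-classSymbol (κ s))

      distance-class : ∀ t t′ → symbolRel (peek (sh t′ (hs t distance))) ≡ rel t t′
      distance-class t t′ = trans (cong symbolRel (distance-rel t t′)) (symbolRel-relSymbol (rel t t′))

      Full : (o t s t′ s′ dt ds : View alphabet) → Vec (View alphabet) 14
      Full o t s t′ s′ dt ds = sh W input ∷ o ∷ counter n ∷ counter 0 ∷ counter 0 ∷ counter 0 ∷ counter 0 ∷ flagV W ∷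
        t ∷ s ∷ t′ ∷ s′ ∷ dt ∷ ds ∷ []

      Print : ℕ → ℕ → ℕ → ℕ → Word → Vec (View alphabet) 14
      Print t s t′ s′ l = Full (zip l []) (sh t Q) (sh s Q) (sh t′ Q) (sh s′ Q) (sh t′ (hs t distance)) (sh s′ (hs s distance))

      ⟶-rewind-ruler : ∀ i {Q₁ Q₂} (B : ℕ → View alphabet) (B₋₁ : View alphabet) (F : View alphabet → View alphabet → Vec (View alphabet) 14) →
        (∀ u v → lookup (F u v) i ≡ u) → (∀ u u′ v → F u v [ i ]≔ u′ ≡ F u′ v) →
        (∀ u s → F u (B (suc s)) ⟶⟨ Q₁ , 1 ⟩ F u (B s)) → (∀ u → F u (B 0) ⟶⟨ Q₁ , 1 ⟩ F u B₋₁) →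
        (∀ u → F u B₋₁ ⟶⟨ Q₂ , 1 ⟩ F u (B 0)) →
        F (sh W Q) (B W) ⟶⟨ rewind i Q₁ Q₂ , rewindTime W ⟩ F Q (B 0)
      ⟶-rewind-ruler i B B₋₁ F look-F set-F back back₀ forth =
        ⟶-rewind i W B B₋₁ F look-F set-F back back₀ forth refl (λ s → ruler-nonblank)

      ⟶-printBit : ∀ {t s t′ s′} → t < W → s < W → t′ < W → s′ < W → ∀ ℓ ℓ′ l →
        Print t s t′ s′ l ⟶⟨ printBit ℓ ℓ′ , 1 ⟩
        Print t s t′ s′ (bits (κ t) (κ s) (κ t′) (κ s′) (rel t t′) (rel s s′) ℓ ℓ′ ∷ l)
      ⟶-printBit {t} {s} {t′} {s′} t< s< t′< s′< ℓ ℓ′ l = ⟶-at λ j → trans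
        (cong (λ b → actV (zip l []) (bit b , right) j) correct) (write-zip _ l j)
        where
        correct : bits (symbolClass (peek (sh t Q))) (symbolClass (peek (sh s Q))) (symbolClass (peek (sh t′ Q))) (symbolClass (peek (sh s′ Q)))
          (symbolRel (peek (sh t′ (hs t distance)))) (symbolRel (peek (sh s′ (hs s distance)))) ℓ ℓ′
          ≡ bits (κ t) (κ s) (κ t′) (κ s′) (rel t t′) (rel s s′) ℓ ℓ′
        correct rewrite ruler-class t< | ruler-class s< | ruler-class t′< | ruler-class s′<
          | distance-class t t′ | distance-class s s′ = refl

      ⟶-printCells : ∀ {t s t′} → t < W → s < W → t′ < W → ∀ ℓ l →
        Print t s t′ 0 l ⟶⟨ printCellsOf ℓ , cellsTime W ⟩ Print t s t′ W (forSites (cells t s ℓ t′) ʳ++ l)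
      ⟶-printCells {t} {s} {t′} t< s< t′< ℓ = while-word W (Print t s t′) (cells t s ℓ t′)
        (λ _ → stop) (λ s′ _ → more s′)
        λ s′ l s′< → ⟶-each-word C (printBit ℓ) (Print t s t′ s′) _ (⟶-printBit t< s< t′< s′< ℓ) l ⟫
          ⟶-move iS′ right (λ _ → refl) ⟫ ⟶-move iDS right (λ _ → refl)

      ⟶-printRow : ∀ {t s} → t < W → s < W → ∀ ℓ l →
        Print t s 0 0 l ⟶⟨ printRowOf ℓ , rowTime W ⟩ Print t s W 0 (row t s ℓ ʳ++ l)
      ⟶-printRow {t} {s} t< s< ℓ = while-word W (λ t′ → Print t s t′ 0) (λ t′ → forSites (cells t s ℓ t′))
        (λ _ → stop) (λ t′ _ → more t′)
        λ t′ l t′< → ⟶-printCells t< s< t′< ℓ l ⟫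
          ⟶-rewind-ruler iS′ (λ s′ → sh s′ (hs s distance)) (hs s distance ∘ dec)
            (λ u v → Full (zip (forSites (cells t s ℓ t′) ʳ++ l) []) (sh t Q) (sh s Q) (sh t′ Q) u (sh t′ (hs t distance)) v) (λ _ _ → refl) (λ _ _ _ → refl)
            (λ u s′ → ⟶-move iDS left (left-sh s′ (hs s distance)))
            (λ u → ⟶-move iDS left (λ _ → refl))
            (λ u → ⟶-move iDS right (λ j → cong (hs s distance) (dec-inc j))) ⟫
          ⟶-move iT′ right (λ _ → refl) ⟫ ⟶-move iDT right (λ _ → refl)

      ⟶-printSite : ∀ {t s} → t < W → s < W → ∀ l →
        Print t s 0 0 l ⟶⟨ printSite , siteTime W ⟩ Print t s 0 0 (concat (tabulate (row t s)) ʳ++ l)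
      ⟶-printSite {t} {s} t< s< = ⟶-each-word C _ (Print t s 0 0) (row t s) λ ℓ l →
        ⟶-printRow t< s< ℓ l ⟫
        ⟶-rewind-ruler iT′ (λ t′ → sh t′ (hs t distance)) (hs t distance ∘ dec)
          (λ u v → Full (zip (row t s ℓ ʳ++ l) []) (sh t Q) (sh s Q) u Q v (hs s distance)) (λ _ _ → refl) (λ _ _ _ → refl)
          (λ u t′ → ⟶-move iDT left (left-sh t′ (hs t distance)))
          (λ u → ⟶-move iDT left (λ _ → refl))
          (λ u → ⟶-move iDT right (λ j → cong (hs t distance) (dec-inc j)))

      ⟶-printSites : ∀ {t} → t < W → ∀ l →
        Print t 0 0 0 l ⟶⟨ printSites , sitesTime W ⟩ Print t W 0 0 (forSites (λ s → concat (tabulate (row t s))) ʳ++ l)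
      ⟶-printSites {t} t< = while-word W (λ s → Print t s 0 0) (λ s → concat (tabulate (row t s)))
        (λ _ → stop) (λ s _ → more s)
        λ s l s< → ⟶-printSite t< s< l ⟫ ⟶-move iS right (λ _ → refl) ⟫ ⟶-move iDS left (λ _ → refl)

      ⟶-print : Print 0 0 0 0 [] ⟶⟨ print , printTime W ⟩ Print W 0 0 0 (matrix ʳ++ [])
      ⟶-print = while-word W (λ t → Print t 0 0 0) (λ t → forSites λ s → concat (tabulate (row t s)))
        (λ _ → stop) (λ t _ → more t)
        (λ t l t< → ⟶-printSites t< l ⟫
          -- This ruler and the distance tape move in opposite directions: when the ruler's head is
          -- on the blank before cell 0, the distance head is one cell to the right of `same`.
          ⟶-rewind-ruler iS (λ s → hs s distance) (distance ∘ inc)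
            (λ u v → Full (zip (forSites (λ s → concat (tabulate (row t s))) ʳ++ l) []) (sh t Q) u Q Q (hs t distance) v) (λ _ _ → refl) (λ _ _ _ → refl)
            (λ u s → ⟶-move iDS right (λ j → cong (hs s distance) (dec-inc j)))
            (λ u → ⟶-move iDS right (λ _ → refl))
            (λ u → ⟶-move iDS left (λ j → cong distance (inc-dec j))) ⟫
          ⟶-move iT right (λ _ → refl) ⟫ ⟶-move iDT left (λ _ → refl)) []

      length-concat : ∀ {k c} (f : Fin k → Word) → (∀ i → length (f i) ≡ c) → length (concat (tabulate f)) ≡ k * c
      length-concat {zero}  f eq = refl
      length-concat {suc k} f eq = trans (List.length-++ (f zero)) (cong₂ _+_ (eq zero) (length-concat (f ∘ suc) (eq ∘ suc)))

      length-forSites : ∀ {c} (f : ℕ → Word) → (∀ s → length (f s) ≡ c) → length (forSites f) ≡ W * c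
      length-forSites f eq = length-concat {W} (f ∘ toℕ) (eq ∘ toℕ)

      length-row : ∀ t s ℓ → length (row t s ℓ) ≡ W * (W * C)
      length-row t s ℓ = length-forSites (λ t′ → forSites (cells t s ℓ t′)) λ t′ → length-forSites (cells t s ℓ t′) λ s′ →
        trans (length-concat (λ ℓ′ → bits (κ t) (κ s) (κ t′) (κ s′) (rel t t′) (rel s s′) ℓ ℓ′ ∷ []) λ _ → refl) (ℕ.*-identityʳ C)

      length-matrix : length matrix ≡ W * (W * (C * (W * (W * C))))
      length-matrix = length-forSites (λ t → forSites λ s → concat (tabulate (row t s))) λ t →
        length-forSites (λ s → concat (tabulate (row t s))) λ s → length-concat (row t s) (length-row t s)

      Final : Vec (View alphabet) 14
      Final = Full (zip [] matrix) (sh W Q) Q Q Q (hs W distance) distance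

      ⟶-rewind-output : Print W 0 0 0 (matrix ʳ++ []) ⟶⟨ rewind iO skip skip , rewindTime (W * (W * (C * (W * (W * C))))) ⟩ Final
      ⟶-rewind-output =
        subst (λ m → Print W 0 0 0 l ⟶⟨ rewind iO skip skip , rewindTime m ⟩ Final)
          (trans (List.length-reverse matrix) length-matrix)
          (subst (λ w → Print W 0 0 0 l ⟶⟨ rewind iO skip skip , rewindTime (length l) ⟩ F (zip [] w))
            (List.reverse-involutive matrix)
            (⟶-pre written (⟶-rewind-alone iO (length l) F (λ _ → refl) (λ _ _ → refl) refl (bits-nonblank (l ʳ++ []) (ℕ.≤-reflexive (sym (List.length-reverse l)))))))
        where
        l : Word
        l = matrix ʳ++ []
        F : View alphabet → Vec (View alphabet) 14
        F u = Full u (sh W Q) Q Q Q (hs W distance) distance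
        written : Print W 0 0 0 l ≋ F (sh (length l) (zip [] (l ʳ++ [])))
        written zero          j = refl
        written (suc zero)    j = zip-sh l [] j
        written (suc (suc i)) j = refl
        bits-nonblank : ∀ w {m} → m ≤ length w → ∀ s → s < m → isNonblank (zip {alphabet} [] w (+ s)) ≡ true
        bits-nonblank (_ ∷ w) _ zero _ = refl
        bits-nonblank (_ ∷ w) (s≤s le) (suc s) (s≤s s<) = bits-nonblank w le s s<
        bits-nonblank [] z≤n s ()

      ⟶-printer : Setup input 0 0 0 ⟶⟨ printer , printerTime n ⟩ Final
      ⟶-printer =
        ⟶-readInput ⟫
        Horner.⟶-horner _ _ _ p n ⟫ ⟶-emit-certificate ⟫
        Horner.⟶-horner _ _ _ r n ⟫ ⟶-emit-rest ⟫ ⟶-emit-last ⟫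
        ⟶-rewind-alone iT W (λ u → Full o u q q q blanks blanks) (λ _ → refl) (λ _ _ → refl) refl nonblanks ⟫
        ⟶-rewind-alone iS W (λ u → Full o Q u q q blanks blanks) (λ _ → refl) (λ _ _ → refl) refl nonblanks ⟫
        ⟶-rewind-alone iT′ W (λ u → Full o Q Q u q blanks blanks) (λ _ → refl) (λ _ _ → refl) refl nonblanks ⟫
        ⟶-rewind-alone iS′ W (λ u → Full o Q Q Q u blanks blanks) (λ _ → refl) (λ _ _ → refl) refl nonblanks ⟫
        ⟶-markD iDT refl ⟫ ⟶-markD iDS refl ⟫ ⟶-print ⟫ ⟶-rewind-output
        where
        o q : View alphabet
        o = zip [] []
        q = sh W Q
        nonblanks : ∀ s → s < W → isNonblank (Q (+ s)) ≡ true
        nonblanks s = ruler-nonblank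

      initial-views : initialTapes 12 (x ∷ []) ⊨ Setup input 0 0 0
      initial-views zero j = refl
      initial-views (suc i) j = trans (cong (λ t → look t j) (Vec.lookup-replicate i (inputTape [])))
        (trans (blank-tape j) (sym (All.lookup⁺ blank-views i j)))
        where
        blank-tape : look {alphabet} (inputTape []) ≗ blanks
        blank-tape (+ zero)  = refl
        blank-tape (+ suc _) = refl
        blank-tape -[1+ _ ]  = refl
        blank-zip : zip {alphabet} [] [] ≗ blanks
        blank-zip (+ _)    = refl
        blank-zip -[1+ _ ] = refl
        blank-flag : flagV 0 ≗ blanks
        blank-flag (+ zero)  = refl
        blank-flag (+ suc _) = refl
        blank-flag -[1+ _ ]  = refl
        blank-ruler : ruler 0 ≗ blanks
        blank-ruler (+ _)    = refl
        blank-ruler -[1+ _ ] = refl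
        none : blanks {alphabet} ≗ blanks
        none _ = refl
        blank-views : All (_≗ blanks) (Vec.tail (Setup input 0 0 0))
        blank-views = blank-zip ∷ none ∷ none ∷ none ∷ none ∷ none ∷ blank-flag ∷
          blank-ruler ∷ blank-ruler ∷ blank-ruler ∷ blank-ruler ∷ none ∷ none ∷ []

      printer-correct : Outputs 1 12 printer (x ∷ []) (printerTime n) matrix
      printer-correct = program-outputs printer (x ∷ []) initial-views ⟶-printer λ _ → refl

-- Polynomial bounds and the order of enumeration

module Polynomials where

  open import Data.Nat.Solver using (module +-*-Solver)
  open FiniteTypes
  open Finite

  infixl 6 _⊕_
  infixl 7 _⊗_

  _⊕_ : Polynomial → Polynomial → Polynomial
  []      ⊕ q       = q
  (a ∷ p) ⊕ []      = a ∷ p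
  (a ∷ p) ⊕ (b ∷ q) = a + b ∷ p ⊕ q

  scale : ℕ → Polynomial → Polynomial
  scale c []      = []
  scale c (a ∷ p) = c * a ∷ scale c p

  _⊗_ : Polynomial → Polynomial → Polynomial
  []      ⊗ q = []
  (a ∷ p) ⊗ q = scale a q ⊕ (0 ∷ p ⊗ q)

  open +-*-Solver

  eval-⊕ : ∀ p q n → eval (p ⊕ q) n ≡ eval p n + eval q n
  eval-⊕ []      q       n = refl
  eval-⊕ (a ∷ p) []      n = sym (ℕ.+-identityʳ _)
  eval-⊕ (a ∷ p) (b ∷ q) n rewrite eval-⊕ p q n =
    solve 5 (λ a b n p q → a :+ b :+ n :* (p :+ q) := a :+ n :* p :+ (b :+ n :* q)) refl a b n (eval p n) (eval q n)

  eval-scale : ∀ c p n → eval (scale c p) n ≡ c * eval p n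
  eval-scale c []      n = sym (ℕ.*-zeroʳ c)
  eval-scale c (a ∷ p) n rewrite eval-scale c p n =
    solve 4 (λ c a n p → c :* a :+ n :* (c :* p) := c :* (a :+ n :* p)) refl c a n (eval p n)

  eval-⊗ : ∀ p q n → eval (p ⊗ q) n ≡ eval p n * eval q n
  eval-⊗ []      q n = refl
  eval-⊗ (a ∷ p) q n rewrite eval-⊕ (scale a q) (0 ∷ p ⊗ q) n | eval-scale a q n | eval-⊗ p q n =
    solve 4 (λ a n p q → a :* q :+ n :* (p :* q) := (a :+ n :* p) :* q) refl a n (eval p n) (eval q n)

  -- Equality instead of a bound: the running times are explicit expressions in sums and products,
  -- and their polynomials are assembled along the same expressions.
  IsPolynomial : (ℕ → ℕ) → Set
  IsPolynomial f = ∃[ p ] ∀ n → eval p n ≡ f n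

  const-poly : ∀ c → IsPolynomial (λ _ → c)
  const-poly c = c ∷ [] , λ n → trans (cong (c +_) (ℕ.*-zeroʳ n)) (ℕ.+-identityʳ c)

  id-poly : IsPolynomial (λ n → n)
  id-poly = 0 ∷ 1 ∷ [] , λ n → solve 1 (λ n → n :* (con 1 :+ n :* con 0) := n) refl n

  eval-poly : ∀ p → IsPolynomial (eval p)
  eval-poly p = p , λ _ → refl

  infixl 6 _+-poly_
  infixl 7 _*-poly_

  _+-poly_ : ∀ {f g} → IsPolynomial f → IsPolynomial g → IsPolynomial (λ n → f n + g n)
  (p , eq) +-poly (q , eq′) = p ⊕ q , λ n → trans (eval-⊕ p q n) (cong₂ _+_ (eq n) (eq′ n))

  _*-poly_ : ∀ {f g} → IsPolynomial f → IsPolynomial g → IsPolynomial (λ n → f n * g n)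
  (p , eq) *-poly (q , eq′) = p ⊗ q , λ n → trans (eval-⊗ p q n) (cong₂ _*_ (eq n) (eq′ n))

  eval-∘-poly : ∀ p {f} → IsPolynomial f → IsPolynomial (λ n → eval p (f n))
  eval-∘-poly []      F = const-poly 0
  eval-∘-poly (a ∷ p) F = const-poly a +-poly F *-poly eval-∘-poly p F

  eval-mono : ∀ p {m n} → m ≤ n → eval p m ≤ eval p n
  eval-mono []      _  = z≤n
  eval-mono (a ∷ p) le = ℕ.+-monoʳ-≤ a (ℕ.*-mono-≤ le (eval-mono p le))

  concat-tabulate-cong : ∀ {A : Set} {n} {f g : Fin n → List A} → (∀ i → f i ≡ g i) →
    concat (tabulate f) ≡ concat (tabulate g)
  concat-tabulate-cong eq = cong concat (List.tabulate-cong eq)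

  tabulate-concat : ∀ {A : Set} {n} (f : Fin n → A) → tabulate f ≡ concat (tabulate (λ i → f i ∷ []))
  tabulate-concat {n = zero}  f = refl
  tabulate-concat {n = suc n} f = cong (f zero ∷_) (tabulate-concat (f ∘ suc))

  concat-tabulate-+ : ∀ {A : Set} m n (f : Fin (m + n) → List A) →
    concat (tabulate f) ≡ concat (tabulate (λ i → f (i ↑ˡ n))) ++ concat (tabulate (λ j → f (m ↑ʳ j)))
  concat-tabulate-+ zero    n f = refl
  concat-tabulate-+ (suc m) n f = trans (cong (f zero ++_) (concat-tabulate-+ m n (f ∘ suc)))
    (sym (List.++-assoc (f zero) _ _))

  -- `remQuot` lists pairs lexicographically, so running through a product is a nested loop.
  concat-tabulate-remQuot : ∀ {A : Set} m n (f : Fin m × Fin n → List A) →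
    concat (tabulate (f ∘ remQuot {m} n)) ≡ concat (tabulate λ i → concat (tabulate λ j → f (i , j)))
  concat-tabulate-remQuot zero    n f = refl
  concat-tabulate-remQuot (suc m) n f = trans (concat-tabulate-+ n (m * n) (f ∘ remQuot {suc m} n)) (cong₂ _++_
    (concat-tabulate-cong λ j → cong f (first j))
    (trans (concat-tabulate-cong λ k → cong f (rest k)) (concat-tabulate-remQuot m n (f ∘ map₁ suc))))
    where
    first : ∀ j → remQuot {suc m} n (j ↑ˡ (m * n)) ≡ (zero , j)
    first j rewrite Fin.splitAt-↑ˡ n j (m * n) = refl
    rest : ∀ k → remQuot {suc m} n (n ↑ʳ k) ≡ map₁ suc (remQuot {m} n k)
    rest k rewrite Fin.splitAt-↑ʳ n (m * n) k = refl

  enumerate : ∀ {A B : Set} → Finite A → (A → List B) → List B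
  enumerate F f = concat (tabulate (f ∘ from F))

  enumerate-× : ∀ {A B C : Set} (F : Finite A) (G : Finite B) (f : A × B → List C) →
    enumerate (finite-× F G) f ≡ enumerate F λ a → enumerate G λ b → f (a , b)
  enumerate-× F G f = concat-tabulate-remQuot (size F) (size G) (f ∘ Product.map (from F) (from G))

  sites : ∀ {A : Set} W → Finite A → Finite (Fin W × Fin W × A)
  sites W F = finite-× (finite-Fin W) (finite-× (finite-Fin W) F)

  enumerate-sites : ∀ {A B : Set} W (F : Finite A) (f : Fin W × Fin W × A → List B) →
    enumerate (sites W F) f ≡ concat (tabulate λ t → concat (tabulate λ s → enumerate F λ a → f (t , s , a)))
  enumerate-sites W F f = trans (enumerate-× (finite-Fin W) (finite-× (finite-Fin W) F) f)
    (concat-tabulate-cong λ t → enumerate-× (finite-Fin W) F λ q → f (t , q))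

  -- The bridge from the order in which `encodeGraph` lists the entries to the six nested loops of
  -- the printing program.
  matrix-of-sites : ∀ {A B : Set} W (F : Finite A) (f : Fin W × Fin W × A → Fin W × Fin W × A → B) →
    concat (tabulate λ u → tabulate λ v → f (from (sites W F) u) (from (sites W F) v)) ≡
    concat (tabulate λ t → concat (tabulate λ s → enumerate F λ a →
      concat (tabulate λ t′ → concat (tabulate λ s′ → enumerate F λ a′ → f (t , s , a) (t′ , s′ , a′) ∷ []))))
  matrix-of-sites W F f =
    trans (concat-tabulate-cong λ u → tabulate-concat (λ v → f (from (sites W F) u) (from (sites W F) v)))
    (trans (enumerate-sites W F λ u → enumerate (sites W F) λ v → f u v ∷ [])
    (concat-tabulate-cong λ t → concat-tabulate-cong λ s → concat-tabulate-cong λ i →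
      enumerate-sites W F λ v → f (t , s , from F i) v ∷ []))

-- The reduction and its correctness

open FiniteTypes
open Finite
open Programs using (Outputs; program⇒polyTime)
open PerfectDivisibility using (colourable⇒perfectlyDivisible; perfectlyDivisible⇒colourable)
open Tilings using (Class; classOf; module Tiles)
open Colourings using (TileSystem; Rel; clamp; toℕ-clamp; module Gadgets)
open Printing using (hornerTime; time; module Printer)
open Polynomials

time-poly : ∀ {f g} → IsPolynomial f → IsPolynomial g → IsPolynomial (λ n → time (f n) (g n))
time-poly F G = F *-poly (const-poly 1 +-poly G) +-poly const-poly 1

horner-poly : ∀ p → IsPolynomial (hornerTime p)
horner-poly []      = const-poly 1
horner-poly (c ∷ p) = horner-poly p +-poly
  (time-poly id-poly (const-poly 1 +-poly (const-poly 2 +-poly (time-poly e (const-poly 5) +-poly time-poly e (const-poly 3)))) +-poly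
   (time-poly id-poly (const-poly 3) +-poly (time-poly e (const-poly 2) +-poly
    (time-poly (id-poly *-poly e) (const-poly 3) +-poly const-poly (c * 2 + 1)))))
  where e = eval-poly p

module _ {C : ℕ} (bits : Class → Class → Class → Class → Rel → Rel → Fin C → Fin C → Bool) (p r : Polynomial) where

  open Printer bits p r using (printerTime; rewindTime; siteTime; printTime)

  printer-poly : IsPolynomial printerTime
  printer-poly =
    time-poly id-poly (const-poly 3) +-poly rewind-poly id-poly +-poly (horner-poly p +-poly
    (time-poly (eval-poly p) (const-poly 7) +-poly (horner-poly r +-poly (time-poly (eval-poly r) (const-poly 7) +-poly (const-poly 6 +-poly
    (rewind-poly W +-poly (rewind-poly W +-poly (rewind-poly W +-poly (rewind-poly W +-poly (const-poly 4 +-poly (const-poly 4 +-poly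
    (printTime-poly +-poly rewind-poly (W *-poly (W *-poly (const-poly C *-poly (W *-poly (W *-poly const-poly C)))))))))))))))))
    where
    W : IsPolynomial (λ n → suc (eval r n + eval p n))
    W = const-poly 1 +-poly (eval-poly r +-poly eval-poly p)
    rewind-poly : ∀ {f} → IsPolynomial f → IsPolynomial (rewindTime ∘ f)
    rewind-poly F = const-poly 2 +-poly (time-poly F (const-poly 2) +-poly const-poly 2)
    siteTime-poly : IsPolynomial (λ n → siteTime (suc (eval r n + eval p n)))
    siteTime-poly = const-poly C *-poly
      (time-poly W (time-poly W (const-poly (C * 1 + 1 + 2)) +-poly (rewind-poly W +-poly const-poly 2)) +-poly rewind-poly W) +-poly const-poly 1
    printTime-poly : IsPolynomial (λ n → printTime (suc (eval r n + eval p n)))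
    printTime-poly = time-poly W (time-poly W (siteTime-poly +-poly const-poly 2) +-poly (rewind-poly W +-poly const-poly 2))

module Reduction (M : TM 2) (p r : Polynomial) where

  open Tiles M

  -- The 2m + 1 indices are odd in number and cover all tiles. The summand 2 makes every cycle of a
  -- site at least 5 long, which keeps it free of triangles.
  m : ℕ
  m = 2 + size finite-Tile

  defaultTile : Tile
  defaultTile = tile (TM.start M , replicate _ blank) nothing (replicate _ (blank , blank)) nothing

  -- Surplus indices repeat a default tile. This is harmless: every condition on an index is a
  -- condition on its tile, so a repetition adds no tiling.
  tileAt : Fin (suc (m + m)) → Tile
  tileAt i with toℕ i <? size finite-Tile
  ... | yes i< = from finite-Tile (fromℕ< i<)
  ... | no  _  = defaultTile

  indexOf : Tile → Fin (suc (m + m))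
  indexOf a = clamp (toℕ (to finite-Tile a))

  toℕ-indexOf : ∀ a → toℕ (indexOf a) ≡ toℕ (to finite-Tile a)
  toℕ-indexOf a = toℕ-clamp (ℕ.≤-trans (ℕ.<⇒≤ (Fin.toℕ<n (to finite-Tile a)))
    (ℕ.≤-trans (ℕ.m≤n+m (size finite-Tile) 2) (ℕ.m≤m+n m m)))

  tileAt-indexOf : ∀ a → tileAt (indexOf a) ≡ a
  tileAt-indexOf a with toℕ (indexOf a) <? size finite-Tile
  ... | yes i< = trans (cong (from finite-Tile) (Fin.toℕ-injective (trans (Fin.toℕ-fromℕ< i<) (toℕ-indexOf a))))
                       (from∘to finite-Tile a)
  ... | no i≮ = contradiction (subst (_< size finite-Tile) (sym (toℕ-indexOf a)) (Fin.toℕ<n (to finite-Tile a))) i≮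

  system : TileSystem (suc (m + m))
  system = record
    { Ok   = λ ρ κ a → Admissible ρ κ (tileAt a)
    ; ok?  = λ ρ κ a → admissible? ρ κ (tileAt a)
    ; Hor  = λ a b → Horizontal (tileAt a) (tileAt b)
    ; Ver  = λ a b → Vertical (tileAt a) (tileAt b)
    ; hor? = λ a b → horizontal? (tileAt a) (tileAt b)
    ; ver? = λ a b → vertical? (tileAt a) (tileAt b) }

  open Gadgets m system

  3≤m+m : 3 ≤ m + m
  3≤m+m = s≤s (s≤s (ℕ.≤-trans (s≤s z≤n) (ℕ.m≤n+m m (size finite-Tile))))

  C : ℕ
  C = size finite-Local

  bits : Class → Class → Class → Class → Rel → Rel → Fin C → Fin C → Bool
  bits ρ κ ρ′ κ′ d e ℓ ℓ′ = entry ρ κ ρ′ κ′ d e (from finite-Local ℓ) (from finite-Local ℓ′)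

  open Printer bits p r

  bound width : Word → ℕ
  bound x = eval p (length x)
  width x = eval r (length x) + eval p (length x)

  reduce : Word → Graph
  reduce x = graph 3≤m+m x (bound x) (width x)

  reduce-triangle-free : ∀ x → TriangleFree (reduce x)
  reduce-triangle-free x = graph-triangle-free 3≤m+m x (bound x) (width x)

  -- Once the enumeration of the vertices is unrolled the two sides agree by computation, as `bits`
  -- is `entry` on numbers of local vertices.
  encode-reduce : ∀ x → encodeGraph (reduce x) ≡ OnInput.matrix x
  encode-reduce x = matrix-of-sites (suc (width x)) finite-Local (adjacent 3≤m+m x (bound x) (width x))

  polyTime : PolyTime {1} (λ ws → encodeGraph (reduce (head ws)))
  polyTime = program⇒polyTime printer (proj₁ (printer-poly bits p r)) λ { (x ∷ []) →
    subst₂ (Outputs 1 12 printer (x ∷ []))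
      (trans (sym (proj₂ (printer-poly bits p r) (length x)))
        (cong (eval (proj₁ (printer-poly bits p r))) (sym (ℕ.+-identityʳ (length x)))))
      (sym (encode-reduce x)) (OnInput.printer-correct x) }

  tiling⇒divisible : ∀ x {τ} → Tiling (suc (width x)) (classOf x (bound x) (suc (width x))) τ → PerfectlyDivisible (reduce x)
  tiling⇒divisible x {τ} tiling = colourable⇒perfectlyDivisible (reduce x) (reduce-triangle-free x)
    (FromSelection.colouring 3≤m+m x (bound x) (width x) {σ = λ t s → indexOf (τ t s)} record
      { ok         = λ {t} {s} t≤ s≤ → subst (Admissible (κₓ t) (κₓ s)) (sym (tileAt-indexOf (τ t s))) (admissible (s≤s t≤) (s≤s s≤))
      ; horizontal = λ {t} {s} t≤ s≤ → subst₂ Horizontal (sym (tileAt-indexOf (τ t s))) (sym (tileAt-indexOf (τ t (suc s))))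
                       (horizontal (s≤s t≤) (s≤s s≤))
      ; vertical   = λ {t} {s} t≤ s≤ → subst₂ Vertical (sym (tileAt-indexOf (τ t s))) (sym (tileAt-indexOf (τ (suc t) s)))
                       (vertical (s≤s t≤) (s≤s s≤)) })
    where
    open Tiling tiling
    κₓ : ℕ → Class
    κₓ = classOf x (bound x) (suc (width x))

  divisible⇒tiling : ∀ x → PerfectlyDivisible (reduce x) →
    ∃[ τ ] Tiling (suc (width x)) (classOf x (bound x) (suc (width x))) τ
  divisible⇒tiling x divisible = (λ t s → tileAt (σ t s)) , record
    { admissible = λ { (s≤s t≤) (s≤s s≤) → ok t≤ s≤ }
    ; horizontal = λ { (s≤s t≤) (s≤s s≤) → horizontal t≤ s≤ }
    ; vertical   = λ { (s≤s t≤) (s≤s s≤) → vertical t≤ s≤ } }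
    where
    open FromColouring 3≤m+m x (bound x) (width x)
      (perfectlyDivisible⇒colourable (reduce x) (reduce-triangle-free x) divisible)
    open Selection selection

Outputs-by : TM 2 → Polynomial → Word → Word → Bool → Set
Outputs-by M q x u b = let open TM M in
  ∃[ t ] ∃[ d ] (initial (x ∷ u ∷ []) ⇓[ t ] d) × t ≤ eval q (length x + (length u + 0)) × output d ≡ b ∷ []

-- The width leaves room for every cell reachable within the running time of the verifier.
module Correctness (M : TM 2) (V : Word → Word → Bool) (p q r : Polynomial)
  (room : ∀ n → eval r n ≡ suc (n + eval q (n + eval p n)))
  (computes : ∀ x u → Outputs-by M q x u (V x u)) where

  open Reduction M p r
  open Tiles M

  -- The running time depends on the certificate. Monotonicity of `eval q` replaces its length by
  -- `bound x`, which makes one width serve all certificates.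
  fits : ∀ (x u : Word) {t} → length u ≤ bound x → t ≤ eval q (length x + (length u + 0)) →
    length x + bound x + t < suc (width x)
  fits x u {t} u≤ t≤ = s≤s (begin
    length x + bound x + t                                    ≤⟨ ℕ.+-monoʳ-≤ (length x + bound x) t≤′ ⟩
    length x + bound x + eval q (length x + bound x)          ≡⟨ ℕ.+-assoc (length x) (bound x) _ ⟩
    length x + (bound x + eval q (length x + bound x))        ≡⟨ cong (length x +_) (ℕ.+-comm (bound x) _) ⟩
    length x + (eval q (length x + bound x) + bound x)        ≡⟨ ℕ.+-assoc (length x) _ (bound x) ⟨
    length x + eval q (length x + bound x) + bound x          ≤⟨ ℕ.n≤1+n _ ⟩
    suc (length x + eval q (length x + bound x)) + bound x    ≡⟨ cong (_+ bound x) (room (length x)) ⟨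
    width x                                                   ∎)
    where
    open ℕ.≤-Reasoning
    t≤′ : t ≤ eval q (length x + bound x)
    t≤′ = ℕ.≤-trans t≤ (eval-mono q (ℕ.+-monoʳ-≤ (length x)
            (ℕ.≤-trans (ℕ.≤-reflexive (ℕ.+-identityʳ (length u))) u≤)))

  1<width : ∀ x → 1 < suc (width x)
  1<width x = s≤s (ℕ.≤-trans (ℕ.≤-trans (s≤s z≤n) (ℕ.≤-reflexive (sym (room (length x))))) (ℕ.m≤m+n _ (bound x)))

  complete : ∀ x u → length u ≤ bound x → V x u ≡ true → PerfectlyDivisible (reduce x)
  complete x u u≤ accepts = let t , d , run , t≤ , out = computes x u in
    tiling⇒divisible x (proj₂ (tiling-of-run x (bound x) (suc (width x)) u u≤ run
      (ℕ.<⇒≤ (fits x u u≤ t≤)) (trans out (cong (_∷ []) accepts))))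

  tiling⇒certificate : ∀ x {τ} → Tiling (suc (width x)) (classOf x (bound x) (suc (width x))) τ →
    ∃[ u ] length u ≤ bound x × V x u ≡ true
  tiling⇒certificate x tiling = S.u , S.u≤P , accepted (computes x S.u)
    where
    module S = Soundness x (bound x) (suc (width x)) tiling (1<width x)
      -- At the empty certificate and time 0, `fits` leaves the bare bound on `length x + bound x`.
      (ℕ.≤-trans (s≤s (ℕ.m≤m+n _ 0)) (fits x [] z≤n z≤n))
    accepted : Outputs-by M q x S.u (V x S.u) → V x S.u ≡ true
    accepted (t , d , run , t≤ , out) = List.∷-injectiveˡ (trans (sym out)
      (S.run-accepts run (ℕ.<⇒≤ space) (ℕ.≤-<-trans (ℕ.m≤n+m t _) space)))
      where
      space : length x + bound x + t < suc (width x)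
      space = fits x S.u S.u≤P t≤

  sound : ∀ x → PerfectlyDivisible (reduce x) → ∃[ u ] length u ≤ bound x × V x u ≡ true
  sound x divisible = tiling⇒certificate x (proj₂ (divisible⇒tiling x divisible))

theorem5 : NPHard TriangleFreePerfectDivisibility
theorem5 L (V , p , (M , q , computes) , L⇔) =
  (λ x → reduce x , reduce-triangle-free x) , polyTime ,
  λ x → mk⇔
    (λ Lx → let u , u≤ , accepts = Equivalence.to (L⇔ x) Lx in complete x u u≤ accepts)
    (λ divisible → Equivalence.from (L⇔ x) (sound x divisible))
  where
  -- `n + eval p n` bounds the joint length of the word and a certificate, so `eval q` of it bounds
  -- the verifier's time on every admissible certificate.
  room : IsPolynomial (λ n → suc (n + eval q (n + eval p n)))
  room = const-poly 1 +-poly (id-poly +-poly eval-∘-poly q (id-poly +-poly eval-poly p))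
  open Reduction M p (proj₁ room)
  open Correctness M V p q (proj₁ room) (proj₂ room) (λ x u → computes (x ∷ u ∷ []))
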